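{- (1) If $q=2^n$ with $n$ even, then every maximal clique of $\Gamma$ has size $q$ or $4$; when $q>4$, the maximal cliques of size $q$ are linear and the maximal cliques of size $4$ are non-linear. (2) If $q=2^n>2$ with $n$ odd, then every maximal clique of $\Gamma$ has size $q$ or $6$; the cliques of size $q$ are linear and the maximal cliques of size $6$ are non-linear. (3) For every $q$, every non-linear $3$-clique of $\Gamma$ is contained in exactly $q+1$ non-linear $4$-cliques. (4) If $n$ is odd, then every non-linear $4$-clique is contained in exactly two $5$-cliques of $\Gamma$, and every non-linear $5$-clique is contained in exactly one $6$-clique of $\Gamma$.
   Context: Let $q=2^n$ and let $Q_0\cong Q(4,q)$ be the parabolic quadric generalized quadrangle in $\mathrm{PG}(4,q)$. An elliptic ovoid of $Q_0$ is a set $X=S\cap Q_0$ where $S$ is a $3$-dimensional projective subspace meeting $Q_0$ in an elliptic quadric $Q^-(3,q)$. Two distinct elliptic ovoids meet in one point (then they are tangent) or in a conic. A rosette based at $p\in Q_0$ is a set of $q$ elliptic ovoids pairwise meeting exactly in $\{p\}$. $\Gamma$ is the graph whose vertices are the elliptic ovoids of $Q_0$, adjacent iff distinct and tangent. A clique of $\Gamma$ is linear if it is contained in some rosette, non-linear otherwise; an $i$-clique is a clique with $i$ vertices. -}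

module Defs where

open import Algebra.Apartness.Bundles using (HeytingField; HeytingCommutativeRing)
open import Algebra.Bundles using (CommutativeRing)
open import Data.Fin.Base using (Fin)
open import Data.Fin.Patterns using (0F; 1F; 2F; 3F; 4F)
open import Data.List.Base using (List; length)
open import Data.List.Relation.Unary.AllPairs using (AllPairs)
import Data.List.Relation.Binary.Subset.Setoid as Subset
open import Data.List.Relation.Binary.Subset.Setoid.Properties using (⊆-preorder)
open import Data.Nat.Base using (ℕ; suc)
open import Data.Product.Base using (Σ; ∃-syntax; _×_; proj₁)
open import Data.Vec.Functional using (Vector)
open import Function.Bundles using (Inverse)
open import Level using (Level; _⊔_) renaming (suc to lsuc)
open import Relation.Binary.Bundles using (Setoid)
open import Relation.Binary.PropositionalEquality.Core using (_≡_)
import Relation.Binary.Construct.On as On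
import Relation.Binary.PropositionalEquality.Properties as ≡
open import Relation.Binary.Properties.Preorder using (InducedEquivalence)
open import Relation.Nullary.Negation using (¬_)
open import Relation.Unary using (Pred; _∈_; _∩_; _≐_)
open import Relation.Unary.Properties using (≐-refl; ≐-sym; ≐-trans)

HasCardinality : ∀ {a ℓ} → Setoid a ℓ → ℕ → Set (a ⊔ ℓ)
HasCardinality S k = Inverse S (≡.setoid (Fin k))

subsetoid : ∀ {a ℓ p} (S : Setoid a ℓ) → Pred (Setoid.Carrier S) p → Setoid (a ⊔ p) ℓ
subsetoid S P = On.setoid {B = Σ (Setoid.Carrier S) P} S proj₁

-- Over a finite field the equality is decidable, so x # y is the same as
-- ¬ (x ≈ y) and a Heyting field is just a field.

module ProjectiveSpace {c ℓ₁ ℓ₂} (F : HeytingField c ℓ₁ ℓ₂) where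

  open HeytingField F
  open HeytingCommutativeRing heytingCommutativeRing using (commutativeRing)
  open import Algebra.Properties.CommutativeMonoid.Sum
    (CommutativeRing.+-commutativeMonoid commutativeRing) using (sum)
  open import Data.Vec.Functional.Relation.Binary.Equality.Setoid
    (CommutativeRing.setoid commutativeRing) using (_≋_)

  combination : ∀ {k m} → Vector Carrier k → Vector (Vector Carrier m) k → Vector Carrier m
  combination x e j = sum (λ i → x i * e i j)

  LinearlyIndependent : ∀ {k m} → Vector (Vector Carrier m) k → Set (c ⊔ ℓ₁)
  LinearlyIndependent {k} e =
    (x : Vector Carrier k) → combination x e ≋ (λ _ → 0#) → x ≋ (λ _ → 0#)

  -- Points of PG(d, F), in homogeneous coordinates.
  record Point (d : ℕ) : Set (c ⊔ ℓ₂) where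
    field
      vec     : Vector Carrier (suc d)
      nonzero : ∃[ i ] vec i # 0#

  open Point public

  infix 4 _∼_
  _∼_ : ∀ {d} → Point d → Point d → Set (c ⊔ ℓ₁ ⊔ ℓ₂)
  p ∼ p′ = ∃[ t ] t # 0# × vec p ≋ (λ i → t * vec p′ i)

  PointSet : ℕ → (r : Level) → Set (c ⊔ ℓ₂ ⊔ lsuc r)
  PointSet d r = Pred (Point d) r

  singleton : ∀ {d} → Point d → PointSet d (c ⊔ ℓ₁ ⊔ ℓ₂)
  singleton p p′ = p′ ∼ p

  -- k-dimensional projective subspaces of PG(d, F); a subspace is presented
  -- by a basis, and two presentations are compared through their spans.
  record Subspace (k d : ℕ) : Set (c ⊔ ℓ₁) where
    field
      basis       : Vector (Vector Carrier (suc d)) (suc k)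
      independent : LinearlyIndependent basis

  open Subspace public

  span : ∀ {k d} → Subspace k d → PointSet d (c ⊔ ℓ₁)
  span S p = ∃[ x ] vec p ≋ combination x (basis S)

  -- The zero locus of f, where f is read in the coordinates given by the
  -- basis of S.
  zeroLocus : ∀ {k d} → Subspace k d → (Vector Carrier (suc k) → Carrier) →
              PointSet d (c ⊔ ℓ₁)
  zeroLocus S f p = ∃[ x ] vec p ≋ combination x (basis S) × f x ≈ 0#

  parabolicForm : Vector Carrier 5 → Carrier
  parabolicForm x = x 0F * x 0F + x 1F * x 2F + x 3F * x 4F

  -- Q(4,q): a quadric of PG(4,q) that becomes x₀² + x₁x₂ + x₃x₄ = 0 in some
  -- basis of the whole space.
  IsParabolicQuadric : ∀ {r} → PointSet 4 r → Set (c ⊔ ℓ₁ ⊔ ℓ₂ ⊔ r)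
  IsParabolicQuadric X = ∃[ E ] X ≐ zeroLocus {4} {4} E parabolicForm

  -- αX² + βXY + γY² is not a product of two linear forms.
  IrreducibleBinaryForm : Carrier → Carrier → Carrier → Set (c ⊔ ℓ₁)
  IrreducibleBinaryForm α β γ =
    ¬ (∃[ l₀ ] ∃[ l₁ ] ∃[ m₀ ] ∃[ m₁ ]
         α ≈ l₀ * m₀ × β ≈ l₀ * m₁ + l₁ * m₀ × γ ≈ l₁ * m₁)

  ellipticForm : Carrier → Carrier → Carrier → Vector Carrier 4 → Carrier
  ellipticForm α β γ x =
    x 0F * x 1F + (α * (x 2F * x 2F) + β * (x 2F * x 3F) + γ * (x 3F * x 3F))

  -- Q⁻(3,q): a quadric of the solid S that becomes x₀x₁ + f(x₂,x₃) = 0, with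
  -- f an irreducible binary quadratic form, in some basis of S.
  IsEllipticQuadricIn : ∀ {d r} → Subspace 3 d → PointSet d r → Set (c ⊔ ℓ₁ ⊔ ℓ₂ ⊔ r)
  IsEllipticQuadricIn S X =
    ∃[ E ] span E ≐ span S ×
    ∃[ α ] ∃[ β ] ∃[ γ ] IrreducibleBinaryForm α β γ ×
    X ≐ zeroLocus {3} E (ellipticForm α β γ)

open ProjectiveSpace public using (PointSet; IsParabolicQuadric)

module EllipticOvoids {c ℓ₁ ℓ₂ r} (F : HeytingField c ℓ₁ ℓ₂)
                      (Q₀ : PointSet F 4 r) (q : ℕ) where

  open ProjectiveSpace F hiding (PointSet; IsParabolicQuadric)

  private
    ℓ : Level
    ℓ = c ⊔ ℓ₁ ⊔ ℓ₂ ⊔ r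

  record EllipticOvoid : Set ℓ where
    field
      solid    : Subspace 3 4
      elliptic : IsEllipticQuadricIn solid (span solid ∩ Q₀)

    points : PointSet F 4 (c ⊔ ℓ₁ ⊔ r)
    points = span solid ∩ Q₀

  open EllipticOvoid public

  -- An ovoid is its set of points: equality ignores how it is presented.
  -- (A record, so that X and Y can be inferred from a proof of X ≈ₒ Y.)
  infix 4 _≈ₒ_
  record _≈ₒ_ (X Y : EllipticOvoid) : Set ℓ where
    constructor mk≈ₒ
    field
      samePoints : points X ≐ points Y

  open _≈ₒ_ public

  ovoidSetoid : Setoid ℓ ℓ
  ovoidSetoid = record
    { Carrier       = EllipticOvoid
    ; _≈_           = _≈ₒ_
    ; isEquivalence = record
      { refl  = λ {X} → mk≈ₒ (≐-refl {x = points X})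
      ; sym   = λ {X} {Y} X≈Y → mk≈ₒ
          (≐-sym {x = points X} {y = points Y} (samePoints X≈Y))
      ; trans = λ {X} {Y} {Z} X≈Y Y≈Z → mk≈ₒ
          (≐-trans {i = points X} {j = points Y} {k = points Z}
            (samePoints X≈Y) (samePoints Y≈Z))
      }
    }

  open Subset ovoidSetoid public using (_⊆_)

  MeetExactlyIn : Point 4 → EllipticOvoid → EllipticOvoid → Set ℓ
  MeetExactlyIn p X Y = points X ∩ points Y ≐ singleton p

  Tangent : EllipticOvoid → EllipticOvoid → Set ℓ
  Tangent X Y = ∃[ p ] MeetExactlyIn p X Y

  Adjacent : EllipticOvoid → EllipticOvoid → Set ℓ
  Adjacent X Y = ¬ (X ≈ₒ Y) × Tangent X Y

  -- Finite sets of ovoids are lists without repetitions, so that length is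
  -- the cardinality; their order is disregarded by finiteSetSetoid.

  Rosette : Point 4 → List EllipticOvoid → Set ℓ
  Rosette p R = length R ≡ q × AllPairs (λ X Y → ¬ (X ≈ₒ Y) × MeetExactlyIn p X Y) R

  Clique : List EllipticOvoid → Set ℓ
  Clique = AllPairs Adjacent

  MaximalClique : List EllipticOvoid → Set ℓ
  MaximalClique C = Clique C × (∀ D → Clique D → C ⊆ D → D ⊆ C)

  Linear : List EllipticOvoid → Set ℓ
  Linear C = ∃[ p ] p ∈ Q₀ × ∃[ R ] Rosette p R × C ⊆ R

  NonLinear : List EllipticOvoid → Set ℓ
  NonLinear C = ¬ Linear C

  CliqueOfSize : ℕ → List EllipticOvoid → Set ℓ
  CliqueOfSize i C = Clique C × length C ≡ i

  NonLinearCliqueOfSize : ℕ → List EllipticOvoid → Set ℓ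
  NonLinearCliqueOfSize i = CliqueOfSize i ∩ NonLinear

  -- Equality is mutual inclusion.
  finiteSetSetoid : Setoid ℓ ℓ
  finiteSetSetoid = InducedEquivalence (⊆-preorder ovoidSetoid)

  ContainedInExactly : ℕ → Pred (List EllipticOvoid) ℓ → List EllipticOvoid → Set ℓ
  ContainedInExactly k P C =
    HasCardinality (subsetoid finiteSetSetoid (λ D → P D × C ⊆ D)) k

-- In characteristic 2 write the points of the quadric x₀² + x₁x₂ + x₃x₄ = 0 as (x₀, z). The line through
-- the nucleus (1, 0) and any point meets the quadric once, whence the solid of an elliptic ovoid avoids
-- the nucleus and is a graph x₀ = B(a, z), B being the polar form of z₁z₂ + z₃z₄. So ovoids correspond to
-- those a ∈ K⁴ for which Q_a(z) = B(a, z)² + z₁z₂ + z₃z₄ is elliptic, and a, b are tangent iff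
-- Q_a(a + b) = 0. Since Q_{a+x} is the transform of Q_a by a transvection if Q_a(x) = 0, the neighbours of
-- a are the a + x with Q_a(x) = 0, and a + x, a + y are tangent iff B(x, y) ∈ {0, 1}. In a clique through a
-- either all these products vanish, and the x are proportional because Q_a contains no lines (the clique
-- lies in a rosette), or all of them are 1. In the second case take a basis e, f, g, h of K⁴ where e, f
-- are singular with B(e, f) = 1 and lead to the second and third vertex, and where Q_a restricted to the
-- orthogonal plane ⟨g, h⟩ is N(α, β) = α² + αβ + εβ², with ε not of the form s² + s. The further vertices
-- are a + e + f + αg + βh with N(α, β) = 1, a conic with q + 1 points, two of them being tangent iff
-- αβ′ + α′β = 1. Taking (1, 0) for the fourth vertex, a fifth one is (s, 1) with s² + s = ε + 1; this is
-- solvable (then by s and s + 1, which are tangent) iff 1 is not of the form s² + s, that is, iff n is odd.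

module Submission where

open import Defs
import Algebra.Apartness.Properties.HeytingCommutativeRing as HeytingProperties
open import Algebra.Apartness.Bundles using (HeytingField; HeytingCommutativeRing)
open import Algebra.Bundles using (CommutativeRing; RawRing)
import Algebra.Morphism.RingMonomorphism as RingMonomorphism
open import Algebra.Morphism.Structures using (IsRingMonomorphism)
import Algebra.Properties.CommutativeMonoid.Sum as FiniteSum
import Algebra.Properties.Group as GroupProperties
import Algebra.Properties.Monoid.Mult as Mult
import Algebra.Properties.Semiring.Sum as SemiringSum
open import Algebra.Structures using (IsCommutativeSemiring)
open import Data.Bool.Base using (Bool; true; false; if_then_else_)
open import Data.Fin.Base using (Fin; zero; suc; punchOut; combine)
import Data.Fin.Base as Fin
open import Data.Fin.Patterns using (0F; 1F; 2F; 3F; 4F)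
open import Data.Fin.Permutation using (Permutation′; permutation)
import Data.Fin.Properties as Fin
open import Data.List.Base using (List; []; _∷_; foldr; length; tabulate)
import Data.List.Membership.DecSetoid as DecMembership
import Data.List.Membership.Setoid as Membership
open import Data.List.Membership.Setoid.Properties using (∈-resp-≈)
open import Data.List.Properties using (length-tabulate)
import Data.List.Relation.Binary.Subset.Setoid as Subset
open import Data.List.Relation.Binary.Subset.Setoid.Properties using (⊆-preorder)
open import Data.List.Relation.Unary.All as All using (All; []; _∷_)
open import Data.List.Relation.Unary.All.Properties using (¬All⇒Any¬)
open import Data.List.Relation.Unary.AllPairs as AllPairs using (AllPairs; []; _∷_)
import Data.List.Relation.Unary.AllPairs.Properties as AllPairs
open import Data.List.Relation.Unary.Any using (here; there)
import Data.List.Relation.Unary.Any.Properties as Any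
open import Data.Nat.Base using (ℕ; zero; suc; _≤_; _<_; _>_; _^_; z≤n; s≤s)
import Data.Nat.Base as ℕ
open import Data.Nat.DivMod using (_%_; _/_; m≡m%n+[m/n]*n; m%n<n; %-distribˡ-*; [m+kn]%n≡m%n)
open import Data.Nat.Divisibility using (_∣_; _∤_; divides; m%n≡0⇒n∣m)
import Data.Nat.Properties as ℕ
open import Data.Product.Base using (∃-syntax; _×_; _,_; proj₁; proj₂; uncurry)
open import Data.Product.Function.NonDependent.Propositional using (_×-↔_)
open import Data.Sum.Base as Sum using (_⊎_; inj₁; inj₂)
open import Data.Vec.Base as Vec using (Vec)
open import Data.Vec.Functional using (Vector; replicate)
import Data.Vec.Functional.Relation.Binary.Equality.Setoid as VectorEquality
open import Data.Vec.N-ary using (N-ary; _$ⁿ_; curryⁿ; curryⁿ-cong; Eq)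
open import Function.Base using (_∘_; id)
open import Function.Bundles using (Inverse; _↔_; mk↔ₛ′)
open import Function.Construct.Composition using (_↔-∘_)
open import Function.Construct.Identity using (↔-id)
open import Function.Construct.Symmetry using (↔-sym)
open import Function.Definitions using (Injective)
open import Level using (_⊔_)
open import Relation.Binary.Bundles using (Setoid; DecSetoid)
open import Relation.Binary.Core using (Rel)
open import Relation.Binary.Definitions using (Decidable; Symmetric; _Respectsʳ_)
open import Relation.Binary.Properties.Preorder using (InducedEquivalence)
open import Relation.Binary.PropositionalEquality using (_≡_; _≢_; refl; sym; trans; cong; cong₂; subst; subst₂; module ≡-Reasoning)
import Relation.Binary.Reasoning.Setoid as SetoidReasoning
open import Relation.Nullary using (Dec; yes; no; does; ¬_; ¬?; map′)
open import Relation.Nullary.Decidable using (_×-dec_; decidable-stable)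
open import Relation.Nullary.Negation using (contradiction)
open import Relation.Unary using (Pred; _≐_) renaming (_∈_ to _∈ᵖ_)
open import Relation.Unary.Properties using (≐-refl)

-- The parity of `n` enters only through `q` modulo 3. The equation `s² + s = 1` describes the
-- primitive cube roots of unity; together with `0` and `1` they are the fixed points of a map of
-- order three on the field, so that `q` is congruent to 4 or to 2 modulo 3 according to whether
-- they exist.
--
-- An elliptic ovoid is given as a point set only: the quadric and the elliptic form on the solid
-- have the same zeros, but nothing is said about the forms being proportional. That the solid
-- avoids the nucleus and that `Q_a` contains no line must therefore be drawn from zeros alone.
-- Conversely, a section determines its pole because an elliptic form has a basis of singular
-- vectors.
--
-- Dimension theory is replaced by counting: an injective map of a finite set to itself is onto.
-- This yields square roots, inverses, coordinates with respect to a basis and the graph form of a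
-- solid. To have it at hand, the given field is exchanged for an isomorphic one on `Fin q`.

-- Injections of finite sets

injective⇒surjective : ∀ {n} {f : Fin n → Fin n} → Injective _≡_ _≡_ f →
                       ∀ y → ∃[ x ] f x ≡ y
injective⇒surjective {suc n} {f} f-inj y with Fin.any? (λ x → f x Fin.≟ y)
... | yes hit = hit
... | no miss = contradiction (Fin.injective⇒≤ g-inj) ℕ.1+n≰n
  where
  avoid : ∀ x → y ≢ f x
  avoid x y≡fx = miss (x , sym y≡fx)
  g-inj : Injective _≡_ _≡_ (λ x → punchOut (avoid x))
  g-inj = f-inj ∘ Fin.punchOut-injective (avoid _) (avoid _)

module _ {a} {A : Set a} {n} (A↔Fin : A ↔ Fin n) where
  open Inverse A↔Fin

  private
    to-inj : Injective _≡_ _≡_ to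
    to-inj {i} {j} eq = trans (sym (strictlyInverseʳ i)) (trans (cong from eq) (strictlyInverseʳ j))

  finite-injective⇒surjective : {f : A → A} → Injective _≡_ _≡_ f → ∀ y → ∃[ x ] f x ≡ y
  finite-injective⇒surjective {f} f-inj y
    with x , e ← injective⇒surjective {f = to ∘ f ∘ from} (λ {i} {j} eq →
           trans (sym (strictlyInverseˡ i)) (trans (cong to (f-inj (to-inj eq))) (strictlyInverseˡ j)))
           (to y)
    = from x , to-inj e

-- Maps of order three

open FiniteSum ℕ.+-0-commutativeMonoid
  using () renaming (sum to ∑; sum-cong-≗ to ∑-cong; sum-permute to ∑-permute; ∑-distrib-+ to ∑-+)

indicator : ∀ {p} {P : Set p} → Dec P → ℕ
indicator d = if does d then 1 else 0

indicator-yes : ∀ {p} {P : Set p} (d : Dec P) → P → indicator d ≡ 1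
indicator-yes (yes _) _ = refl
indicator-yes (no ¬p) p = contradiction p ¬p

indicator-no : ∀ {p} {P : Set p} (d : Dec P) → ¬ P → indicator d ≡ 0
indicator-no (yes p) ¬p = contradiction p ¬p
indicator-no (no _) _ = refl

∑-zero : ∀ {n} → ∑ {n} (λ _ → 0) ≡ 0
∑-zero {zero} = refl
∑-zero {suc n} = ∑-zero {n}

∑-one : ∀ {n} → ∑ {n} (λ _ → 1) ≡ n
∑-one {zero} = refl
∑-one {suc n} = cong suc (∑-one {n})

∑-indicator : ∀ {n} (y : Fin n) → ∑ (λ x → indicator (x Fin.≟ y)) ≡ 1
∑-indicator {suc n} zero = cong suc (∑-zero {n})
∑-indicator {suc n} (suc y) = ∑-indicator y

-- On an orbit of size three, least singles out one element.
least : ∀ {n} → Fin n → Fin n → Fin n → ℕ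
least a b c = indicator (a Fin.<? b) ℕ.* indicator (a Fin.<? c)

-- Three distinct numbers have exactly one minimum. The six comparisons are made independent
-- arguments, so that each pattern of outcomes is either one of the six orders or contradictory.
least-cyclic : ∀ {n} (a b c : Fin n) → a ≢ b → b ≢ c → c ≢ a →
               least a b c ℕ.+ (least b c a ℕ.+ least c a b) ≡ 1
least-cyclic a b c a≢b b≢c c≢a =
  cases (a Fin.<? b) (b Fin.<? c) (c Fin.<? a) (a Fin.<? c) (b Fin.<? a) (c Fin.<? b)
  where
  cases : (ab : Dec (a Fin.< b)) (bc : Dec (b Fin.< c)) (ca : Dec (c Fin.< a))
          (ac : Dec (a Fin.< c)) (ba : Dec (b Fin.< a)) (cb : Dec (c Fin.< b)) →
          indicator ab ℕ.* indicator ac ℕ.+ (indicator bc ℕ.* indicator ba ℕ.+ indicator ca ℕ.* indicator cb) ≡ 1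
  cases (yes p) _ _ _ (yes q) _ = contradiction q (Fin.<-asym p)
  cases _ (yes p) _ _ _ (yes q) = contradiction q (Fin.<-asym p)
  cases _ _ (yes p) (yes q) _ _ = contradiction q (Fin.<-asym p)
  cases (no p) _ _ _ (no q) _ = contradiction (Fin.≤-antisym (ℕ.≮⇒≥ q) (ℕ.≮⇒≥ p)) a≢b
  cases _ (no p) _ _ _ (no q) = contradiction (Fin.≤-antisym (ℕ.≮⇒≥ q) (ℕ.≮⇒≥ p)) b≢c
  cases _ _ (no p) (no q) _ _ = contradiction (Fin.≤-antisym (ℕ.≮⇒≥ q) (ℕ.≮⇒≥ p)) c≢a
  cases (yes p) (yes q) (yes r) (no _) (no _) (no _) = contradiction (Fin.<-trans p q) (Fin.<-asym r)
  cases (no _) (no _) (no _) (yes p) (yes q) (yes r) = contradiction (Fin.<-trans p r) (Fin.<-asym q)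
  cases (yes _) (yes _) (no _) (yes _) (no _) (no _) = refl
  cases (yes _) (no _) (yes _) (no _) (no _) (yes _) = refl
  cases (yes _) (no _) (no _) (yes _) (no _) (yes _) = refl
  cases (no _) (yes _) (yes _) (no _) (yes _) (no _) = refl
  cases (no _) (yes _) (no _) (yes _) (yes _) (no _) = refl
  cases (no _) (no _) (yes _) (no _) (yes _) (yes _) = refl

module _ {n} (f : Fin n → Fin n) (f³ : ∀ x → f (f (f x)) ≡ x) where

  private
    π : Permutation′ n
    π = permutation f (f ∘ f) f³ f³

    c : Fin n → ℕ
    c x = least x (f x) (f (f x))

    -- The comparisons in `least` are strict, so `c` vanishes at a fixed point. Every `x` is thus
    -- counted once, either through its orbit or as a fixed point.
    orbit : ∀ x → c x ℕ.+ (c (f x) ℕ.+ c (f (f x))) ℕ.+ indicator (f x Fin.≟ x) ≡ 1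
    orbit x rewrite f³ x with f x Fin.≟ x
    ... | yes p rewrite p | p | indicator-no (x Fin.<? x) (Fin.<-irrefl refl) = refl
    ... | no p = trans (ℕ.+-identityʳ _) (least-cyclic x (f x) (f (f x)) (p ∘ sym)
                   (λ e → p (sym (trans (sym (f³ x)) (trans (cong (f ∘ f) e) (cong f (f³ x))))))
                   (λ e → p (trans (sym (cong f e)) (f³ x))))

  -- Points outside the fixed ones come in orbits of size three.
  order3-fixedPoints : ∃[ N ] n ≡ 3 ℕ.* N ℕ.+ ∑ (λ x → indicator (f x Fin.≟ x))
  order3-fixedPoints = ∑ c , (begin
      n                                              ≡⟨ ∑-one ⟨
      ∑ {n} (λ _ → 1)                                ≡⟨ ∑-cong orbit ⟨
      ∑ (λ x → c x ℕ.+ (c (f x) ℕ.+ c (f (f x))) ℕ.+ δ x) ≡⟨ ∑-+ _ δ ⟩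
      ∑ (λ x → c x ℕ.+ (c (f x) ℕ.+ c (f (f x)))) ℕ.+ ∑ δ ≡⟨ cong (ℕ._+ ∑ δ) step ⟩
      3 ℕ.* ∑ c ℕ.+ ∑ δ                              ∎)
    where
    open ≡-Reasoning
    δ : Fin n → ℕ
    δ x = indicator (f x Fin.≟ x)
    ∑cf : ∑ (c ∘ f) ≡ ∑ c
    ∑cf = sym (∑-permute c π)
    step : ∑ (λ x → c x ℕ.+ (c (f x) ℕ.+ c (f (f x)))) ≡ 3 ℕ.* ∑ c
    step = trans (∑-+ c _) (cong (∑ c ℕ.+_) (trans (∑-+ (c ∘ f) (c ∘ f ∘ f))
      (cong₂ ℕ._+_ ∑cf (trans (trans (sym (∑-permute (c ∘ f) π)) ∑cf) (sym (ℕ.+-identityʳ _))))))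

-- Fields of characteristic 2 and a solver for their polynomial identities

-- By `x+x≡0` every element is its own negative, so a commutative semiring is already a ring here.
-- The carrier is `Fin q` to make equality decidable and counting possible.
record FiniteField₂ (q : ℕ) : Set where
  infixl 7 _*_
  infixl 6 _+_
  infix 8 _⁻¹
  K : Set
  K = Fin q
  field
    _+_ _*_               : K → K → K
    0# 1#                 : K
    _⁻¹                   : K → K
    isCommutativeSemiring : IsCommutativeSemiring _≡_ _+_ _*_ 0# 1#
    x+x≡0                 : ∀ x → x + x ≡ 0#
    1≢0                   : 1# ≢ 0#
    *-inverseʳ            : ∀ {x} → x ≢ 0# → x * x ⁻¹ ≡ 1#

-- A polynomial over 𝔽₂ is normalised to the sorted list of its monomials, a monomial being the sorted
-- list of its variables. Soundness does not depend on the order.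
module Polynomials where

  infixl 6 _:+_
  infixl 7 _:*_
  infix 4 _:=_

  data Expr (n : ℕ) : Set where
    var       : Fin n → Expr n
    con       : Bool → Expr n
    _:+_ _:*_ : Expr n → Expr n → Expr n

  :0 :1 : ∀ {n} → Expr n
  :0 = con false
  :1 = con true

  _:=_ : ∀ {n} → Expr n → Expr n → Expr n × Expr n
  _:=_ = _,_

  Monomial Polynomial : ℕ → Set
  Monomial n   = List (Fin n)
  Polynomial n = List (Monomial n)

  -- Only `equal` carries a proof: soundness has to know when two monomials cancel, while a wrong
  -- order could merely keep equal polynomials from having the same normal form.
  data Comparison {A : Set} (x y : A) : Set where
    less greater : Comparison x y
    equal        : x ≡ y → Comparison x y

  compare : ∀ {n} (m m′ : Monomial n) → Comparison m m′
  compare [] [] = equal refl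
  compare [] (_ ∷ _) = less
  compare (_ ∷ _) [] = greater
  compare (i ∷ m) (j ∷ m′) with i Fin.≟ j
  ... | no _ = if Fin.toℕ i ℕ.<ᵇ Fin.toℕ j then less else greater
  ... | yes refl with compare m m′
  ... | less = less
  ... | greater = greater
  ... | equal refl = equal refl

  insert : ∀ {n} → Monomial n → Polynomial n → Polynomial n
  insert m [] = m ∷ []
  insert m (m′ ∷ p) with compare m m′
  ... | less    = m ∷ m′ ∷ p
  ... | greater = m′ ∷ insert m p
  -- Equal monomials cancel in characteristic 2.
  ... | equal _ = p

  insertVar : ∀ {n} → Fin n → Monomial n → Monomial n
  insertVar i [] = i ∷ []
  -- Repeated variables are kept, because `x * x` differs from `x` in a general field of
  -- characteristic 2.
  insertVar i (j ∷ m) = if Fin.toℕ i ℕ.≤ᵇ Fin.toℕ j then i ∷ j ∷ m else j ∷ insertVar i m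

  add mul : ∀ {n} → Polynomial n → Polynomial n → Polynomial n
  add p p′ = foldr insert p′ p
  mul p p′ = foldr (λ m r → foldr (λ m′ → insert (foldr insertVar m′ m)) r p′) [] p

  normalise : ∀ {n} → Expr n → Polynomial n
  normalise (var i)     = (i ∷ []) ∷ []
  normalise (con true)  = [] ∷ []
  normalise (con false) = []
  normalise (e :+ e′)   = add (normalise e) (normalise e′)
  normalise (e :* e′)   = mul (normalise e) (normalise e′)

module 𝔽₂-Solver {A : Set} {_+_ _*_ : A → A → A} {0# 1# : A}
  (isCommutativeSemiring : IsCommutativeSemiring _≡_ _+_ _*_ 0# 1#)
  (x+x≡0 : ∀ x → x + x ≡ 0#) where

  open IsCommutativeSemiring isCommutativeSemiring
    using (+-identityˡ; +-identityʳ; *-identityˡ; +-comm; *-comm; +-assoc; *-assoc; zeroˡ; distribˡ; distribʳ)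
  open Polynomials
  open ≡-Reasoning

  ⟦_⟧ : ∀ {n} → Expr n → Vec A n → A
  ⟦ var i ⟧     ρ = Vec.lookup ρ i
  ⟦ con true ⟧  ρ = 1#
  ⟦ con false ⟧ ρ = 0#
  ⟦ e :+ e′ ⟧   ρ = ⟦ e ⟧ ρ + ⟦ e′ ⟧ ρ
  ⟦ e :* e′ ⟧   ρ = ⟦ e ⟧ ρ * ⟦ e′ ⟧ ρ

  private module _ {n} (ρ : Vec A n) where

    monomial : Monomial n → A
    monomial [] = 1#
    monomial (i ∷ m) = Vec.lookup ρ i * monomial m

    polynomial : Polynomial n → A
    polynomial [] = 0#
    polynomial (m ∷ p) = monomial m + polynomial p

    swap : ∀ x y z → y + (x + z) ≡ x + (y + z)
    swap x y z = trans (sym (+-assoc y x z)) (trans (cong (_+ z) (+-comm y x)) (+-assoc x y z))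

    insert-sound : ∀ m p → polynomial (insert m p) ≡ monomial m + polynomial p
    insert-sound m [] = refl
    insert-sound m (m′ ∷ p) with compare m m′
    ... | less       = refl
    ... | greater    = trans (cong (monomial m′ +_) (insert-sound m p)) (swap _ _ _)
    ... | equal refl = sym (trans (sym (+-assoc _ _ _)) (trans (cong (_+ polynomial p) (x+x≡0 (monomial m))) (+-identityˡ _)))

    insertVar-sound : ∀ i m → monomial (insertVar i m) ≡ Vec.lookup ρ i * monomial m
    insertVar-sound i [] = refl
    insertVar-sound i (j ∷ m) with Fin.toℕ i ℕ.≤ᵇ Fin.toℕ j
    ... | true  = refl
    ... | false = trans (cong (Vec.lookup ρ j *_) (insertVar-sound i m))
                    (trans (sym (*-assoc _ _ _)) (trans (cong (_* monomial m) (*-comm _ _)) (*-assoc _ _ _)))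

    add-sound : ∀ p p′ → polynomial (add p p′) ≡ polynomial p + polynomial p′
    add-sound [] p′ = sym (+-identityˡ _)
    add-sound (m ∷ p) p′ = trans (insert-sound m (add p p′)) (trans (cong (monomial m +_) (add-sound p p′)) (sym (+-assoc _ _ _)))

    times-sound : ∀ m m′ → monomial (foldr insertVar m′ m) ≡ monomial m * monomial m′
    times-sound [] m′ = sym (*-identityˡ _)
    times-sound (i ∷ m) m′ = trans (insertVar-sound i (foldr insertVar m′ m)) (trans (cong (Vec.lookup ρ i *_) (times-sound m m′)) (sym (*-assoc _ _ _)))

    scale-sound : ∀ m r p′ → polynomial (foldr (λ m′ → insert (foldr insertVar m′ m)) r p′) ≡ (monomial m * polynomial p′) + polynomial r
    scale-sound m r [] = sym (trans (cong (_+ polynomial r) (trans (*-comm _ _) (zeroˡ _))) (+-identityˡ _))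
    scale-sound m r (m′ ∷ p′) = trans (insert-sound (foldr insertVar m′ m) (foldr (λ m′ → insert (foldr insertVar m′ m)) r p′)) (trans (cong₂ _+_ (times-sound m m′) (scale-sound m r p′))
      (trans (sym (+-assoc _ _ _)) (cong (_+ polynomial r) (sym (distribˡ (monomial m) (monomial m′) (polynomial p′))))))

    mul-sound : ∀ p p′ → polynomial (mul p p′) ≡ polynomial p * polynomial p′
    mul-sound [] p′ = sym (zeroˡ _)
    mul-sound (m ∷ p) p′ = trans (scale-sound m (mul p p′) p′) (trans (cong (_ +_) (mul-sound p p′)) (sym (distribʳ (polynomial p′) (monomial m) (polynomial p))))

    normalise-sound : ∀ e → polynomial (normalise e) ≡ ⟦ e ⟧ ρ
    normalise-sound (var i) = trans (+-identityʳ _) (trans (*-comm _ _) (*-identityˡ _))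
    normalise-sound (con true) = +-identityʳ _
    normalise-sound (con false) = refl
    normalise-sound (e :+ e′) = trans (add-sound (normalise e) (normalise e′)) (cong₂ _+_ (normalise-sound e) (normalise-sound e′))
    normalise-sound (e :* e′) = trans (mul-sound (normalise e) (normalise e′)) (cong₂ _*_ (normalise-sound e) (normalise-sound e′))

  private
    close : ∀ {B : Set} n → N-ary n (Expr n) B → B
    close n f = f $ⁿ Vec.map var (Vec.allFin n)

  -- Normal forms of closed syntax compute, so the hypothesis is discharged by `refl` whenever the
  -- two sides agree as polynomials over the field with two elements.
  solve : ∀ n (f : N-ary n (Expr n) (Expr n × Expr n)) →
    normalise (proj₁ (close n f)) ≡ normalise (proj₂ (close n f)) →
    Eq n _≡_ (curryⁿ ⟦ proj₁ (close n f) ⟧) (curryⁿ ⟦ proj₂ (close n f) ⟧)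
  solve n f same = curryⁿ-cong _≡_ ⟦ proj₁ (close n f) ⟧ ⟦ proj₂ (close n f) ⟧ λ ρ →
    trans (sym (normalise-sound ρ (proj₁ (close n f)))) (trans (cong (polynomial ρ) same) (normalise-sound ρ (proj₂ (close n f))))

-- Square roots, the Artin-Schreier map and cube roots of unity

module FieldTheory {q : ℕ} (𝔽 : FiniteField₂ q) where

  open FiniteField₂ 𝔽 public
  open IsCommutativeSemiring isCommutativeSemiring public
    using (+-identityˡ; +-identityʳ; *-identityˡ; *-identityʳ; +-comm; *-comm; +-assoc; *-assoc; zeroˡ; zeroʳ)

  open Polynomials
  open 𝔽₂-Solver isCommutativeSemiring x+x≡0 public using (solve)
  open Polynomials public using (Expr; :0; :1; _:+_; _:*_; _:=_)

  infix 4 _≟_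
  _≟_ : (x y : K) → Dec (x ≡ y)
  _≟_ = Fin._≟_

  x≡y⇒x+y≡0 : ∀ {x y} → x ≡ y → x + y ≡ 0#
  x≡y⇒x+y≡0 refl = x+x≡0 _

  x+y≡0⇒x≡y : ∀ {x y} → x + y ≡ 0# → x ≡ y
  x+y≡0⇒x≡y {x} {y} x+y≡0 = begin
    x           ≡⟨ solve 2 (λ x y → x := (x :+ y) :+ y) refl x y ⟩
    x + y + y   ≡⟨ cong (_+ y) x+y≡0 ⟩
    0# + y      ≡⟨ +-identityˡ y ⟩
    y           ∎
    where open ≡-Reasoning

  -- This is how hypotheses enter the solver: a consequence of equations is verified by adding
  -- suitable multiples of them to the goal, after which a polynomial identity remains.
  by-adding : ∀ {x y u v} → u ≡ v → x + u ≡ y + v → x ≡ y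
  by-adding {x} {y} {u} {.u} refl e = x+y≡0⇒x≡y (begin
    x + y               ≡⟨ solve 3 (λ x y u → x :+ y := (x :+ u) :+ (y :+ u)) refl x y u ⟩
    (x + u) + (y + u)   ≡⟨ x≡y⇒x+y≡0 e ⟩
    0#                  ∎)
    where open ≡-Reasoning

  +-cancelˡ : ∀ x {y z} → x + y ≡ x + z → y ≡ z
  +-cancelˡ x {y} {z} e = by-adding e (solve 3 (λ x y z → y :+ (x :+ y) := z :+ (x :+ z)) refl x y z)

  +-cancelʳ : ∀ x {y z} → y + x ≡ z + x → y ≡ z
  +-cancelʳ x {y} {z} e = by-adding e (solve 3 (λ x y z → y :+ (y :+ x) := z :+ (z :+ x)) refl x y z)

  *-cancelˡ : ∀ x {y z} → x ≢ 0# → x * y ≡ x * z → y ≡ z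
  *-cancelˡ x {y} {z} x≢0 e = begin
    y                 ≡⟨ undo y ⟩
    x ⁻¹ * (x * y)    ≡⟨ cong (x ⁻¹ *_) e ⟩
    x ⁻¹ * (x * z)    ≡⟨ undo z ⟨
    z                 ∎
    where
    open ≡-Reasoning
    undo : ∀ w → w ≡ x ⁻¹ * (x * w)
    undo w = trans (sym (*-identityˡ w)) (trans (cong (_* w) (sym (*-inverseʳ x≢0)))
      (solve 3 (λ x y w → (x :* y) :* w := y :* (x :* w)) refl x (x ⁻¹) w))

  x*y≡0⇒y≡0 : ∀ {x y} → x ≢ 0# → x * y ≡ 0# → y ≡ 0#
  x*y≡0⇒y≡0 {x} x≢0 e = *-cancelˡ x x≢0 (trans e (sym (zeroʳ x)))

  *-≢0 : ∀ {x y} → x ≢ 0# → y ≢ 0# → x * y ≢ 0#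
  *-≢0 x≢0 y≢0 e = y≢0 (x*y≡0⇒y≡0 x≢0 e)

  ⁻¹-≢0 : ∀ {x} → x ≢ 0# → x ⁻¹ ≢ 0#
  ⁻¹-≢0 {x} x≢0 e = 1≢0 (trans (sym (*-inverseʳ x≢0)) (trans (cong (x *_) e) (zeroʳ x)))

  x*x≡0⇒x≡0 : ∀ {x} → x * x ≡ 0# → x ≡ 0#
  x*x≡0⇒x≡0 {x} e with x ≟ 0#
  ... | yes x≡0 = x≡0
  ... | no x≢0 = x*y≡0⇒y≡0 x≢0 e

  -- Squaring is additive in characteristic 2 and has trivial kernel.
  square-injective : Injective _≡_ _≡_ (λ x → x * x)
  square-injective {x} {y} e = x+y≡0⇒x≡y (x*x≡0⇒x≡0
    (by-adding e (solve 2 (λ x y → (x :+ y) :* (x :+ y) :+ x :* x := :0 :+ y :* y) refl x y)))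

  sqrt : ∀ x → ∃[ r ] r * r ≡ x
  sqrt = injective⇒surjective square-injective

  -- The Artin-Schreier map. The form `α² + αβ + εβ²` is anisotropic exactly if `ε` is not one of
  -- its values.
  ℘ : K → K
  ℘ x = x * x + x

  x*x≡x⇒0or1 : ∀ {x} → x * x ≡ x → x ≡ 0# ⊎ x ≡ 1#
  x*x≡x⇒0or1 {x} e with x ≟ 0#
  ... | yes x≡0 = inj₁ x≡0
  ... | no x≢0 = inj₂ (*-cancelˡ x x≢0 (trans e (sym (*-identityʳ x))))

  ℘-+ : ∀ x y → ℘ (x + y) ≡ ℘ x + ℘ y
  ℘-+ = solve 2 (λ x y → (x :+ y) :* (x :+ y) :+ (x :+ y) := (x :* x :+ x) :+ (y :* y :+ y)) refl

  ℘-fibres : ∀ {x y} → ℘ x ≡ ℘ y → x ≡ y ⊎ x ≡ y + 1#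
  ℘-fibres {x} {y} e with x*x≡x⇒0or1 {x + y} (x+y≡0⇒x≡y (trans (℘-+ x y) (x≡y⇒x+y≡0 e)))
  ... | inj₁ x+y≡0 = inj₁ (x+y≡0⇒x≡y x+y≡0)
  ... | inj₂ x+y≡1 = inj₂ (by-adding x+y≡1 (solve 2 (λ x y → x :+ (x :+ y) := y :+ :1 :+ :1) refl x y))

  ℘x+1 : ∀ x → ℘ (x + 1#) ≡ ℘ x
  ℘x+1 = solve 1 (λ x → (x :+ :1) :* (x :+ :1) :+ (x :+ :1) := x :* x :+ x) refl

  ℘? : ∀ y → Dec (∃[ x ] ℘ x ≡ y)
  ℘? y = Fin.any? (λ x → ℘ x ≟ y)

  -- A surjective `℘` would have a right inverse, which is injective, hence onto by counting, hence
  -- a two-sided inverse; but `℘` takes the same value at `0` and at `1`.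
  ℘-not-surjective : ∃[ ε ] ∀ x → ℘ x ≢ ε
  ℘-not-surjective with Fin.all? ℘?
  ... | no ¬onto with ε , ε∉ ← Fin.¬∀⟶∃¬ q _ ℘? ¬onto = ε , λ x e → ε∉ (x , e)
  ... | yes onto = contradiction 0≡1 (1≢0 ∘ sym)
    where
    open ≡-Reasoning
    section : K → K
    section = proj₁ ∘ onto
    section-surjective : ∀ y → ∃[ x ] section x ≡ y
    section-surjective = injective⇒surjective λ {x} {y} e →
      trans (sym (proj₂ (onto x))) (trans (cong ℘ e) (proj₂ (onto y)))
    ℘-cancel : ∀ x → section (℘ x) ≡ x
    ℘-cancel x with y , refl ← section-surjective x = cong section (proj₂ (onto y))
    0≡1 : 0# ≡ 1#
    0≡1 = begin
      0#                 ≡⟨ ℘-cancel 0# ⟨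
      section (℘ 0#)     ≡⟨ cong section (trans (sym (℘x+1 0#)) (cong ℘ (+-identityˡ 1#))) ⟩
      section (℘ 1#)     ≡⟨ ℘-cancel 1# ⟩
      1#                 ∎

  -- ℘ is additive with kernel {0, 1}, so its image has index 2: three cosets of the image do not fit.
  ℘-index : ∀ {ε} → (∀ x → ℘ x ≢ 1#) → (∀ x → ℘ x ≢ ε) → ∃[ x ] ℘ x ≡ ε + 1#
  ℘-index {ε} 1∉ ε∉ with ℘? (ε + 1#)
  ... | yes hit = hit
  ... | no ε+1∉ = contradiction (Fin.injective⇒≤ {f = λ z → pair (Fin.remQuot q z)} inj) 3q≰2q
    where
    rep : Fin 3 → K
    rep 0F = 0#
    rep 1F = 1#
    rep 2F = ε
    value : Fin 3 × K → K
    value (i , x) = ℘ x + rep i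
    -- The order of `Fin q` tells `x` from `x + 1`, the two elements of a fibre of `℘`. Together
    -- with the value it would embed three copies of the field into two.
    side : K → Fin 2
    side x with x Fin.≤? (x + 1#)
    ... | yes _ = 0F
    ... | no  _ = 1F
    pair : Fin 3 × K → Fin (2 ℕ.* q)
    pair (i , x) = combine (side x) (value (i , x))
    side-flip : ∀ x → side x ≢ side (x + 1#)
    side-flip x with x Fin.≤? (x + 1#) | (x + 1#) Fin.≤? ((x + 1#) + 1#)
    ... | yes p | no r = λ ()
    ... | no r | yes p = λ ()
    ... | yes p | yes r = λ _ → 1≢0 (+-cancelˡ x (trans (sym (Fin.≤-antisym p
           (subst (x + 1# Fin.≤_) (solve 1 (λ x → (x :+ :1) :+ :1 := x) refl x) r))) (sym (+-identityʳ x))))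
    ... | no p | no r = λ _ → r (subst (x + 1# Fin.≤_)
           (solve 1 (λ x → x := (x :+ :1) :+ :1) refl x) (ℕ.<⇒≤ (ℕ.≰⇒> p)))
    coset : ∀ {i j x y} → ℘ x + rep i ≡ ℘ y + rep j → ℘ (x + y) ≡ rep i + rep j
    coset {i} {j} {x} {y} e = trans (℘-+ x y) (by-adding e
      (solve 4 (λ x y a b → (x :+ y) :+ (x :+ a) := (a :+ b) :+ (y :+ b)) refl (℘ x) (℘ y) (rep i) (rep j)))
    apart : ∀ {i j} x → i ≢ j → ℘ x ≢ rep i + rep j
    apart {0F} {0F} x i≢j e = i≢j refl
    apart {1F} {1F} x i≢j e = i≢j refl
    apart {2F} {2F} x i≢j e = i≢j refl
    apart {0F} {1F} x i≢j e = 1∉ x (trans e (+-identityˡ 1#))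
    apart {0F} {2F} x i≢j e = ε∉ x (trans e (+-identityˡ ε))
    apart {1F} {0F} x i≢j e = 1∉ x (trans e (+-identityʳ 1#))
    apart {2F} {0F} x i≢j e = ε∉ x (trans e (+-identityʳ ε))
    apart {1F} {2F} x i≢j e = ε+1∉ (x , trans e (+-comm 1# ε))
    apart {2F} {1F} x i≢j e = ε+1∉ (x , e)
    pair-inj : Injective _≡_ _≡_ pair
    pair-inj {i , x} {j , y} e with Fin.combine-injective (side x) _ (side y) _ e
    ... | same-side , same-value with i Fin.≟ j
    ... | no i≢j = contradiction (coset {i} {j} same-value) (apart (x + y) i≢j)
    ... | yes refl with ℘-fibres (+-cancelʳ (rep i) same-value)
    ... | inj₁ refl = refl
    ... | inj₂ refl = contradiction (sym same-side) (side-flip y)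
    inj : Injective _≡_ _≡_ (λ z → pair (Fin.remQuot q z))
    inj {x} {y} e = begin
      x                                          ≡⟨ Fin.combine-remQuot {3} q x ⟨
      uncurry combine (Fin.remQuot {3} q x) ≡⟨ cong (uncurry combine) (pair-inj {Fin.remQuot q x} {Fin.remQuot q y} e) ⟩
      uncurry combine (Fin.remQuot {3} q y) ≡⟨ Fin.combine-remQuot {3} q y ⟩
      y                                          ∎
      where open ≡-Reasoning
    3q≰2q : ¬ (3 ℕ.* q ℕ.≤ 2 ℕ.* q)
    3q≰2q = go q 0#
      where
      go : ∀ q → Fin q → ¬ (3 ℕ.* q ℕ.≤ 2 ℕ.* q)
      go (suc q) _ le = ℕ.1+n≰n (ℕ.*-cancelʳ-≤ 3 2 (suc q) le)

  -- x ↦ 1/(1+x) has order three on K ∖ {0, 1}, where its fixed points are the solutions of ℘ x ≡ 1.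
  private
    f : K → K
    f x with x ≟ 0# | x ≟ 1#
    ... | yes _ | _     = 0#
    ... | no _  | yes _ = 1#
    ... | no _  | no _  = (1# + x) ⁻¹

    f0 : f 0# ≡ 0#
    f0 with 0# ≟ 0# | 0# ≟ 1#
    ... | yes _ | _ = refl
    ... | no p | _ = contradiction refl p

    f1 : f 1# ≡ 1#
    f1 with 1# ≟ 0# | 1# ≟ 1#
    ... | yes p | _ = sym p
    ... | no _ | yes _ = refl
    ... | no _ | no p = contradiction refl p

    f-other : ∀ {x} → x ≢ 0# → x ≢ 1# → f x ≡ (1# + x) ⁻¹
    f-other {x} x≢0 x≢1 with x ≟ 0# | x ≟ 1#
    ... | yes p | _ = contradiction p x≢0
    ... | no _ | yes p = contradiction p x≢1
    ... | no _ | no _ = refl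

    module _ {x} (x≢0 : x ≢ 0#) (x≢1 : x ≢ 1#) where
      1+x≢0 : 1# + x ≢ 0#
      1+x≢0 e = x≢1 (sym (x+y≡0⇒x≡y e))

      f-equation : (1# + x) * f x ≡ 1#
      f-equation = trans (cong ((1# + x) *_) (f-other x≢0 x≢1)) (*-inverseʳ 1+x≢0)

      fx≢0 : f x ≢ 0#
      fx≢0 e = 1≢0 (trans (sym f-equation) (trans (cong ((1# + x) *_) e) (zeroʳ _)))

      fx≢1 : f x ≢ 1#
      fx≢1 e = x≢0 (+-cancelˡ 1# (trans (trans (sym (*-identityʳ _)) (trans (cong ((1# + x) *_) (sym e)) f-equation)) (sym (+-identityʳ 1#))))

    f³ : ∀ x → f (f (f x)) ≡ x
    f³ x with x ≟ 0# | x ≟ 1#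
    ... | yes refl | _ = trans (cong f f0) f0
    ... | no _ | yes refl = trans (cong f f1) f1
    ... | no x≢0 | no x≢1 = subst (λ w → f (f w) ≡ x) (f-other x≢0 x≢1) main
      where
      y = f x
      z = f y
      w = f z
      e1 : (1# + x) * y ≡ 1#
      e1 = f-equation x≢0 x≢1
      y≢0 = fx≢0 x≢0 x≢1
      y≢1 = fx≢1 x≢0 x≢1
      e2 : (1# + y) * z ≡ 1#
      e2 = f-equation y≢0 y≢1
      e3 : (1# + z) * w ≡ 1#
      e3 = f-equation (fx≢0 y≢0 y≢1) (fx≢1 y≢0 y≢1)
      -- (1+y)(1+z) = y, so multiplying e3 by 1+y gives y w = 1 + y = x y
      main : w ≡ x
      main = *-cancelˡ y y≢0 (by-adding (cong₂ _+_ (cong₂ _+_ (cong ((1# + y) *_) e3) (cong (w *_) e2)) e1)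
        (solve 4 (λ x y z w → y :* w :+ ((:1 :+ y) :* ((:1 :+ z) :* w) :+ w :* ((:1 :+ y) :* z) :+ (:1 :+ x) :* y)
          := y :* x :+ ((:1 :+ y) :* :1 :+ w :* :1 :+ :1)) refl x y z w))

    f-fixed : ∀ {x} → f x ≡ x → x ≡ 0# ⊎ x ≡ 1# ⊎ ℘ x ≡ 1#
    f-fixed {x} e with x ≟ 0# | x ≟ 1#
    ... | yes p | _ = inj₁ p
    ... | no _ | yes p = inj₂ (inj₁ p)
    ... | no x≢0 | no x≢1 = inj₂ (inj₂ (trans (solve 1 (λ x → x :* x :+ x := (:1 :+ x) :* x) refl x)
           (trans (cong ((1# + x) *_) (sym e)) (*-inverseʳ (1+x≢0 x≢0 x≢1)))))

    fixedPoints : ∃[ N ] q ≡ 3 ℕ.* N ℕ.+ ∑ (λ x → indicator (f x ≟ x))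
    fixedPoints = order3-fixedPoints f f³

    ℘x≡1⇒x≢0 : ∀ {x} → ℘ x ≡ 1# → x ≢ 0#
    ℘x≡1⇒x≢0 e refl = 1≢0 (trans (sym e) (solve 0 (:0 :* :0 :+ :0 := :0) refl))

    ℘x≡1⇒x≢1 : ∀ {x} → ℘ x ≡ 1# → x ≢ 1#
    ℘x≡1⇒x≢1 e refl = 1≢0 (trans (sym e) (solve 0 (:1 :* :1 :+ :1 := :0) refl))

    f-fixed⁻¹ : ∀ {x} → ℘ x ≡ 1# → f x ≡ x
    f-fixed⁻¹ {x} e = trans (f-other x≢0 x≢1) (*-cancelˡ (1# + x) (1+x≢0 x≢0 x≢1) (trans (*-inverseʳ (1+x≢0 x≢0 x≢1))
        (trans (sym e) (solve 1 (λ x → x :* x :+ x := (:1 :+ x) :* x) refl x))))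
      where
      x≢0 : x ≢ 0#
      x≢0 = ℘x≡1⇒x≢0 e
      x≢1 : x ≢ 1#
      x≢1 = ℘x≡1⇒x≢1 e

    δ : K → K → ℕ
    δ y x = indicator (x ≟ y)

    count-two : (∀ x → ℘ x ≢ 1#) → ∑ (λ x → indicator (f x ≟ x)) ≡ 2
    count-two 1∉ = trans (∑-cong pointwise) (trans (∑-+ (δ 0#) (δ 1#)) (cong₂ ℕ._+_ (∑-indicator 0#) (∑-indicator 1#)))
      where
      pointwise : ∀ x → indicator (f x ≟ x) ≡ δ 0# x ℕ.+ δ 1# x
      pointwise x with x ≟ 0# | x ≟ 1#
      ... | yes refl | yes 0≡1 = contradiction (sym 0≡1) 1≢0
      ... | yes refl | no _ = indicator-yes (0# ≟ 0#) refl
      ... | no _ | yes refl = indicator-yes (1# ≟ 1#) refl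
      ... | no x≢0 | no x≢1 = indicator-no ((1# + x) ⁻¹ ≟ x) fixed⇒⊥
        where
        fixed⇒⊥ : (1# + x) ⁻¹ ≢ x
        fixed⇒⊥ e with f-fixed (trans (f-other x≢0 x≢1) e)
        ... | inj₁ p = x≢0 p
        ... | inj₂ (inj₁ p) = x≢1 p
        ... | inj₂ (inj₂ p) = 1∉ x p

    module _ {ω} (℘ω≡1 : ℘ ω ≡ 1#) where
      private
        ω≢0 : ω ≢ 0#
        ω≢0 = ℘x≡1⇒x≢0 ℘ω≡1
        ω≢1 : ω ≢ 1#
        ω≢1 = ℘x≡1⇒x≢1 ℘ω≡1

      count-four : ∑ (λ x → indicator (f x ≟ x)) ≡ 4
      count-four = trans (∑-cong pointwise) (trans (∑-+ (λ x → δ 0# x ℕ.+ δ 1# x) (λ x → δ ω x ℕ.+ δ (ω + 1#) x))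
        (cong₂ ℕ._+_ (trans (∑-+ (δ 0#) (δ 1#)) (cong₂ ℕ._+_ (∑-indicator 0#) (∑-indicator 1#)))
                     (trans (∑-+ (δ ω) (δ (ω + 1#))) (cong₂ ℕ._+_ (∑-indicator ω) (∑-indicator (ω + 1#))))))
        where
        pointwise : ∀ x → indicator (f x ≟ x) ≡ (δ 0# x ℕ.+ δ 1# x) ℕ.+ (δ ω x ℕ.+ δ (ω + 1#) x)
        pointwise x with x ≟ 0# | x ≟ 1# | x ≟ ω | x ≟ (ω + 1#)
        ... | yes refl | yes p | _ | _ = contradiction (sym p) 1≢0
        ... | yes refl | no _ | yes p | _ = contradiction (sym p) ω≢0
        ... | yes refl | no _ | no _ | yes p = contradiction (x+y≡0⇒x≡y (sym p)) ω≢1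
        ... | yes refl | no _ | no _ | no _ = indicator-yes (0# ≟ 0#) refl
        ... | no _ | yes refl | yes p | _ = contradiction (sym p) ω≢1
        ... | no _ | yes refl | no _ | yes p = contradiction (+-cancelʳ 1# (trans (sym p) (sym (+-identityˡ 1#)))) ω≢0
        ... | no _ | yes refl | no _ | no _ = indicator-yes (1# ≟ 1#) refl
        ... | no x≢0 | no x≢1 | yes refl | yes p = contradiction (sym (+-cancelˡ ω (trans (+-identityʳ ω) p))) 1≢0
        ... | no x≢0 | no x≢1 | yes refl | no _ = indicator-yes ((1# + x) ⁻¹ ≟ x) (trans (sym (f-other x≢0 x≢1)) (f-fixed⁻¹ ℘ω≡1))
        ... | no x≢0 | no x≢1 | no _ | yes refl = indicator-yes ((1# + x) ⁻¹ ≟ x) (trans (sym (f-other x≢0 x≢1)) (f-fixed⁻¹ (trans (℘x+1 ω) ℘ω≡1)))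
        ... | no x≢0 | no x≢1 | no x≢ω | no x≢ω+1 = indicator-no ((1# + x) ⁻¹ ≟ x) fixed⇒⊥
          where
          fixed⇒⊥ : (1# + x) ⁻¹ ≢ x
          fixed⇒⊥ e with f-fixed (trans (f-other x≢0 x≢1) e)
          ... | inj₁ p = x≢0 p
          ... | inj₂ (inj₁ p) = x≢1 p
          ... | inj₂ (inj₂ p) with ℘-fibres (trans p (sym ℘ω≡1))
          ... | inj₁ p = x≢ω p
          ... | inj₂ p = x≢ω+1 p

    mod3 : ∀ N c → (3 ℕ.* N ℕ.+ c) % 3 ≡ c % 3
    mod3 N c = trans (cong (_% 3) (trans (ℕ.+-comm (3 ℕ.* N) c) (cong (c ℕ.+_) (ℕ.*-comm 3 N)))) ([m+kn]%n≡m%n c N 3)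

  -- A solution is a primitive cube root of unity. Without one the map of order three fixes only `0`
  -- and `1`, and `q` would be 2 modulo 3.
  cubeRootOfUnity : q % 3 ≡ 1 → ∃[ ω ] ℘ ω ≡ 1#
  cubeRootOfUnity q≡1 with ℘? 1#
  ... | yes ω = ω
  ... | no none with N , e ← fixedPoints
    = contradiction (trans (sym q≡1) (trans (cong (_% 3) e) (trans (mod3 N _) (cong (_% 3) (count-two λ x p → none (x , p)))))) λ ()

  -- With a solution `ω` also `ω + 1` is fixed, which makes four fixed points in all, and `q` would
  -- be 1 modulo 3.
  no-cubeRootOfUnity : q % 3 ≡ 2 → ∀ x → ℘ x ≢ 1#
  no-cubeRootOfUnity q≡2 ω ℘ω≡1 with N , e ← fixedPoints
    = contradiction (trans (sym q≡2) (trans (cong (_% 3) e) (trans (mod3 N _) (cong (_% 3) (count-four ℘ω≡1))))) λ ()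

-- Quadratic forms on `K⁴` with a common polar form

module Forms {q : ℕ} (𝔽 : FiniteField₂ q) where

  open FieldTheory 𝔽

  record V : Set where
    constructor ⟨_,_,_,_⟩
    field z₁ z₂ z₃ z₄ : K
  open V public

  cong₄ : ∀ {x x′ y y′ z z′ w w′} → x ≡ x′ → y ≡ y′ → z ≡ z′ → w ≡ w′ → ⟨ x , y , z , w ⟩ ≡ ⟨ x′ , y′ , z′ , w′ ⟩
  cong₄ refl refl refl refl = refl

  infixl 6 _⊕_
  infixr 7 _·_

  opaque

    _⊕_ : V → V → V
    ⟨ x1 , x2 , x3 , x4 ⟩ ⊕ ⟨ y1 , y2 , y3 , y4 ⟩ = ⟨ x1 + y1 , x2 + y2 , x3 + y3 , x4 + y4 ⟩

    _·_ : K → V → V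
    c · ⟨ x1 , x2 , x3 , x4 ⟩ = ⟨ c * x1 , c * x2 , c * x3 , c * x4 ⟩

    0v : V
    0v = ⟨ 0# , 0# , 0# , 0# ⟩

    B : V → V → K
    B ⟨ x1 , x2 , x3 , x4 ⟩ ⟨ y1 , y2 , y3 , y4 ⟩ = x1 * y2 + x2 * y1 + (x3 * y4 + x4 * y3)

    qf : V → K
    qf ⟨ x1 , x2 , x3 , x4 ⟩ = x1 * x2 + x3 * x4

  unit₁ unit₂ unit₃ unit₄ : V
  unit₁ = ⟨ 1# , 0# , 0# , 0# ⟩
  unit₂ = ⟨ 0# , 1# , 0# , 0# ⟩
  unit₃ = ⟨ 0# , 0# , 1# , 0# ⟩
  unit₄ = ⟨ 0# , 0# , 0# , 1# ⟩

  _≟v_ : (x y : V) → Dec (x ≡ y)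
  ⟨ x1 , x2 , x3 , x4 ⟩ ≟v ⟨ y1 , y2 , y3 , y4 ⟩ =
    map′ (λ { (refl , refl , refl , refl) → refl }) (λ { refl → refl , refl , refl , refl })
      (x1 ≟ y1 ×-dec x2 ≟ y2 ×-dec x3 ≟ y3 ×-dec x4 ≟ y4)

  opaque
    V-finite : V ↔ Fin ((q ℕ.* q) ℕ.* (q ℕ.* q))
    V-finite = ↔-sym Fin.*↔× ↔-∘ ((↔-sym Fin.*↔× ×-↔ ↔-sym Fin.*↔×) ↔-∘
      mk↔ₛ′ (λ z → (z₁ z , z₂ z) , (z₃ z , z₄ z)) (λ { ((a , b) , (c , d)) → ⟨ a , b , c , d ⟩ })
        (λ _ → refl) (λ _ → refl))

  opaque
    unfolding _⊕_

    ⊕-comm : ∀ x y → x ⊕ y ≡ y ⊕ x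
    ⊕-comm x y = cong₄ (+-comm _ _) (+-comm _ _) (+-comm _ _) (+-comm _ _)

    ⊕-assoc : ∀ x y z → (x ⊕ y) ⊕ z ≡ x ⊕ (y ⊕ z)
    ⊕-assoc x y z = cong₄ (+-assoc _ _ _) (+-assoc _ _ _) (+-assoc _ _ _) (+-assoc _ _ _)

    ⊕-identityʳ : ∀ x → x ⊕ 0v ≡ x
    ⊕-identityʳ x = cong₄ (+-identityʳ _) (+-identityʳ _) (+-identityʳ _) (+-identityʳ _)

    ⊕-identityˡ : ∀ x → 0v ⊕ x ≡ x
    ⊕-identityˡ x = trans (⊕-comm 0v x) (⊕-identityʳ x)

    ⊕-self : ∀ x → x ⊕ x ≡ 0v
    ⊕-self x = cong₄ (x+x≡0 _) (x+x≡0 _) (x+x≡0 _) (x+x≡0 _)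

  x⊕x⊕y≡y : ∀ x y → x ⊕ (x ⊕ y) ≡ y
  x⊕x⊕y≡y x y = trans (sym (⊕-assoc x x y)) (trans (cong (_⊕ y) (⊕-self x)) (trans (⊕-comm 0v y) (⊕-identityʳ y)))

  ⊕-cancelˡ : ∀ x {y z} → x ⊕ y ≡ x ⊕ z → y ≡ z
  ⊕-cancelˡ x {y} {z} e = trans (sym (x⊕x⊕y≡y x y)) (trans (cong (x ⊕_) e) (x⊕x⊕y≡y x z))

  [x⊕y]⊕[x⊕z]≡y⊕z : ∀ x y z → (x ⊕ y) ⊕ (x ⊕ z) ≡ y ⊕ z
  [x⊕y]⊕[x⊕z]≡y⊕z x y z = trans (cong (_⊕ (x ⊕ z)) (⊕-comm x y)) (trans (⊕-assoc y x (x ⊕ z)) (cong (y ⊕_) (x⊕x⊕y≡y x z)))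

  x⊕y≡0⇒x≡y : ∀ {x y} → x ⊕ y ≡ 0v → x ≡ y
  x⊕y≡0⇒x≡y {x} {y} e = ⊕-cancelˡ y (trans (⊕-comm y x) (trans e (sym (⊕-self y))))

  opaque
    unfolding _⊕_

    0·x≡0 : ∀ x → 0# · x ≡ 0v
    0·x≡0 x = cong₄ (zeroˡ _) (zeroˡ _) (zeroˡ _) (zeroˡ _)

    c·0≡0 : ∀ c → c · 0v ≡ 0v
    c·0≡0 c = cong₄ (zeroʳ c) (zeroʳ c) (zeroʳ c) (zeroʳ c)

    1·x≡x : ∀ x → 1# · x ≡ x
    1·x≡x x = cong₄ (*-identityˡ _) (*-identityˡ _) (*-identityˡ _) (*-identityˡ _)

    ·-·-assoc : ∀ c d x → c · (d · x) ≡ (c * d) · x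
    ·-·-assoc c d x = cong₄ (sym (*-assoc _ _ _)) (sym (*-assoc _ _ _)) (sym (*-assoc _ _ _)) (sym (*-assoc _ _ _))

    ·-distrib-+ : ∀ c d x → c · x ⊕ d · x ≡ (c + d) · x
    ·-distrib-+ c d x = cong₄ (law _) (law _) (law _) (law _)
      where
      law : ∀ x → c * x + d * x ≡ (c + d) * x
      law = solve 3 (λ c d x → c :* x :+ d :* x := (c :+ d) :* x) refl c d

  ⁻¹·-cancel : ∀ {c} x → c ≢ 0# → c ⁻¹ · (c · x) ≡ x
  ⁻¹·-cancel {c} x c≢0 = trans (·-·-assoc (c ⁻¹) c x) (trans (cong (_· x) (trans (*-comm (c ⁻¹) c) (*-inverseʳ c≢0))) (1·x≡x x))

  ·-≢0 : ∀ {c x} → c ≢ 0# → x ≢ 0v → c · x ≢ 0v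
  ·-≢0 {c} {x} c≢0 x≢0 e = x≢0 (trans (sym (⁻¹·-cancel x c≢0)) (trans (cong (c ⁻¹ ·_) e) (c·0≡0 (c ⁻¹))))

  dependent : ∀ {c d x y} → c ≢ 0# → c · x ⊕ d · y ≡ 0v → x ≡ (c ⁻¹ * d) · y
  dependent {c} {d} {x} {y} c≢0 e = begin
    x                   ≡⟨ ⁻¹·-cancel x c≢0 ⟨
    c ⁻¹ · (c · x)      ≡⟨ cong (c ⁻¹ ·_) (x⊕y≡0⇒x≡y e) ⟩
    c ⁻¹ · (d · y)      ≡⟨ ·-·-assoc (c ⁻¹) d y ⟩
    (c ⁻¹ * d) · y      ∎
    where open ≡-Reasoning

  -- Writing a point of the quadric x₀² = x₁x₂ + x₃x₄ as (x₀, z), the hyperplane x₀ = B(a, z) meets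
  -- the quadric in the points with Q a z = 0. All the forms Q a have the same polar form B.
  Q : V → V → K
  Q a z = B a z * B a z + qf z

  opaque
    unfolding _⊕_

    B-comm : ∀ x y → B x y ≡ B y x
    B-comm ⟨ x1 , x2 , x3 , x4 ⟩ ⟨ y1 , y2 , y3 , y4 ⟩ =
      solve 8 (λ x1 x2 x3 x4 y1 y2 y3 y4 → x1 :* y2 :+ x2 :* y1 :+ (x3 :* y4 :+ x4 :* y3)
        := y1 :* x2 :+ y2 :* x1 :+ (y3 :* x4 :+ y4 :* x3)) refl x1 x2 x3 x4 y1 y2 y3 y4

    B-self : ∀ x → B x x ≡ 0#
    B-self ⟨ x1 , x2 , x3 , x4 ⟩ =
      solve 4 (λ x1 x2 x3 x4 → x1 :* x2 :+ x2 :* x1 :+ (x3 :* x4 :+ x4 :* x3) := :0) refl x1 x2 x3 x4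

    B-⊕ˡ : ∀ x y z → B (x ⊕ y) z ≡ B x z + B y z
    B-⊕ˡ ⟨ x1 , x2 , x3 , x4 ⟩ ⟨ y1 , y2 , y3 , y4 ⟩ ⟨ w1 , w2 , w3 , w4 ⟩ =
      solve 12 (λ x1 x2 x3 x4 y1 y2 y3 y4 z1 z2 z3 z4 →
        (x1 :+ y1) :* z2 :+ (x2 :+ y2) :* z1 :+ ((x3 :+ y3) :* z4 :+ (x4 :+ y4) :* z3)
        := (x1 :* z2 :+ x2 :* z1 :+ (x3 :* z4 :+ x4 :* z3)) :+ (y1 :* z2 :+ y2 :* z1 :+ (y3 :* z4 :+ y4 :* z3)))
        refl x1 x2 x3 x4 y1 y2 y3 y4 w1 w2 w3 w4

    B-·ˡ : ∀ c x y → B (c · x) y ≡ c * B x y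
    B-·ˡ c ⟨ x1 , x2 , x3 , x4 ⟩ ⟨ y1 , y2 , y3 , y4 ⟩ =
      solve 9 (λ c x1 x2 x3 x4 y1 y2 y3 y4 → c :* x1 :* y2 :+ c :* x2 :* y1 :+ (c :* x3 :* y4 :+ c :* x4 :* y3)
        := c :* (x1 :* y2 :+ x2 :* y1 :+ (x3 :* y4 :+ x4 :* y3))) refl c x1 x2 x3 x4 y1 y2 y3 y4

  B-⊕ʳ : ∀ x y z → B x (y ⊕ z) ≡ B x y + B x z
  B-⊕ʳ x y z = trans (B-comm x (y ⊕ z)) (trans (B-⊕ˡ y z x) (cong₂ _+_ (B-comm y x) (B-comm z x)))

  B-·ʳ : ∀ c x y → B x (c · y) ≡ c * B x y
  B-·ʳ c x y = trans (B-comm x (c · y)) (trans (B-·ˡ c y x) (cong (c *_) (B-comm y x)))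

  B-self-·ʳ : ∀ c x → B x (c · x) ≡ 0#
  B-self-·ʳ c x = trans (B-·ʳ c x x) (trans (cong (c *_) (B-self x)) (zeroʳ c))

  B-self-·ˡ : ∀ c x → B (c · x) x ≡ 0#
  B-self-·ˡ c x = trans (B-comm (c · x) x) (B-self-·ʳ c x)

  B-0ʳ : ∀ x → B x 0v ≡ 0#
  B-0ʳ x = trans (cong (B x) (sym (0·x≡0 0v))) (trans (B-·ʳ 0# x 0v) (zeroˡ _))

  B-0ˡ : ∀ x → B 0v x ≡ 0#
  B-0ˡ x = trans (B-comm 0v x) (B-0ʳ x)

  opaque
    unfolding _⊕_

    qf-⊕ : ∀ x y → qf (x ⊕ y) ≡ qf x + qf y + B x y
    qf-⊕ ⟨ x1 , x2 , x3 , x4 ⟩ ⟨ y1 , y2 , y3 , y4 ⟩ =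
      solve 8 (λ x1 x2 x3 x4 y1 y2 y3 y4 → (x1 :+ y1) :* (x2 :+ y2) :+ (x3 :+ y3) :* (x4 :+ y4)
        := (x1 :* x2 :+ x3 :* x4) :+ (y1 :* y2 :+ y3 :* y4) :+ (x1 :* y2 :+ x2 :* y1 :+ (x3 :* y4 :+ x4 :* y3)))
        refl x1 x2 x3 x4 y1 y2 y3 y4

    qf-· : ∀ c x → qf (c · x) ≡ c * c * qf x
    qf-· c ⟨ x1 , x2 , x3 , x4 ⟩ =
      solve 5 (λ c x1 x2 x3 x4 → c :* x1 :* (c :* x2) :+ c :* x3 :* (c :* x4) := c :* c :* (x1 :* x2 :+ x3 :* x4)) refl c x1 x2 x3 x4

  -- The square of the linear form `B a` is additive and leaves the polar form of `qf` unchanged.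
  Q-⊕ : ∀ a x y → Q a (x ⊕ y) ≡ Q a x + Q a y + B x y
  Q-⊕ a x y = trans (cong₂ _+_ (cong (λ b → b * b) (B-⊕ʳ a x y)) (qf-⊕ x y))
    (solve 5 (λ s t u v w → (s :+ t) :* (s :+ t) :+ (u :+ v :+ w) := (s :* s :+ u) :+ (t :* t :+ v) :+ w) refl
      (B a x) (B a y) (qf x) (qf y) (B x y))

  Q-· : ∀ a c x → Q a (c · x) ≡ c * c * Q a x
  Q-· a c x = trans (cong₂ _+_ (cong (λ b → b * b) (B-·ʳ c a x)) (qf-· c x))
    (solve 3 (λ c s u → c :* s :* (c :* s) :+ c :* c :* u := c :* c :* (s :* s :+ u)) refl c (B a x) (qf x))

  Q-·-singular : ∀ {a} c {x} → Q a x ≡ 0# → Q a (c · x) ≡ 0#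
  Q-·-singular {a} c {x} Qx = trans (Q-· a c x) (trans (cong (c * c *_) Qx) (zeroʳ (c * c)))

  Q-0 : ∀ a → Q a 0v ≡ 0#
  Q-0 a = trans (cong (Q a) (sym (0·x≡0 0v))) (trans (Q-· a 0# 0v) (trans (cong (_* Q a 0v) (zeroˡ 0#)) (zeroˡ (Q a 0v))))

  Q-shift : ∀ a x z → Q (a ⊕ x) z ≡ Q a z + B x z * B x z
  Q-shift a x z = trans (cong (λ b → b * b + qf z) (B-⊕ˡ a x z))
    (solve 3 (λ s t u → (s :+ t) :* (s :+ t) :+ u := s :* s :+ u :+ t :* t) refl (B a z) (B x z) (qf z))

  B-combine : ∀ c d x y z → B (c · x ⊕ d · y) z ≡ c * B x z + d * B y z
  B-combine c d x y z = trans (B-⊕ˡ (c · x) (d · y) z) (cong₂ _+_ (B-·ˡ c x z) (B-·ˡ d y z))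

  Q-combine : ∀ a c d x y → Q a (c · x ⊕ d · y) ≡ c * c * Q a x + d * d * Q a y + c * d * B x y
  Q-combine a c d x y = trans (Q-⊕ a (c · x) (d · y)) (cong₂ _+_ (cong₂ _+_ (Q-· a c x) (Q-· a d y))
    (trans (B-·ˡ c x (d · y)) (trans (cong (c *_) (B-·ʳ d x y)) (sym (*-assoc c d (B x y))))))

  opaque
    unfolding _⊕_

    nondegenerate : ∀ {x} → x ≢ 0v → ∃[ y ] B x y ≡ 1#
    nondegenerate {⟨ x1 , x2 , x3 , x4 ⟩} x≢0 with x1 ≟ 0# | x2 ≟ 0# | x3 ≟ 0# | x4 ≟ 0#
    ... | no p | _ | _ | _ = ⟨ 0# , x1 ⁻¹ , 0# , 0# ⟩ , trans (solve 5 (λ x1 x2 x3 x4 y →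
            x1 :* y :+ x2 :* :0 :+ (x3 :* :0 :+ x4 :* :0) := x1 :* y) refl x1 x2 x3 x4 (x1 ⁻¹)) (*-inverseʳ p)
    ... | yes _ | no p | _ | _ = ⟨ x2 ⁻¹ , 0# , 0# , 0# ⟩ , trans (solve 5 (λ x1 x2 x3 x4 y →
            x1 :* :0 :+ x2 :* y :+ (x3 :* :0 :+ x4 :* :0) := x2 :* y) refl x1 x2 x3 x4 (x2 ⁻¹)) (*-inverseʳ p)
    ... | yes _ | yes _ | no p | _ = ⟨ 0# , 0# , 0# , x3 ⁻¹ ⟩ , trans (solve 5 (λ x1 x2 x3 x4 y →
            x1 :* :0 :+ x2 :* :0 :+ (x3 :* y :+ x4 :* :0) := x3 :* y) refl x1 x2 x3 x4 (x3 ⁻¹)) (*-inverseʳ p)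
    ... | yes _ | yes _ | yes _ | no p = ⟨ 0# , 0# , x4 ⁻¹ , 0# ⟩ , trans (solve 5 (λ x1 x2 x3 x4 y →
            x1 :* :0 :+ x2 :* :0 :+ (x3 :* :0 :+ x4 :* y) := x4 :* y) refl x1 x2 x3 x4 (x4 ⁻¹)) (*-inverseʳ p)
    ... | yes refl | yes refl | yes refl | yes refl = contradiction refl x≢0

  opaque
    unfolding _⊕_

    -- The map `z ↦ z + B(z, f) e + B(z, e) f` is self-adjoint, so its trace contains every term
    -- twice and is `0` in characteristic 2. Keeping one term of each pair gives a half trace, which
    -- still shows that the map is not zero when `B e f` is `1`.
    half-trace : ∀ e f →
      (B unit₁ unit₂ + (B unit₁ f * B e unit₂ + B unit₁ e * B f unit₂)) + (B unit₃ unit₄ + (B unit₃ f * B e unit₄ + B unit₃ e * B f unit₄)) ≡ B e f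
    half-trace ⟨ e1 , e2 , e3 , e4 ⟩ ⟨ f1 , f2 , f3 , f4 ⟩ = solve 8 (λ e1 e2 e3 e4 f1 f2 f3 f4 →
      let b = λ x1 x2 x3 x4 y1 y2 y3 y4 → x1 :* y2 :+ x2 :* y1 :+ (x3 :* y4 :+ x4 :* y3)
          b12 = b :1 :0 :0 :0 :0 :1 :0 :0 ; b34 = b :0 :0 :1 :0 :0 :0 :0 :1
          b1e = b :1 :0 :0 :0 e1 e2 e3 e4 ; b1f = b :1 :0 :0 :0 f1 f2 f3 f4
          b3e = b :0 :0 :1 :0 e1 e2 e3 e4 ; b3f = b :0 :0 :1 :0 f1 f2 f3 f4
          be2 = b e1 e2 e3 e4 :0 :1 :0 :0 ; bf2 = b f1 f2 f3 f4 :0 :1 :0 :0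
          be4 = b e1 e2 e3 e4 :0 :0 :0 :1 ; bf4 = b f1 f2 f3 f4 :0 :0 :0 :1
      in (b12 :+ (b1f :* be2 :+ b1e :* bf2)) :+ (b34 :+ (b3f :* be4 :+ b3e :* bf4)) := b e1 e2 e3 e4 f1 f2 f3 f4)
      refl e1 e2 e3 e4 f1 f2 f3 f4

  B≡1⇒≢0 : ∀ {x y} → B x y ≡ 1# → x ≢ 0v
  B≡1⇒≢0 {y = y} e refl = 1≢0 (trans (sym e) (B-0ˡ y))

  -- Elliptic forms

  -- Orthogonal singular vectors span a totally singular subspace, so the Witt index is at most 1.
  -- This is the form in which ellipticity is established for a given solid; `Frame` is the normal
  -- form derived from it.
  NoLines : V → Set
  NoLines a = ∀ {u w} → u ≢ 0v → Q a u ≡ 0# → Q a w ≡ 0# → B u w ≡ 0# → ∃[ c ] w ≡ c · u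

  record HyperbolicPair (a e f : V) : Set where
    field
      Qe  : Q a e ≡ 0#
      Qf  : Q a f ≡ 0#
      Bef : B e f ≡ 1#

  -- In these coordinates `Q a` becomes `st + α² + αβ + εβ²`. The products recover the coordinates
  -- of a combination, whence the four vectors form a basis by counting.
  record Frame (a : V) : Set where
    field
      {e f g h} : V
      pair      : HyperbolicPair a e f
      Qg        : Q a g ≡ 1#
      Qh∉℘      : ∀ s → ℘ s ≢ Q a h
      Beg       : B e g ≡ 0#
      Beh       : B e h ≡ 0#
      Bfg       : B f g ≡ 0#
      Bfh       : B f h ≡ 0#
      Bgh       : B g h ≡ 1#
    open HyperbolicPair pair public

    ε : K
    ε = Q a h

    at : K → K → K → K → V
    at s t α β = (s · e ⊕ t · f) ⊕ (α · g ⊕ β · h)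

  open Frame public using (at)

  -- Dividing by `β²` turns a zero with `β ≢ 0#` into `℘ (α / β) ≡ ε`.
  anisotropic : ∀ {ε α β} → (∀ s → ℘ s ≢ ε) → α * α + α * β + ε * (β * β) ≡ 0# → α ≡ 0# × β ≡ 0#
  anisotropic {ε} {α} {β} ε∉℘ N≡0 with β ≟ 0#
  ... | yes refl = x*x≡0⇒x≡0 (trans (solve 2 (λ a e → a :* a := a :* a :+ a :* :0 :+ e :* (:0 :* :0)) refl α ε) N≡0) , refl
  ... | no β≢0 = contradiction (*-cancelˡ (β * β) (*-≢0 β≢0 β≢0)
      (by-adding (cong₂ _+_ N≡0 (cong₂ _+_ (cong (λ u → (α * α) * (u * u)) β*b≡1) (cong (λ u → α * β * u) β*b≡1)))
        (solve 4 (λ α β ε b → β :* β :* ((α :* b) :* (α :* b) :+ α :* b) :+ ((α :* α :+ α :* β :+ ε :* (β :* β)) :+ (α :* α :* ((β :* b) :* (β :* b)) :+ α :* β :* (β :* b)))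
            := β :* β :* ε :+ (:0 :+ (α :* α :* (:1 :* :1) :+ α :* β :* :1))) refl α β ε (β ⁻¹))))
      (ε∉℘ (α * β ⁻¹))
    where β*b≡1 = *-inverseʳ β≢0

  module _ {a} (F : Frame a) where
    open Frame F hiding (at)

    Q-at : ∀ s t α β → Q a (at F s t α β) ≡ s * t + (α * α + α * β + ε * (β * β))
    Q-at s t α β = begin
      Q a (at F s t α β)
        ≡⟨ Q-⊕ a (s · e ⊕ t · f) (α · g ⊕ β · h) ⟩
      Q a (s · e ⊕ t · f) + Q a (α · g ⊕ β · h) + B (s · e ⊕ t · f) (α · g ⊕ β · h)
        ≡⟨ cong₂ _+_ (cong₂ _+_ (Q-combine a s t e f) (Q-combine a α β g h)) cross ⟩
      s * s * Q a e + t * t * Q a f + s * t * B e f + (α * α * Q a g + β * β * Q a h + α * β * B g h) + 0#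
        ≡⟨ cong₂ (λ u v → u + v + 0#)
             (cong₂ _+_ (cong₂ (λ u v → s * s * u + t * t * v) Qe Qf) (cong (s * t *_) Bef))
             (cong₂ (λ u v → α * α * u + β * β * Q a h + α * β * v) Qg Bgh) ⟩
      s * s * 0# + t * t * 0# + s * t * 1# + (α * α * 1# + β * β * ε + α * β * 1#) + 0#
        ≡⟨ solve 5 (λ s t α β ε → s :* s :* :0 :+ t :* t :* :0 :+ s :* t :* :1 :+ (α :* α :* :1 :+ β :* β :* ε :+ α :* β :* :1) :+ :0
             := s :* t :+ (α :* α :+ α :* β :+ ε :* (β :* β))) refl s t α β ε ⟩
      s * t + (α * α + α * β + ε * (β * β)) ∎
      where
      open ≡-Reasoning
      cross : B (s · e ⊕ t · f) (α · g ⊕ β · h) ≡ 0#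
      cross = trans (B-combine s t e f _) (trans (cong₂ (λ u v → s * u + t * v)
        (trans (B-⊕ʳ e (α · g) (β · h)) (cong₂ _+_ (trans (B-·ʳ α e g) (cong (α *_) Beg)) (trans (B-·ʳ β e h) (cong (β *_) Beh))))
        (trans (B-⊕ʳ f (α · g) (β · h)) (cong₂ _+_ (trans (B-·ʳ α f g) (cong (α *_) Bfg)) (trans (B-·ʳ β f h) (cong (β *_) Bfh)))))
        (solve 4 (λ s t α β → s :* (α :* :0 :+ β :* :0) :+ t :* (α :* :0 :+ β :* :0) := :0) refl s t α β))

    private
      B-at : ∀ s t α β z → B (at F s t α β) z ≡ s * B e z + t * B f z + (α * B g z + β * B h z)
      B-at s t α β z = trans (B-⊕ˡ (s · e ⊕ t · f) (α · g ⊕ β · h) z) (cong₂ _+_ (B-combine s t e f z) (B-combine α β g h z))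

      row : ∀ {s t α β p q r u p′ q′ r′ u′} → p ≡ p′ → q ≡ q′ → r ≡ r′ → u ≡ u′ →
        s * p + t * q + (α * r + β * u) ≡ s * p′ + t * q′ + (α * r′ + β * u′)
      row refl refl refl refl = refl

    module _ (s t α β : K) where

      B-at-e : B (at F s t α β) e ≡ t
      B-at-e = trans (B-at s t α β e) (trans (row (B-self e) (trans (B-comm f e) Bef) (trans (B-comm g e) Beg) (trans (B-comm h e) Beh))
        (solve 4 (λ s t α β → s :* :0 :+ t :* :1 :+ (α :* :0 :+ β :* :0) := t) refl s t α β))

      B-at-f : B (at F s t α β) f ≡ s
      B-at-f = trans (B-at s t α β f) (trans (row Bef (B-self f) (trans (B-comm g f) Bfg) (trans (B-comm h f) Bfh))
        (solve 4 (λ s t α β → s :* :1 :+ t :* :0 :+ (α :* :0 :+ β :* :0) := s) refl s t α β))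

      B-at-g : B (at F s t α β) g ≡ β
      B-at-g = trans (B-at s t α β g) (trans (row Beg Bfg (B-self g) (trans (B-comm h g) Bgh))
        (solve 4 (λ s t α β → s :* :0 :+ t :* :0 :+ (α :* :0 :+ β :* :1) := β) refl s t α β))

      B-at-h : B (at F s t α β) h ≡ α
      B-at-h = trans (B-at s t α β h) (trans (row Beh Bfh Bgh (B-self h))
        (solve 4 (λ s t α β → s :* :0 :+ t :* :0 :+ (α :* :1 :+ β :* :0) := α) refl s t α β))

    at-injective : ∀ {s t α β s′ t′ α′ β′} → at F s t α β ≡ at F s′ t′ α′ β′ → s ≡ s′ × t ≡ t′ × α ≡ α′ × β ≡ β′
    at-injective {s} {t} {α} {β} {s′} {t′} {α′} {β′} eq =
      trans (sym (B-at-f s t α β)) (trans (cong (λ z → B z f) eq) (B-at-f s′ t′ α′ β′)) ,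
      trans (sym (B-at-e s t α β)) (trans (cong (λ z → B z e) eq) (B-at-e s′ t′ α′ β′)) ,
      trans (sym (B-at-h s t α β)) (trans (cong (λ z → B z h) eq) (B-at-h s′ t′ α′ β′)) ,
      trans (sym (B-at-g s t α β)) (trans (cong (λ z → B z g) eq) (B-at-g s′ t′ α′ β′))

    private
      coordinates : V → V
      coordinates x = at F (z₁ x) (z₂ x) (z₃ x) (z₄ x)

      coordinates-surjective : ∀ z → ∃[ x ] coordinates x ≡ z
      coordinates-surjective = finite-injective⇒surjective V-finite
        λ eq → let p , q , r , u = at-injective eq in cong₄ p q r u

      at-cong : ∀ {s t α β s′ t′ α′ β′} → s ≡ s′ → t ≡ t′ → α ≡ α′ → β ≡ β′ → at F s t α β ≡ at F s′ t′ α′ β′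
      at-cong refl refl refl refl = refl

    -- Being injective, the map from coordinates to vectors is onto. Pairing with the frame then
    -- reads the coordinates off, `e` being dual to `f` and `g` to `h`.
    at-coordinates : ∀ z → z ≡ at F (B z f) (B z e) (B z h) (B z g)
    at-coordinates z = recover (coordinates-surjective z)
      where
      recover : ∃[ x ] coordinates x ≡ z → z ≡ at F (B z f) (B z e) (B z h) (B z g)
      recover (⟨ s , t , α , β ⟩ , eq) = trans (sym eq) (at-cong
        (trans (sym (B-at-f s t α β)) (cong (λ z → B z f) eq))
        (trans (sym (B-at-e s t α β)) (cong (λ z → B z e) eq))
        (trans (sym (B-at-h s t α β)) (cong (λ z → B z h) eq))
        (trans (sym (B-at-g s t α β)) (cong (λ z → B z g) eq)))

    B-at-at : ∀ s t α β s′ t′ α′ β′ →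
      B (at F s t α β) (at F s′ t′ α′ β′) ≡ s * t′ + t * s′ + (α * β′ + β * α′)
    B-at-at s t α β s′ t′ α′ β′ = trans (B-at s t α β _) (row
      (trans (B-comm e _) (B-at-e s′ t′ α′ β′)) (trans (B-comm f _) (B-at-f s′ t′ α′ β′))
      (trans (B-comm g _) (B-at-g s′ t′ α′ β′)) (trans (B-comm h _) (B-at-h s′ t′ α′ β′)))

    private
      -- Orthogonality to `f` kills the coordinate along `e`; what remains of `Q a` is the
      -- anisotropic binary form in the last two coordinates.
      singular-⊥f : ∀ {y} → Q a y ≡ 0# → B y f ≡ 0# → y ≡ B y e · f
      singular-⊥f {y} Qy Byf = begin
        y                                      ≡⟨ at-coordinates y ⟩
        at F (B y f) (B y e) (B y h) (B y g)   ≡⟨ cong₂ (λ u (v : K × K) → at F u (B y e) (proj₁ v) (proj₂ v)) Byf (cong₂ _,_ (proj₁ αβ≡0) (proj₂ αβ≡0)) ⟩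
        at F 0# (B y e) 0# 0#                  ≡⟨ cong₂ _⊕_ (trans (cong (_⊕ B y e · f) (0·x≡0 e)) (⊕-identityˡ _)) (trans (cong₂ _⊕_ (0·x≡0 g) (0·x≡0 h)) (⊕-self 0v)) ⟩
        B y e · f ⊕ 0v                         ≡⟨ ⊕-identityʳ _ ⟩
        B y e · f                              ∎
        where
        open ≡-Reasoning
        αβ≡0 : B y h ≡ 0# × B y g ≡ 0#
        αβ≡0 = anisotropic Qh∉℘ (trans (trans (sym (trans (cong (_+ (B y h * B y h + B y h * B y g + ε * (B y g * B y g))) (trans (cong (_* B y e) Byf) (zeroˡ _))) (+-identityˡ _)))
                 (sym (Q-at _ _ _ _))) (trans (cong (Q a) (sym (at-coordinates y))) Qy))

    noLines : NoLines a
    noLines {u} {w} u≢0 Qu Qw Buw with B u f ≟ 0#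
    ... | yes Buf≡0 = t ⁻¹ * B w e , (begin
        w                      ≡⟨ singular-⊥f Qw Bwf≡0 ⟩
        B w e · f              ≡⟨ cong (B w e ·_) (⁻¹·-cancel f t≢0) ⟨
        B w e · t ⁻¹ · t · f   ≡⟨ ·-·-assoc (B w e) (t ⁻¹) (t · f) ⟩
        (B w e * t ⁻¹) · t · f ≡⟨ cong₂ _·_ (*-comm (B w e) (t ⁻¹)) (sym u≡tf) ⟩
        (t ⁻¹ * B w e) · u     ∎)
      where
      open ≡-Reasoning
      t = B u e
      u≡tf : u ≡ t · f
      u≡tf = singular-⊥f Qu Buf≡0
      t≢0 : t ≢ 0#
      t≢0 t≡0 = u≢0 (trans u≡tf (trans (cong (_· f) t≡0) (0·x≡0 f)))
      Bwf≡0 : B w f ≡ 0#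
      Bwf≡0 = trans (B-comm w f) (x*y≡0⇒y≡0 t≢0 (trans (sym (trans (cong (λ z → B z w) u≡tf) (B-·ˡ t f w))) Buw))
    ... | no c≢0 = _ , dependent c≢0 y≡0
      where
      c = B u f
      d = B w f
      -- The combination of `u` and `w` orthogonal to `f`. It is singular, hence a multiple of `f`;
      -- it is also orthogonal to `u`, which `f` is not, so it vanishes.
      y = c · w ⊕ d · u
      Qy : Q a y ≡ 0#
      Qy = trans (Q-combine a c d w u) (trans (cong₂ _+_ (cong₂ (λ m n → c * c * m + d * d * n) Qw Qu) (cong (c * d *_) (trans (B-comm w u) Buw)))
        (solve 2 (λ c d → c :* c :* :0 :+ d :* d :* :0 :+ c :* d :* :0 := :0) refl c d))
      Byf : B y f ≡ 0#
      Byf = trans (B-combine c d w u f) (solve 2 (λ c d → c :* d :+ d :* c := :0) refl c d)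
      Byu : B y u ≡ 0#
      Byu = trans (B-combine c d w u u) (trans (cong₂ (λ m n → c * m + d * n) (trans (B-comm w u) Buw) (B-self u))
        (solve 2 (λ c d → c :* :0 :+ d :* :0 := :0) refl c d))
      y≡tf : y ≡ B y e · f
      y≡tf = singular-⊥f Qy Byf
      t≡0 : B y e ≡ 0#
      t≡0 = x*y≡0⇒y≡0 c≢0 (trans (*-comm c (B y e)) (trans (cong (B y e *_) (B-comm u f))
        (trans (sym (trans (cong (λ z → B z u) y≡tf) (B-·ˡ (B y e) f u))) Byu)))
      y≡0 : y ≡ 0v
      y≡0 = trans y≡tf (trans (cong (_· f) t≡0) (0·x≡0 f))

  module _ {a} (ell : NoLines a) where

    -- If `B e w` is `1`, then adding `c · e` to a vector `w` changes `Q a w` by exactly `c`, so a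
    -- suitable multiple of `e` makes `w` singular.
    completePair : ∀ {e} → e ≢ 0v → Q a e ≡ 0# → ∃[ f ] HyperbolicPair a e f
    completePair {e} e≢0 Qe with w , Bew ← nondegenerate e≢0 = w ⊕ Q a w · e , record
      { Qe  = Qe
      ; Qf  = begin
          Q a (w ⊕ c · e)                          ≡⟨ Q-⊕ a w (c · e) ⟩
          c + Q a (c · e) + B w (c · e)            ≡⟨ cong₂ (λ u v → c + u + v) (trans (Q-· a c e) (cong (c * c *_) Qe)) (trans (B-·ʳ c w e) (cong (c *_) (trans (B-comm w e) Bew))) ⟩
          c + c * c * 0# + c * 1#                  ≡⟨ solve 1 (λ c → c :+ c :* c :* :0 :+ c :* :1 := :0) refl c ⟩
          0#                                       ∎
      ; Bef = trans (B-⊕ʳ e w (c · e)) (trans (cong₂ _+_ Bew (B-self-·ʳ c e)) (+-identityʳ 1#))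
      }
      where
      open ≡-Reasoning
      c = Q a w

    module _ {e f} (pair : HyperbolicPair a e f) where
      open HyperbolicPair pair

      private
        project : V → V
        project z = z ⊕ (B z f · e ⊕ B z e · f)

        B-project : ∀ z w → B (project z) w ≡ B z w + (B z f * B e w + B z e * B f w)
        B-project z w = trans (B-⊕ˡ z _ w) (cong (B z w +_) (B-combine (B z f) (B z e) e f w))

        project-⊥e : ∀ z → B (project z) e ≡ 0#
        project-⊥e z = trans (B-project z e) (trans (cong₂ (λ u v → B z e + (B z f * u + B z e * v)) (B-self e) (trans (B-comm f e) Bef))
          (solve 2 (λ u v → v :+ (u :* :0 :+ v :* :1) := :0) refl (B z f) (B z e)))

        project-⊥f : ∀ z → B (project z) f ≡ 0#
        project-⊥f z = trans (B-project z f) (trans (cong₂ (λ u v → B z f + (B z f * u + B z e * v)) Bef (B-self f))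
          (solve 2 (λ u v → u :+ (u :* :1 :+ v :* :0) := :0) refl (B z f) (B z e)))

        -- A singular vector orthogonal to `e` is a multiple `c · e` since there are no lines, and
        -- `c` is its product with `f`.
        singular-⊥ : ∀ {y} → B y e ≡ 0# → B y f ≡ 0# → Q a y ≡ 0# → y ≡ 0v
        singular-⊥ {y} Bye Byf Qy with c , refl ← ell (B≡1⇒≢0 Bef) Qe Qy (trans (B-comm e y) Bye)
          = trans (cong (_· e) (trans (sym (trans (B-·ˡ c e f) (trans (cong (c *_) Bef) (*-identityʳ c)))) Byf)) (0·x≡0 e)

        nonzero-⊥ : ∃[ y ] B y e ≡ 0# × B y f ≡ 0# × y ≢ 0v
        nonzero-⊥ with project unit₁ ≟v 0v | project unit₃ ≟v 0v
        ... | no p | _ = project unit₁ , project-⊥e _ , project-⊥f _ , p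
        ... | yes _ | no p = project unit₃ , project-⊥e _ , project-⊥f _ , p
        ... | yes p | yes r = contradiction (trans (sym trace≡1) (trans (cong₂ _+_ (trans (cong (λ y → B y unit₂) p) (B-0ˡ _))
                                (trans (cong (λ y → B y unit₄) r) (B-0ˡ _))) (+-identityʳ 0#))) 1≢0
          where
          -- half the trace of the projection onto the plane orthogonal to e and f
          trace : B (project unit₁) unit₂ + B (project unit₃) unit₄ ≡ B e f
          trace = trans (cong₂ _+_ (B-project _ _) (B-project _ _)) (half-trace e f)
          trace≡1 = trans trace Bef

      normalise-⊥ : ∃[ g ] B e g ≡ 0# × B f g ≡ 0# × Q a g ≡ 1#
      normalise-⊥ with y , Bye , Byf , y≢0 ← nonzero-⊥ with sqrt (Q a y ⁻¹)
      ... | r , r²≡Qy⁻¹ = r · y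
          , trans (B-·ʳ r e y) (trans (cong (r *_) (trans (B-comm e y) Bye)) (zeroʳ r))
          , trans (B-·ʳ r f y) (trans (cong (r *_) (trans (B-comm f y) Byf)) (zeroʳ r))
          , trans (Q-· a r y) (trans (cong (_* Q a y) r²≡Qy⁻¹) (trans (*-comm _ _) (*-inverseʳ λ Qy≡0 → y≢0 (singular-⊥ Bye Byf Qy≡0))))

      -- A solution of `℘ s ≡ Q a h` would make `s · g ⊕ h` singular in the anisotropic plane
      -- orthogonal to `e` and `f`, hence zero, although its product with `g` is `1`.
      completeFrame : ∀ {g} → B e g ≡ 0# → B f g ≡ 0# → Q a g ≡ 1# → ∃[ F ] Frame.e {a} F ≡ e × Frame.f F ≡ f × Frame.g F ≡ g
      completeFrame {g} Beg Bfg Qg = F , refl , refl , refl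
        where
        g≢0 : g ≢ 0v
        g≢0 refl = 1≢0 (trans (sym Qg) (Q-0 a))
        k = proj₁ (nondegenerate g≢0)
        h = project k
        Bgh : B g h ≡ 1#
        Bgh = trans (B-comm g h) (trans (B-project k g) (trans (cong₂ (λ u v → B k g + (B k f * u + B k e * v)) Beg Bfg)
          (trans (solve 3 (λ w u v → w :+ (u :* :0 :+ v :* :0) := w) refl (B k g) (B k f) (B k e)) (trans (B-comm k g) (proj₂ (nondegenerate g≢0))))))
        module _ (s : K) where
          u = s · g ⊕ 1# · h
          uBg : B u g ≡ B h g
          uBg = trans (B-combine s 1# g h g) (trans (cong (λ w → s * w + 1# * B h g) (B-self g))
            (solve 2 (λ s w → s :* :0 :+ :1 :* w := w) refl s (B h g)))
          u≡0 : ℘ s ≡ Q a h → u ≡ 0v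
          u≡0 ℘s≡Qh = singular-⊥
            (trans (B-combine s 1# g h e) (trans (cong₂ (λ v w → s * v + 1# * w) (trans (B-comm g e) Beg) (project-⊥e k))
              (solve 1 (λ s → s :* :0 :+ :1 :* :0 := :0) refl s)))
            (trans (B-combine s 1# g h f) (trans (cong₂ (λ v w → s * v + 1# * w) (trans (B-comm g f) Bfg) (project-⊥f k))
              (solve 1 (λ s → s :* :0 :+ :1 :* :0 := :0) refl s)))
            (trans (Q-combine a s 1# g h) (trans (cong₂ (λ v w → s * s * v + 1# * 1# * Q a h + s * 1# * w) Qg Bgh)
              (by-adding ℘s≡Qh (solve 2 (λ s ε → s :* s :* :1 :+ :1 :* :1 :* ε :+ s :* :1 :* :1 :+ (s :* s :+ s) := :0 :+ ε) refl s (Q a h)))))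

        F : Frame a
        F = record
          { e = e ; f = f ; g = g ; h = h ; pair = pair ; Qg = Qg ; Beg = Beg ; Bfg = Bfg
          ; Beh = trans (B-comm e h) (project-⊥e k)
          ; Bfh = trans (B-comm f h) (project-⊥f k)
          ; Bgh = Bgh
          ; Qh∉℘ = λ s ℘s≡Qh → 1≢0 (begin
              1#              ≡⟨ Bgh ⟨
              B g h           ≡⟨ B-comm g h ⟩
              B h g           ≡⟨ uBg s ⟨
              B (u s) g       ≡⟨ cong (λ u → B u g) (u≡0 s ℘s≡Qh) ⟩
              B 0v g          ≡⟨ B-0ˡ g ⟩
              0#              ∎)
          }
          where open ≡-Reasoning

      completeFrame₀ : ∃[ F ] Frame.e {a} F ≡ e × Frame.f F ≡ f
      completeFrame₀ = let g , Beg , Bfg , Qg = normalise-⊥ ; F , e≡ , f≡ , _ = completeFrame Beg Bfg Qg in F , e≡ , f≡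

  -- Q (a ⊕ x) is Q a composed with the transvection z ↦ z + B(x, z) x.
  shiftFrame : ∀ {a x} → Q a x ≡ 0# → Frame a → Frame (a ⊕ x)
  shiftFrame {a} {x} Qx F = record
    { e = τ e ; f = τ f ; g = τ g ; h = τ h
    ; pair = record { Qe = trans (Q-τ e) Qe ; Qf = trans (Q-τ f) Qf ; Bef = trans (B-τ e f) Bef }
    ; Qg = trans (Q-τ g) Qg
    ; Qh∉℘ = λ s eq → Qh∉℘ s (trans eq (Q-τ h))
    ; Beg = trans (B-τ e g) Beg ; Beh = trans (B-τ e h) Beh
    ; Bfg = trans (B-τ f g) Bfg ; Bfh = trans (B-τ f h) Bfh ; Bgh = trans (B-τ g h) Bgh
    }
    where
    open Frame F
    τ : V → V
    τ z = z ⊕ B x z · x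
    B-τ : ∀ z w → B (τ z) (τ w) ≡ B z w
    B-τ z w = trans (B-⊕ˡ z _ (τ w)) (trans (cong₂ _+_
        (trans (B-⊕ʳ z w _) (cong (B z w +_) (B-·ʳ (B x w) z x)))
        (trans (B-·ˡ (B x z) x (τ w)) (cong (B x z *_) (trans (B-⊕ʳ x w _) (cong (B x w +_) (trans (B-·ʳ (B x w) x x) (cong (B x w *_) (B-self x))))))))
      (trans (cong (λ u → B z w + B x w * u + B x z * (B x w + B x w * 0#)) (B-comm z x))
      (solve 3 (λ s t u → s :+ t :* u :+ u :* (t :+ t :* :0) := s) refl (B z w) (B x w) (B x z))))
    Q-τ : ∀ z → Q (a ⊕ x) (τ z) ≡ Q a z
    Q-τ z = trans (Q-shift a x (τ z)) (trans (cong₂ (λ u v → u + v * v)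
      (trans (Q-⊕ a z _) (cong₂ (λ u v → Q a z + u + v) (trans (Q-· a (B x z) x) (cong (B x z * B x z *_) Qx)) (trans (B-·ʳ (B x z) z x) (cong (B x z *_) (B-comm z x)))))
      (trans (B-⊕ʳ x z _) (cong (B x z +_) (trans (B-·ʳ (B x z) x x) (cong (B x z *_) (B-self x))))))
      (solve 2 (λ s t → s :+ t :* t :* :0 :+ t :* t :+ (t :+ t :* :0) :* (t :+ t :* :0) := s) refl (Q a z) (B x z)))

-- Tangency as a relation between poles

module Tangency {q : ℕ} (𝔽 : FiniteField₂ q) where

  open FieldTheory 𝔽
  open Forms 𝔽

  infix 4 _~_
  _~_ : V → V → Set
  a ~ b = a ≢ b × Q a (a ⊕ b) ≡ 0#

  ~-sym : ∀ {a b} → a ~ b → b ~ a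
  ~-sym {a} {b} (a≢b , Qab) = a≢b ∘ sym , (begin
    Q b (b ⊕ a)                                ≡⟨ cong₂ Q (sym (x⊕x⊕y≡y a b)) (⊕-comm b a) ⟩
    Q (a ⊕ (a ⊕ b)) (a ⊕ b)                    ≡⟨ Q-shift a (a ⊕ b) (a ⊕ b) ⟩
    Q a (a ⊕ b) + B (a ⊕ b) (a ⊕ b) * B (a ⊕ b) (a ⊕ b) ≡⟨ cong₂ (λ u v → u + v * v) Qab (B-self (a ⊕ b)) ⟩
    0# + 0# * 0#                               ≡⟨ trans (+-identityˡ _) (zeroˡ 0#) ⟩
    0#                                         ∎)
    where open ≡-Reasoning

  -- A neighbour b of a is studied through the singular vector a ⊕ b of Q a.
  ~⇒≢0 : ∀ {a b} → a ~ b → a ⊕ b ≢ 0v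
  ~⇒≢0 (a≢b , _) e = a≢b (x⊕y≡0⇒x≡y e)

  shift-~ : ∀ {a x} → x ≢ 0v → Q a x ≡ 0# → a ~ a ⊕ x
  shift-~ {a} {x} x≢0 Qx = (λ e → x≢0 (⊕-cancelˡ a (trans (sym e) (sym (⊕-identityʳ a))))) , trans (cong (Q a) (x⊕x⊕y≡y a x)) Qx

  module _ {a x y} (Qx : Q a x ≡ 0#) (Qy : Q a y ≡ 0#) where

    Q-difference : Q (a ⊕ x) (x ⊕ y) ≡ B x y + B x y * B x y
    Q-difference = trans (Q-shift a x (x ⊕ y)) (trans (cong₂ (λ u v → u + v * v)
      (trans (Q-⊕ a x y) (cong₂ (λ u v → u + v + B x y) Qx Qy)) (trans (B-⊕ʳ x x y) (cong (_+ B x y) (B-self x))))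
      (solve 1 (λ b → :0 :+ :0 :+ b :+ (:0 :+ b) :* (:0 :+ b) := b :+ b :* b) refl (B x y)))

    tangent⇒0or1 : a ⊕ x ~ a ⊕ y → B x y ≡ 0# ⊎ B x y ≡ 1#
    tangent⇒0or1 (_ , Qxy) = x*x≡x⇒0or1 (x+y≡0⇒x≡y (trans (+-comm _ _)
      (trans (sym Q-difference) (trans (cong (Q (a ⊕ x)) (sym ([x⊕y]⊕[x⊕z]≡y⊕z a x y))) Qxy))))

    0or1⇒tangent : x ≢ y → B x y ≡ 0# ⊎ B x y ≡ 1# → a ⊕ x ~ a ⊕ y
    0or1⇒tangent x≢y b = x≢y ∘ ⊕-cancelˡ a , trans (cong (Q (a ⊕ x)) ([x⊕y]⊕[x⊕z]≡y⊕z a x y)) (trans Q-difference (vanish b))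
      where
      vanish : ∀ {b} → b ≡ 0# ⊎ b ≡ 1# → b + b * b ≡ 0#
      vanish (inj₁ refl) = trans (+-identityˡ _) (zeroˡ 0#)
      vanish (inj₂ refl) = x≡y⇒x+y≡0 (sym (*-identityˡ 1#))

  β : V → V → V → K
  β a b c = B (a ⊕ b) (a ⊕ c)

  β-comm : ∀ a b c → β a b c ≡ β a c b
  β-comm a b c = B-comm (a ⊕ b) (a ⊕ c)

  triangle : ∀ {a b c} → a ~ b → a ~ c → b ~ c → β a b c ≡ 0# ⊎ β a b c ≡ 1#
  triangle {a} {b} {c} (_ , Qb) (_ , Qc) b~c = tangent⇒0or1 Qb Qc (subst₂ _~_ (sym (x⊕x⊕y≡y a b)) (sym (x⊕x⊕y≡y a c)) b~c)

  module _ {a} (ell : NoLines a) {b c d} (a~b : a ~ b) (a~c : a ~ c) (a~d : a ~ d) (b~c : b ~ c) (b~d : b ~ d) (c~d : c ~ d) where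

    -- The vector `a ⊕ c` is a multiple `k` of `a ⊕ b`. If `β a b d` were `1`, then `β a c d` would
    -- be `k`, so `k` would be `0` or `1`, and `c` would coincide with `a` or `b`.
    flat-propagates : β a b c ≡ 0# → β a b d ≡ 0#
    flat-propagates βbc≡0 = conclude (triangle a~b a~d b~d) (triangle a~c a~d c~d)
      where
      k = proj₁ (ell (~⇒≢0 a~b) (proj₂ a~b) (proj₂ a~c) βbc≡0)
      c≡kb : a ⊕ c ≡ k · (a ⊕ b)
      c≡kb = proj₂ (ell (~⇒≢0 a~b) (proj₂ a~b) (proj₂ a~c) βbc≡0)
      conclude : β a b d ≡ 0# ⊎ β a b d ≡ 1# → β a c d ≡ 0# ⊎ β a c d ≡ 1# → β a b d ≡ 0#
      conclude (inj₁ p) _ = p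
      conclude (inj₂ p) r = contradiction r λ where
          (inj₁ r) → ~⇒≢0 a~c (trans c≡kb (trans (cong (_· (a ⊕ b)) (trans (sym βcd≡k) r)) (0·x≡0 _)))
          (inj₂ r) → proj₁ b~c (sym (⊕-cancelˡ a (trans c≡kb (trans (cong (_· (a ⊕ b)) (trans (sym βcd≡k) r)) (1·x≡x _)))))
        where
        βcd≡k : β a c d ≡ k
        βcd≡k = trans (cong (λ z → B z (a ⊕ d)) c≡kb) (trans (B-·ˡ k _ _) (trans (cong (k *_) p) (*-identityʳ k)))

  module _ {a} (ell : NoLines a) {b c d} (a~b : a ~ b) (a~c : a ~ c) (a~d : a ~ d) (b~c : b ~ c) (b~d : b ~ d) (c~d : c ~ d) where

    spread-propagates : β a b c ≡ 1# → β a b d ≡ 1#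
    spread-propagates βbc≡1 with triangle a~b a~d b~d
    ... | inj₂ p = p
    ... | inj₁ p = contradiction (trans (sym βbc≡1) (flat-propagates ell a~b a~d a~c b~d b~c (~-sym c~d) p)) 1≢0

  module _ {a} (F : Frame a) where
    open Frame F using (e; f; g; h; ε; Qe; Qf; Bef; Qh∉℘)

    N : K → K → K
    N α β = α * α + α * β + ε * (β * β)

    member : K → K → V
    member α β = a ⊕ at F 1# 1# α β

    member-injective : ∀ {α β α′ β′} → member α β ≡ member α′ β′ → α ≡ α′ × β ≡ β′
    member-injective eq = proj₂ (proj₂ (at-injective F (⊕-cancelˡ a eq)))

    Q-11 : ∀ {α β} → N α β ≡ 1# → Q a (at F 1# 1# α β) ≡ 0#
    Q-11 {α} {β} N≡1 = trans (Q-at F 1# 1# α β) (trans (cong (1# * 1# +_) N≡1) (x≡y⇒x+y≡0 (*-identityˡ 1#)))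

    private
      B-e-11 : ∀ α β → B e (at F 1# 1# α β) ≡ 1#
      B-e-11 α β = trans (B-comm e _) (B-at-e F 1# 1# α β)

      B-f-11 : ∀ α β → B f (at F 1# 1# α β) ≡ 1#
      B-f-11 α β = trans (B-comm f _) (B-at-f F 1# 1# α β)

    B-11 : ∀ α β α′ β′ → B (at F 1# 1# α β) (at F 1# 1# α′ β′) ≡ α * β′ + β * α′
    B-11 α β α′ β′ = trans (B-at-at F 1# 1# α β 1# 1# α′ β′)
      (solve 4 (λ α β α′ β′ → :1 :* :1 :+ :1 :* :1 :+ (α :* β′ :+ β :* α′) := α :* β′ :+ β :* α′) refl α β α′ β′)

    module _ {α β} (N≡1 : N α β ≡ 1#) where

      member-~a : a ~ member α β
      member-~a = shift-~ (B≡1⇒≢0 (B-at-e F 1# 1# α β)) (Q-11 N≡1)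

      member-~e : a ⊕ e ~ member α β
      member-~e = 0or1⇒tangent Qe (Q-11 N≡1) (λ eq → 1≢0 (trans (sym (B-at-e F 1# 1# α β)) (trans (cong (λ z → B z e) (sym eq)) (B-self e)))) (inj₂ (B-e-11 α β))

      member-~f : a ⊕ f ~ member α β
      member-~f = 0or1⇒tangent Qf (Q-11 N≡1) (λ eq → 1≢0 (trans (sym (B-at-f F 1# 1# α β)) (trans (cong (λ z → B z f) (sym eq)) (B-self f)))) (inj₂ (B-f-11 α β))

      member-~member : ∀ {α′ β′} → N α′ β′ ≡ 1# → α * β′ + β * α′ ≡ 1# → member α β ~ member α′ β′
      member-~member {α′} {β′} N′≡1 det≡1 = 0or1⇒tangent (Q-11 N≡1) (Q-11 N′≡1)
        (λ eq → 1≢0 (trans (sym (trans (B-11 α β α′ β′) det≡1)) (trans (cong (B _) (sym eq)) (B-self _))))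
        (inj₂ (trans (B-11 α β α′ β′) det≡1))

    private
      a~e : a ~ a ⊕ e
      a~e = shift-~ (B≡1⇒≢0 Bef) Qe
      a~f : a ~ a ⊕ f
      a~f = shift-~ (B≡1⇒≢0 (trans (B-comm f e) Bef)) Qf
      e≢f : e ≢ f
      e≢f eq = 1≢0 (trans (sym Bef) (trans (cong (B e) (sym eq)) (B-self e)))
      e~f : a ⊕ e ~ a ⊕ f
      e~f = 0or1⇒tangent Qe Qf e≢f (inj₂ Bef)

      βef≡1 : β a (a ⊕ e) (a ⊕ f) ≡ 1#
      βef≡1 = trans (cong₂ B (x⊕x⊕y≡y a e) (x⊕x⊕y≡y a f)) Bef

    -- By `spread-propagates` both hyperbolic coordinates of `a ⊕ v` are `1`, and being singular
    -- then means lying on the conic.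
    common₃ : ∀ {v} → a ~ v → a ⊕ e ~ v → a ⊕ f ~ v → ∃[ α ] ∃[ β ] N α β ≡ 1# × v ≡ member α β
    common₃ {v} a~v e~v f~v = B z h , B z g , N≡1 , trans (sym (x⊕x⊕y≡y a v)) (cong (a ⊕_) z≡)
      where
      z = a ⊕ v
      βev : B e z ≡ 1#
      βev = trans (cong (λ y → B y z) (sym (x⊕x⊕y≡y a e))) (spread-propagates (noLines F) a~e a~f a~v e~f e~v f~v βef≡1)
      βfv : B f z ≡ 1#
      βfv = trans (cong (λ y → B y z) (sym (x⊕x⊕y≡y a f))) (spread-propagates (noLines F) a~f a~e a~v (~-sym e~f) f~v e~v (trans (β-comm a _ _) βef≡1))
      z≡ : z ≡ at F 1# 1# (B z h) (B z g)
      z≡ = trans (at-coordinates F z) (cong₂ (λ s t → at F s t (B z h) (B z g)) (trans (B-comm z f) βfv) (trans (B-comm z e) βev))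
      N≡1 : N (B z h) (B z g) ≡ 1#
      N≡1 = sym (x+y≡0⇒x≡y (trans (cong (_+ N (B z h) (B z g)) (sym (*-identityˡ 1#))) (trans (sym (Q-at F 1# 1# (B z h) (B z g))) (trans (cong (Q a) (sym z≡)) (proj₂ a~v)))))

    -- Tangency alone leaves the values `0` and `1`. The product of a difference with `e` is `1`,
    -- and this value propagates through the clique formed with `a` and `a ⊕ e`.
    members-adjacent : ∀ {α β α′ β′} → N α β ≡ 1# → N α′ β′ ≡ 1# → member α β ~ member α′ β′ → α * β′ + β * α′ ≡ 1#
    members-adjacent {α} {β′} {α′} {β″} N≡1 N′≡1 adj = trans (sym (B-11 α β′ α′ β″)) (trans (cong₂ B (sym (x⊕x⊕y≡y a _)) (sym (x⊕x⊕y≡y a _)))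
      (spread-propagates (noLines F) (member-~a N≡1) a~e (member-~a N′≡1) (~-sym (member-~e N≡1)) adj (member-~e N′≡1)
        (trans (cong₂ B (x⊕x⊕y≡y a _) (x⊕x⊕y≡y a e)) (B-at-e F 1# 1# α β′))))

    N-10 : N 1# 0# ≡ 1#
    N-10 = solve 1 (λ ε → :1 :* :1 :+ :1 :* :0 :+ ε :* (:0 :* :0) := :1) refl ε

    N-α1 : ∀ {α} → ℘ α ≡ ε + 1# → N α 1# ≡ 1#
    N-α1 {α} eq = by-adding eq (solve 2 (λ α ε → α :* α :+ α :* :1 :+ ε :* (:1 :* :1) :+ (α :* α :+ α) := :1 :+ (ε :+ :1)) refl α ε)

    det-10 : ∀ α → 1# * 1# + 0# * α ≡ 1#
    det-10 = solve 1 (λ α → :1 :* :1 :+ :0 :* α := :1) refl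

    -- The determinant with `(1, 0)` is `β`, so `β` is `1`, and the equation of the conic turns into
    -- `℘ α ≡ ε + 1#`.
    common₄ : ∀ {v} → a ~ v → a ⊕ e ~ v → a ⊕ f ~ v → member 1# 0# ~ v → ∃[ α ] ℘ α ≡ ε + 1# × v ≡ member α 1#
    common₄ {v} a~v e~v f~v m~v = restrict (common₃ a~v e~v f~v)
      where
      restrict : ∃[ α ] ∃[ β ] N α β ≡ 1# × v ≡ member α β → ∃[ α ] ℘ α ≡ ε + 1# × v ≡ member α 1#
      restrict (α , β , N≡1 , v≡) = α , ℘α , trans v≡ (cong (member α) β≡1)
        where
        β≡1 : β ≡ 1#
        β≡1 = trans (solve 2 (λ α β → β := :1 :* β :+ :0 :* α) refl α β) (members-adjacent N-10 N≡1 (subst (member 1# 0# ~_) v≡ m~v))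
        ℘α : ℘ α ≡ ε + 1#
        ℘α = by-adding (trans (cong (N α) (sym β≡1)) N≡1)
          (solve 2 (λ α ε → (α :* α :+ α) :+ (α :* α :+ α :* :1 :+ ε :* (:1 :* :1)) := (ε :+ :1) :+ :1) refl α ε)

    -- The determinant of `(s, 1)` and `(α, 1)` is `s + α`, which has to be `1`.
    common₅ : ∀ {v s} → ℘ s ≡ ε + 1# → a ~ v → a ⊕ e ~ v → a ⊕ f ~ v → member 1# 0# ~ v → member s 1# ~ v → v ≡ member (s + 1#) 1#
    common₅ {v} {s} ℘s a~v e~v f~v m~v s~v = restrict (common₄ a~v e~v f~v m~v)
      where
      restrict : ∃[ α ] ℘ α ≡ ε + 1# × v ≡ member α 1# → v ≡ member (s + 1#) 1#
      restrict (α , ℘α , v≡) = trans v≡ (cong (λ α → member α 1#) (by-adding (members-adjacent (N-α1 ℘s) (N-α1 ℘α) (subst (member s 1# ~_) v≡ s~v))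
        (solve 2 (λ α s → α :+ (s :* :1 :+ :1 :* α) := s :+ :1 :+ :1) refl α s)))

    det-s : ∀ s → s * 1# + 1# * (s + 1#) ≡ 1#
    det-s = solve 1 (λ s → s :* :1 :+ :1 :* (s :+ :1) := :1) refl

    -- The conic N = 1 is parametrised by the lines through its point (1, 0), k being the one in direction (k, 1).
    private
      D : K → K
      D k = ℘ k + ε

      D≢0 : ∀ k → D k ≢ 0#
      D≢0 k eq = Qh∉℘ k (x+y≡0⇒x≡y eq)

    conic : Fin (suc q) → K × K
    conic zero    = 1# , 0#
    -- At `(1, 0) + r (k, 1)` the form `N` has the value `1 + r + r² D k`; apart from `r = 0` this
    -- is `1` only for `r = 1 / D k`.
    conic (suc k) = 1# + k * D k ⁻¹ , D k ⁻¹

    conic-N : ∀ i → N (proj₁ (conic i)) (proj₂ (conic i)) ≡ 1#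
    conic-N zero = N-10
    conic-N (suc k) = by-adding (cong (λ u → D k ⁻¹ * u) (*-inverseʳ (D≢0 k)))
      (solve 3 (λ k d ε → (:1 :+ k :* d) :* (:1 :+ k :* d) :+ (:1 :+ k :* d) :* d :+ ε :* (d :* d) :+ d :* ((k :* k :+ k :+ ε) :* d) := :1 :+ d :* :1) refl k (D k ⁻¹) ε)

    conic-injective : ∀ {i j} → conic i ≡ conic j → i ≡ j
    conic-injective {zero} {zero} eq = refl
    conic-injective {zero} {suc k} eq = contradiction (sym (cong proj₂ eq)) (⁻¹-≢0 (D≢0 k))
    conic-injective {suc k} {zero} eq = contradiction (cong proj₂ eq) (⁻¹-≢0 (D≢0 k))
    conic-injective {suc k} {suc l} eq = cong suc (*-cancelˡ (D k ⁻¹) (⁻¹-≢0 (D≢0 k))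
      (trans (*-comm _ k) (trans (+-cancelˡ 1# (cong proj₁ eq)) (trans (cong (l *_) (sym (cong proj₂ eq))) (*-comm l _)))))

    conic-surjective : ∀ {α β} → N α β ≡ 1# → ∃[ i ] conic i ≡ (α , β)
    conic-surjective {α} {β} N≡1 with β ≟ 0#
    ... | yes refl = zero , cong (_, 0#) (square-injective (trans (*-identityˡ 1#) (trans (sym N≡1)
            (solve 2 (λ α ε → α :* α :+ α :* :0 :+ ε :* (:0 :* :0) := α :* α) refl α ε))))
    ... | no β≢0 = suc k , cong₂ _,_ (trans (cong (λ d → 1# + k * d) d≡β) (trans (cong (1# +_) kβ)
            (solve 1 (λ α → :1 :+ (α :+ :1) := α) refl α))) d≡β
      where
      -- The direction of the line joining `(1, 0)` to the given point.
      k = (α + 1#) * β ⁻¹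
      kβ : k * β ≡ α + 1#
      kβ = trans (solve 3 (λ a b c → a :* c :* b := a :* (b :* c)) refl (α + 1#) β (β ⁻¹)) (trans (cong ((α + 1#) *_) (*-inverseʳ β≢0)) (*-identityʳ _))
      Dβ≡1 : D k * β ≡ 1#
      Dβ≡1 = *-cancelˡ β β≢0 (by-adding (cong₂ _+_ (cong (λ u → u * u + u * β) kβ) N≡1)
        (solve 4 (λ k β α ε → β :* ((k :* k :+ k :+ ε) :* β) :+ ((k :* β) :* (k :* β) :+ (k :* β) :* β :+ (α :* α :+ α :* β :+ ε :* (β :* β)))
           := β :* :1 :+ ((α :+ :1) :* (α :+ :1) :+ (α :+ :1) :* β :+ :1)) refl k β α ε))
      d≡β : D k ⁻¹ ≡ β
      d≡β = *-cancelˡ (D k) (D≢0 k) (trans (*-inverseʳ (D≢0 k)) (sym Dβ≡1))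

-- Solids meeting the quadric in an elliptic quadric, and their poles

module Solids {q : ℕ} (𝔽 : FiniteField₂ q) where

  open FieldTheory 𝔽
  open Forms 𝔽

  -- (t, z) stands for the vector with coordinates t, z₁, z₂, z₃, z₄.
  W : Set
  W = K × V

  infixl 6 _⊕w_
  infixr 7 _·w_

  _⊕w_ : W → W → W
  (s , x) ⊕w (t , y) = s + t , x ⊕ y

  _·w_ : K → W → W
  k ·w (t , x) = k * t , k · x

  0w : W
  0w = 0# , 0v

  parabolic : W → K
  parabolic (t , z) = t * t + qf z

  -- A linear injection of V into W plays the part of a basis of a solid.
  record Solid : Set where
    field
      map       : V → W
      map-⊕     : ∀ x y → map (x ⊕ y) ≡ map x ⊕w map y
      map-·     : ∀ k x → map (k · x) ≡ k ·w map x
      injective : Injective _≡_ _≡_ map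

    map-0 : map 0v ≡ 0w
    map-0 = trans (cong map (sym (0·x≡0 0v))) (trans (map-· 0# 0v) (cong₂ _,_ (zeroˡ _) (0·x≡0 _)))

  opaque
    unfolding _⊕_

    expand : ∀ x → z₁ x · unit₁ ⊕ (z₂ x · unit₂ ⊕ (z₃ x · unit₃ ⊕ z₄ x · unit₄)) ≡ x
    expand ⟨ x1 , x2 , x3 , x4 ⟩ = cong₄
      (solve 4 (λ x1 x2 x3 x4 → x1 :* :1 :+ (x2 :* :0 :+ (x3 :* :0 :+ x4 :* :0)) := x1) refl x1 x2 x3 x4)
      (solve 4 (λ x1 x2 x3 x4 → x1 :* :0 :+ (x2 :* :1 :+ (x3 :* :0 :+ x4 :* :0)) := x2) refl x1 x2 x3 x4)
      (solve 4 (λ x1 x2 x3 x4 → x1 :* :0 :+ (x2 :* :0 :+ (x3 :* :1 :+ x4 :* :0)) := x3) refl x1 x2 x3 x4)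
      (solve 4 (λ x1 x2 x3 x4 → x1 :* :0 :+ (x2 :* :0 :+ (x3 :* :0 :+ x4 :* :1)) := x4) refl x1 x2 x3 x4)

    unit₁≢0 : unit₁ ≢ 0v
    unit₁≢0 e = 1≢0 (cong z₁ e)

    B-coordinates : ∀ a x → B a x ≡ z₁ x * z₂ a + (z₂ x * z₁ a + (z₃ x * z₄ a + z₄ x * z₃ a))
    B-coordinates ⟨ a1 , a2 , a3 , a4 ⟩ ⟨ x1 , x2 , x3 , x4 ⟩ = solve 8 (λ a1 a2 a3 a4 x1 x2 x3 x4 →
      a1 :* x2 :+ a2 :* x1 :+ (a3 :* x4 :+ a4 :* x3) := x1 :* a2 :+ (x2 :* a1 :+ (x3 :* a4 :+ x4 :* a3))) refl a1 a2 a3 a4 x1 x2 x3 x4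

  qf-0 : qf 0v ≡ 0#
  qf-0 = trans (sym (+-identityˡ _)) (trans (cong (_+ qf 0v) (sym (trans (cong₂ _*_ (B-0ˡ 0v) (B-0ˡ 0v)) (zeroˡ 0#)))) (Q-0 0v))

  parabolic-0 : parabolic 0w ≡ 0#
  parabolic-0 = trans (cong₂ _+_ (zeroˡ 0#) qf-0) (+-identityʳ 0#)

  functional : (s : V → K) → (∀ x y → s (x ⊕ y) ≡ s x + s y) → (∀ k x → s (k · x) ≡ k * s x) → ∃[ a ] ∀ x → s x ≡ B a x
  functional s s-⊕ s-· = a , λ x → trans (cong s (sym (expand x))) (trans (s-⊕ _ _) (trans (cong₂ _+_ (s-· _ _) (trans (s-⊕ _ _)
      (cong₂ _+_ (s-· _ _) (trans (s-⊕ _ _) (cong₂ _+_ (s-· _ _) (s-· _ _)))))) (sym (B-coordinates a x))))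
    where
    a : V
    -- The form `B` pairs `unit₁` with `unit₂` and `unit₃` with `unit₄`, hence the exchanged
    -- entries.
    a = ⟨ s unit₂ , s unit₁ , s unit₄ , s unit₃ ⟩

  module _ (α β γ : K) where

    binary : K → K → K
    binary x y = α * (x * x) + β * (x * y) + γ * (y * y)

    ellipticᴷ : V → K
    ellipticᴷ x = z₁ x * z₂ x + binary (z₃ x) (z₄ x)

    elliptic-00 : ∀ {x y} → x * y ≡ 0# → x * y + binary 0# 0# ≡ 0#
    elliptic-00 {x} {y} e = trans (cong (_+ binary 0# 0#) e)
      (solve 3 (λ α β γ → :0 :+ (α :* (:0 :* :0) :+ β :* (:0 :* :0) :+ γ :* (:0 :* :0)) := :0) refl α β γ)

    opaque
      unfolding _⊕_

      elliptic-0 : ellipticᴷ 0v ≡ 0#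
      elliptic-0 = elliptic-00 (zeroˡ 0#)

    Irreducible Anisotropic : Set
    Irreducible = ∀ l0 l1 m₀ m₁ → α ≡ l0 * m₀ → β ≡ l0 * m₁ + l1 * m₀ → γ ≢ l1 * m₁
    Anisotropic = ∀ {x y} → binary x y ≡ 0# → x ≡ 0# × y ≡ 0#

    irreducible⇒anisotropic : Irreducible → Anisotropic
    irreducible⇒anisotropic irr {x} {y} e with y ≟ 0#
    -- With the root `r = x / y` the form factors as `(X + rY)(αX + (αr + β)Y)`.
    ... | no y≢0 = contradiction γ≡ (irr 1# r α (α * r + β) (sym (*-identityˡ α))
            (solve 3 (λ α β r → β := :1 :* (α :* r :+ β) :+ r :* α) refl α β r))
      where
      r = x * y ⁻¹
      ry≡x : r * y ≡ x
      ry≡x = trans (solve 3 (λ x y i → x :* i :* y := x :* (y :* i)) refl x y (y ⁻¹)) (trans (cong (x *_) (*-inverseʳ y≢0)) (*-identityʳ x))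
      γ≡ : γ ≡ r * (α * r + β)
      γ≡ = *-cancelˡ (y * y) (*-≢0 y≢0 y≢0) (by-adding (trans (cong₂ (λ u v → α * (u * v) + β * (u * y) + γ * (y * y)) ry≡x ry≡x) e)
        (solve 5 (λ α β γ y r → y :* y :* γ :+ (α :* (r :* y :* (r :* y)) :+ β :* (r :* y :* y) :+ γ :* (y :* y)) := y :* y :* (r :* (α :* r :+ β)) :+ :0) refl α β γ y r))
    ... | yes refl with x ≟ 0#
    ... | yes x≡0 = x≡0 , refl
    ... | no x≢0 = contradiction (sym (*-identityˡ γ)) (irr 0# 1# β γ (trans α≡0 (sym (zeroˡ β))) (trans (sym (+-identityˡ β)) (cong₂ _+_ (sym (zeroˡ γ)) (sym (*-identityˡ β)))))
      where
      α≡0 : α ≡ 0#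
      α≡0 = x*y≡0⇒y≡0 (*-≢0 x≢0 x≢0) (trans (solve 4 (λ x α β γ → x :* x :* α := α :* (x :* x) :+ β :* (x :* :0) :+ γ :* (:0 :* :0)) refl x α β γ) e)

    -- A product vanishes at the zero `(l1, l0)` of its first factor. Anisotropy then makes this
    -- factor zero, so that the form vanishes everywhere, in particular at `(1, 1)`.
    anisotropic⇒irreducible : Anisotropic → Irreducible
    anisotropic⇒irreducible aniso l0 l1 m₀ m₁ refl refl refl = 1≢0 (proj₁ (aniso {1#} {1#} zero₂))
      where
      zero₁ : binary l1 l0 ≡ 0#
      zero₁ = solve 4 (λ l0 l1 m0 m1 → l0 :* m0 :* (l1 :* l1) :+ (l0 :* m1 :+ l1 :* m0) :* (l1 :* l0) :+ l1 :* m1 :* (l0 :* l0) := :0) refl l0 l1 m₀ m₁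
      zero₂ : ∀ {x y} → binary x y ≡ 0#
      zero₂ {x} {y} = trans (cong₂ (λ l0 l1 → l0 * m₀ * (x * x) + (l0 * m₁ + l1 * m₀) * (x * y) + l1 * m₁ * (y * y)) (proj₂ (aniso zero₁)) (proj₁ (aniso zero₁)))
        (solve 4 (λ x y m0 m1 → :0 :* m0 :* (x :* x) :+ (:0 :* m1 :+ :0 :* m0) :* (x :* y) :+ :0 :* m1 :* (y :* y) := :0) refl x y m₀ m₁)

    module EllipticSolid (aniso : Anisotropic) (M : Solid)
      (singular⇒ : ∀ {x} → parabolic (Solid.map M x) ≡ 0# → ellipticᴷ x ≡ 0#)
      (⇒singular : ∀ {x} → ellipticᴷ x ≡ 0# → parabolic (Solid.map M x) ≡ 0#) where

      open Solid M

      private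
        -- The polar form of `ellipticᴷ`.
        b : V → V → K
        b x y = z₁ x * z₂ y + z₂ x * z₁ y + β * (z₃ x * z₄ y + z₄ x * z₃ y)

        opaque
          unfolding _⊕_

          elliptic-line : ∀ x k v → ellipticᴷ (x ⊕ k · v) ≡ ellipticᴷ x + k * k * ellipticᴷ v + k * b x v
          elliptic-line ⟨ x1 , x2 , x3 , x4 ⟩ k ⟨ y1 , y2 , y3 , y4 ⟩ = solve 12 (λ α β γ k x1 x2 x3 x4 y1 y2 y3 y4 →
            let φ = λ z1 z2 z3 z4 → z1 :* z2 :+ (α :* (z3 :* z3) :+ β :* (z3 :* z4) :+ γ :* (z4 :* z4)) in
            φ (x1 :+ k :* y1) (x2 :+ k :* y2) (x3 :+ k :* y3) (x4 :+ k :* y4)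
              := φ x1 x2 x3 x4 :+ k :* k :* φ y1 y2 y3 y4 :+ k :* (x1 :* y2 :+ x2 :* y1 :+ β :* (x3 :* y4 :+ x4 :* y3)))
            refl α β γ k x1 x2 x3 x4 y1 y2 y3 y4

        -- For `β ≡ 0#` the binary form is the square of `√α X + √γ Y`, which vanishes at
        -- `(√γ, √α)`. Anisotropy gives `√α ≡ 0#`, and then `(1, 0)` is a zero too.
        β≢0 : β ≢ 0#
        β≢0 β≡0 = 1≢0 (proj₁ (aniso {1#} {0#} (trans (cong (λ a → a * (1# * 1#) + β * (1# * 0#) + γ * (0# * 0#)) α≡0)
            (solve 2 (λ β γ → :0 :* (:1 :* :1) :+ β :* (:1 :* :0) :+ γ :* (:0 :* :0) := :0) refl β γ))))
          where
          √α = proj₁ (sqrt α)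
          √γ = proj₁ (sqrt γ)
          root : binary √γ √α ≡ 0#
          root = trans (cong₂ (λ u v → α * u + β * (√γ * √α) + γ * v) (proj₂ (sqrt γ)) (proj₂ (sqrt α)))
            (trans (cong (λ β → α * γ + β * (√γ * √α) + γ * α) β≡0)
              (solve 4 (λ α γ x y → α :* γ :+ :0 :* (y :* x) :+ γ :* α := :0) refl α γ √α √γ))
          α≡0 : α ≡ 0#
          α≡0 = trans (sym (proj₂ (sqrt α))) (trans (cong (_* √α) (proj₂ (aniso root))) (zeroˡ _))

        opaque
          unfolding _⊕_

          -- The polar form is nondegenerate because `β ≢ 0#`, and the singular vectors `unit₁`,
          -- `unit₂`, `(γ, 1, 0, 1)` and `(α, 1, 1, 0)` form a basis; one of them is therefore not
          -- orthogonal to `v`.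
          nonorthogonal : ∀ {v} → v ≢ 0v → ∃[ x ] ellipticᴷ x ≡ 0# × b x v ≢ 0#
          nonorthogonal {⟨ v1 , v2 , v3 , v4 ⟩} v≢0 with v1 ≟ 0# | v2 ≟ 0# | v3 ≟ 0# | v4 ≟ 0#
          ... | no p | _ | _ | _ = unit₂ , elliptic-00 (zeroˡ 1#) ,
                λ e → p (trans (solve 5 (λ v1 v2 v3 v4 β → v1 := :0 :* v2 :+ :1 :* v1 :+ β :* (:0 :* v4 :+ :0 :* v3)) refl v1 v2 v3 v4 β) e)
          ... | yes _ | no p | _ | _ = unit₁ , elliptic-00 (zeroʳ 1#) ,
                λ e → p (trans (solve 5 (λ v1 v2 v3 v4 β → v2 := :1 :* v2 :+ :0 :* v1 :+ β :* (:0 :* v4 :+ :0 :* v3)) refl v1 v2 v3 v4 β) e)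
          ... | yes refl | yes refl | no p | _ = ⟨ γ , 1# , 0# , 1# ⟩ , solve 3 (λ α β γ → γ :* :1 :+ (α :* (:0 :* :0) :+ β :* (:0 :* :1) :+ γ :* (:1 :* :1)) := :0) refl α β γ ,
                λ e → *-≢0 β≢0 p (trans (solve 4 (λ v3 v4 β γ → β :* v3 := γ :* :0 :+ :1 :* :0 :+ β :* (:0 :* v4 :+ :1 :* v3)) refl v3 v4 β γ) e)
          ... | yes refl | yes refl | yes refl | no p = ⟨ α , 1# , 1# , 0# ⟩ , solve 3 (λ α β γ → α :* :1 :+ (α :* (:1 :* :1) :+ β :* (:1 :* :0) :+ γ :* (:0 :* :0)) := :0) refl α β γ ,
                λ e → *-≢0 β≢0 p (trans (solve 3 (λ v4 β α → β :* v4 := α :* :0 :+ :1 :* :0 :+ β :* (:1 :* v4 :+ :0 :* :0)) refl v4 β α) e)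
          ... | yes refl | yes refl | yes refl | yes refl = contradiction refl v≢0

      -- A line through the nucleus (1, 0) meets the quadric in one point only, but if v were mapped to
      -- the nucleus, some line through v would contain two zeros of the elliptic form.
      nucleus-∉ : ∀ {v} → proj₂ (map v) ≡ 0v → v ≡ 0v
      nucleus-∉ {v} πv≡0 with v ≟v 0v
      ... | yes v≡0 = v≡0
      ... | no v≢0 = contradiction (x*x≡0⇒x≡0 kt²≡0) (*-≢0 k≢0 t≢0)
        where
        t = proj₁ (map v)
        t≢0 : t ≢ 0#
        t≢0 t≡0 = v≢0 (injective (trans (cong₂ _,_ t≡0 πv≡0) (sym map-0)))
        φv≢0 : ellipticᴷ v ≢ 0#
        φv≢0 φv≡0 = t≢0 (x*x≡0⇒x≡0 (trans (sym (trans (cong (t * t +_) (trans (cong qf πv≡0) qf-0)) (+-identityʳ _))) (⇒singular φv≡0)))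
        x   = proj₁ (nonorthogonal v≢0)
        φx  = proj₁ (proj₂ (nonorthogonal v≢0))
        bxv = proj₂ (proj₂ (nonorthogonal v≢0))
        -- The value at `x ⊕ k · v` is `k² φ(v) + k b(x, v)`, where `φ` is the elliptic form; this
        -- `k` is its nonzero root.
        k = b x v * ellipticᴷ v ⁻¹
        k≢0 : k ≢ 0#
        k≢0 = *-≢0 bxv (⁻¹-≢0 φv≢0)
        φline : ellipticᴷ (x ⊕ k · v) ≡ 0#
        φline = trans (elliptic-line x k v) (trans (cong (λ u → u + k * k * ellipticᴷ v + k * b x v) φx)
          (by-adding (cong (λ u → b x v * b x v * ellipticᴷ v ⁻¹ * u) (*-inverseʳ φv≢0))
          (solve 3 (λ b φ i → :0 :+ b :* i :* (b :* i) :* φ :+ b :* i :* b :+ b :* b :* i :* (φ :* i) := :0 :+ b :* b :* i :* :1) refl (b x v) (ellipticᴷ v) (ellipticᴷ v ⁻¹))))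
        s = proj₁ (map x)
        z = proj₂ (map x)
        map-line : map (x ⊕ k · v) ≡ (s + k * t , z)
        map-line = trans (map-⊕ x (k · v)) (trans (cong (map x ⊕w_) (map-· k v)) (cong (s + k * t ,_)
          (trans (cong (λ y → z ⊕ k · y) πv≡0) (trans (cong (z ⊕_) (c·0≡0 k)) (⊕-identityʳ z)))))
        kt²≡0 : (k * t) * (k * t) ≡ 0#
        kt²≡0 = by-adding (trans (trans (sym (cong parabolic map-line)) (⇒singular φline)) (sym (⇒singular φx)))
          (solve 3 (λ s u w → u :* u :+ ((s :+ u) :* (s :+ u) :+ w) := :0 :+ (s :* s :+ w)) refl s (k * t) (qf z))

      π : V → V
      π x = proj₂ (map x)

      π-⊕ : ∀ x y → π (x ⊕ y) ≡ π x ⊕ π y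
      π-⊕ x y = cong proj₂ (map-⊕ x y)

      π-· : ∀ k x → π (k · x) ≡ k · π x
      π-· k x = cong proj₂ (map-· k x)

      π-injective : Injective _≡_ _≡_ π
      π-injective {x} {y} e = x⊕y≡0⇒x≡y (nucleus-∉ (trans (π-⊕ x y) (trans (cong (_⊕ π y) e) (⊕-self (π y)))))

      private
        opaque
          section : V → V
          section z = proj₁ (finite-injective⇒surjective V-finite π-injective z)

          π-section : ∀ z → π (section z) ≡ z
          π-section z = proj₂ (finite-injective⇒surjective V-finite π-injective z)

        section-⊕ : ∀ x y → section (x ⊕ y) ≡ section x ⊕ section y
        section-⊕ x y = π-injective (trans (π-section (x ⊕ y)) (sym (trans (π-⊕ _ _) (cong₂ _⊕_ (π-section x) (π-section y)))))

        section-· : ∀ k x → section (k · x) ≡ k · section x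
        section-· k x = π-injective (trans (π-section (k · x)) (sym (trans (π-· _ _) (cong (k ·_) (π-section x)))))

        height : ∃[ a ] ∀ z → proj₁ (map (section z)) ≡ B a z
        height = functional (λ z → proj₁ (map (section z)))
          (λ x y → cong proj₁ (trans (cong map (section-⊕ x y)) (map-⊕ _ _)))
          (λ k x → cong proj₁ (trans (cong map (section-· k x)) (map-· _ _)))

      pole : V
      pole = proj₁ height

      map-section : ∀ z → map (section z) ≡ (B pole z , z)
      map-section z = cong₂ _,_ (proj₂ height z) (π-section z)

      map≡ : ∀ x → map x ≡ (B pole (π x) , π x)
      map≡ x = trans (cong map (sym (π-injective (π-section (π x))))) (map-section (π x))

      on-graph : ∀ z → ∃[ x ] map x ≡ (B pole z , z)
      on-graph z = section z , map-section z

      private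
        Q⇒φ : ∀ {x} → Q pole (π x) ≡ 0# → ellipticᴷ x ≡ 0#
        Q⇒φ {x} e = singular⇒ (trans (cong parabolic (map≡ x)) e)

        φ⇒Q : ∀ {x} → ellipticᴷ x ≡ 0# → Q pole (π x) ≡ 0#
        φ⇒Q {x} e = trans (sym (cong parabolic (map≡ x))) (⇒singular e)

        opaque
          unfolding _⊕_

          -- The first coordinate of `y′` is `0`, so `ellipticᴷ y′ ≡ 0#` and anisotropy leave at
          -- most the second coordinate `t`. The value at `x ⊕ y′` is then `z₁ x * t`, whence `t`
          -- vanishes. Only zeros of the form are used.
          reduce₁ : ∀ x y → let y′ = z₁ x · y ⊕ z₁ y · x in z₁ x ≢ 0# → ellipticᴷ x ≡ 0# → ellipticᴷ y′ ≡ 0# → ellipticᴷ (x ⊕ y′) ≡ 0# → y′ ≡ 0v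
          reduce₁ ⟨ x1 , x2 , x3 , x4 ⟩ ⟨ y1 , y2 , y3 , y4 ⟩ x₁≢0 φx φy′ φx+y′ = finish (aniso (trans (sym (trans (cong (_+ binary u w) (trans (cong (_* t) o≡0) (zeroˡ t))) (+-identityˡ _))) φy′))
            where
            o t u w : K
            o = x1 * y1 + y1 * x1
            t = x1 * y2 + y1 * x2
            u = x1 * y3 + y1 * x3
            w = x1 * y4 + y1 * x4
            o≡0 : o ≡ 0#
            o≡0 = x≡y⇒x+y≡0 (*-comm x1 y1)
            finish : u ≡ 0# × w ≡ 0# → ⟨ o , t , u , w ⟩ ≡ 0v
            finish (u≡0 , w≡0) = cong₄ o≡0 (x*y≡0⇒y≡0 x₁≢0 (by-adding (trans (sym (cong₂ _+_ (cong₂ (λ o t → (x1 + o) * (x2 + t)) o≡0 refl)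
                (cong₂ (λ u w → binary (x3 + u) (x4 + w)) u≡0 w≡0))) (trans φx+y′ (sym φx)))
              (solve 8 (λ α β γ x1 x2 x3 x4 t → let φ = λ z1 z2 z3 z4 → z1 :* z2 :+ (α :* (z3 :* z3) :+ β :* (z3 :* z4) :+ γ :* (z4 :* z4)) in
                x1 :* t :+ φ (x1 :+ :0) (x2 :+ t) (x3 :+ :0) (x4 :+ :0) := :0 :+ φ x1 x2 x3 x4) refl α β γ x1 x2 x3 x4 t))) u≡0 w≡0

          swap : V → V
          swap x = ⟨ z₂ x , z₁ x , z₃ x , z₄ x ⟩

          elliptic-swap : ∀ x → ellipticᴷ x ≡ 0# → ellipticᴷ (swap x) ≡ 0#
          elliptic-swap x φx = trans (cong (_+ binary (z₃ x) (z₄ x)) (*-comm (z₂ x) (z₁ x))) φx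

          reduce₂ : ∀ x y → let y′ = z₂ x · y ⊕ z₂ y · x in z₂ x ≢ 0# → ellipticᴷ x ≡ 0# → ellipticᴷ y′ ≡ 0# → ellipticᴷ (x ⊕ y′) ≡ 0# → y′ ≡ 0v
          reduce₂ x y x2≢0 φx φy′ φx+y′ = cong swap (reduce₁ (swap x) (swap y) x2≢0 (elliptic-swap _ φx) (elliptic-swap _ φy′) (elliptic-swap _ φx+y′))

          elliptic-degenerate : ∀ x → z₁ x ≡ 0# → z₂ x ≡ 0# → ellipticᴷ x ≡ 0# → x ≡ 0v
          elliptic-degenerate ⟨ x1 , x2 , x3 , x4 ⟩ refl refl φx = finish (aniso (trans (sym (trans (cong (_+ binary x3 x4) (zeroˡ 0#)) (+-identityˡ _))) φx))
            where
            finish : x3 ≡ 0# × x4 ≡ 0# → ⟨ 0# , 0# , x3 , x4 ⟩ ≡ 0v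
            finish (refl , refl) = refl

      private
        module _ {x y} (Qx : Q pole (π x) ≡ 0#) (Qy : Q pole (π y) ≡ 0#) (Bxy : B (π x) (π y) ≡ 0#) where

          φ-combine : ∀ c d → ellipticᴷ (c · x ⊕ d · y) ≡ 0#
          φ-combine c d = Q⇒φ (trans (cong (Q pole) (trans (π-⊕ _ _) (cong₂ _⊕_ (π-· c x) (π-· d y))))
            (trans (Q-combine pole c d (π x) (π y)) (trans (cong₂ _+_ (cong₂ (λ u v → c * c * u + d * d * v) Qx Qy) (cong (c * d *_) Bxy))
              (solve 2 (λ c d → c :* c :* :0 :+ d :* d :* :0 :+ c :* d :* :0 := :0) refl c d))))

          private
            regroup : ∀ c d → x ⊕ (c · y ⊕ d · x) ≡ (1# + d) · x ⊕ c · y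
            regroup c d = trans (cong₂ _⊕_ (sym (1·x≡x x)) (⊕-comm (c · y) (d · x))) (trans (sym (⊕-assoc _ _ _)) (cong (_⊕ c · y) (·-distrib-+ 1# d x)))

            φ-y′ : ∀ c d → ellipticᴷ (c · y ⊕ d · x) ≡ 0#
            φ-y′ c d = trans (cong ellipticᴷ (⊕-comm (c · y) (d · x))) (φ-combine d c)

            φ-x+y′ : ∀ c d → ellipticᴷ (x ⊕ (c · y ⊕ d · x)) ≡ 0#
            φ-x+y′ c d = trans (cong ellipticᴷ (regroup c d)) (φ-combine (1# + d) c)

          -- All combinations of `x` and `y` are zeros of the elliptic form. A nonzero zero has its
          -- first or second coordinate nonzero, and the matching reduction gives a linear relation.
          proportional : x ≢ 0v → ∃[ k ] y ≡ k · x
          proportional x≢0 with z₁ x ≟ 0# | z₂ x ≟ 0#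
          ... | no p  | _     = _ , dependent p (reduce₁ x y p (Q⇒φ Qx) (φ-y′ _ _) (φ-x+y′ _ _))
          ... | yes _ | no p  = _ , dependent p (reduce₂ x y p (Q⇒φ Qx) (φ-y′ _ _) (φ-x+y′ _ _))
          ... | yes p | yes r = contradiction (elliptic-degenerate x p r (Q⇒φ Qx)) x≢0

      pole-noLines : NoLines pole
      pole-noLines {u} {w} u≢0 Qu Qw Buw = proj₁ y≡kx , trans (sym (π-section w)) (trans (cong π (proj₂ y≡kx)) (trans (π-· _ _) (cong (proj₁ y≡kx ·_) (π-section u))))
        where
        y≡kx : ∃[ k ] section w ≡ k · section u
        y≡kx = proportional (trans (cong (Q pole) (π-section u)) Qu) (trans (cong (Q pole) (π-section w)) Qw)
          (trans (cong₂ B (π-section u) (π-section w)) Buw) (λ e → u≢0 (trans (sym (π-section u)) (trans (cong π e) (cong proj₂ map-0))))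

      pole-frame : Frame pole
      pole-frame = proj₁ (completeFrame₀ pole-noLines (proj₂ (completePair pole-noLines π1≢0 (φ⇒Q φ1))))
        where
        φ1 : ellipticᴷ unit₁ ≡ 0#
        φ1 = elliptic-00 (zeroʳ 1#)
        π1≢0 : π unit₁ ≢ 0v
        π1≢0 e = unit₁≢0 (nucleus-∉ e)

-- Points of hyperplane sections and their intersections

module Sections {q : ℕ} (𝔽 : FiniteField₂ q) where

  open FieldTheory 𝔽
  open Forms 𝔽
  open Solids 𝔽
  open Tangency 𝔽

  -- the points of the hyperplane section with pole a
  On : V → W → Set
  On a (t , z) = t ≡ B a z × Q a z ≡ 0#

  lift : V → V → W
  lift a z = B a z , z

  lift-on : ∀ {a z} → Q a z ≡ 0# → On a (lift a z)
  lift-on Qz = refl , Qz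

  lift-≢0 : ∀ {a z} → z ≢ 0v → lift a z ≢ 0w
  lift-≢0 z≢0 e = z≢0 (cong proj₂ e)

  on-≢0 : ∀ {a w} → w ≢ 0w → On a w → proj₂ w ≢ 0v
  on-≢0 {a} w≢0 (t≡ , _) z≡0 = w≢0 (cong₂ _,_ (trans t≡ (trans (cong (B a) z≡0) (B-0ʳ a))) z≡0)

  on-both : ∀ {a b w} → On a w → On b w → B (a ⊕ b) (proj₂ w) ≡ 0#
  on-both {a} {b} (t≡ , _) (t≡′ , _) = trans (B-⊕ˡ a b _) (x≡y⇒x+y≡0 (trans (sym t≡) t≡′))

  both-on : ∀ {a b z} → Q a z ≡ 0# → B (a ⊕ b) z ≡ 0# → On b (lift a z)
  both-on {a} {b} {z} Qz Bz = Ba≡Bb , trans (cong (λ u → u * u + qf z) (sym Ba≡Bb)) Qz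
    where
    Ba≡Bb : B a z ≡ B b z
    Ba≡Bb = x+y≡0⇒x≡y (trans (sym (B-⊕ˡ a b z)) Bz)

  -- The vectors `e`, `f`, `e + f + g` and `εe + f + h` are singular and form a basis, and `a ⊕ b`
  -- is orthogonal to each of them.
  pole-unique : ∀ {a b} → Frame a → (∀ {w} → w ≢ 0w → On a w → On b w) → a ≡ b
  pole-unique {a} {b} F on = x⊕y≡0⇒x≡y (trans (at-coordinates F x) (trans (cong₂ _⊕_ (cong₂ _⊕_ (vanish x⊥f) (vanish x⊥e)) (cong₂ _⊕_ (vanish x⊥h) (vanish x⊥g)))
      (trans (cong (_⊕ (0v ⊕ 0v)) (⊕-self 0v)) (trans (⊕-identityˡ _) (⊕-self 0v)))))
    where
    open Frame F hiding (at)
    x = a ⊕ b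
    vanish : ∀ {k z} → k ≡ 0# → k · z ≡ 0v
    vanish {z = z} refl = 0·x≡0 z
    orthogonal : ∀ {z} → z ≢ 0v → Q a z ≡ 0# → B x z ≡ 0#
    orthogonal z≢0 Qz = on-both (lift-on Qz) (on (lift-≢0 z≢0) (lift-on Qz))
    x⊥e : B x e ≡ 0#
    x⊥e = orthogonal (B≡1⇒≢0 Bef) Qe
    x⊥f : B x f ≡ 0#
    x⊥f = orthogonal (B≡1⇒≢0 (trans (B-comm f e) Bef)) Qf
    spread : ∀ {s α β} → s + (α * α + α * β + ε * (β * β)) ≡ 0# → B x (at F s 1# α β) ≡ 0#
    spread {s} {α} {β} N≡ = orthogonal (B≡1⇒≢0 (B-at-e F s 1# α β)) (trans (Q-at F s 1# α β) (trans (cong (_+ (α * α + α * β + ε * (β * β))) (*-identityʳ s)) N≡))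
    B-x-at : ∀ s α β → B x (at F s 1# α β) ≡ α * B x g + β * B x h
    B-x-at s α β = trans (B-⊕ʳ x _ _) (trans (cong₂ _+_ (trans (B-⊕ʳ x _ _) (cong₂ _+_ (trans (B-·ʳ s x e) (cong (s *_) x⊥e)) (trans (B-·ʳ 1# x f) (cong (1# *_) x⊥f))))
        (trans (B-⊕ʳ x _ _) (cong₂ _+_ (B-·ʳ α x g) (B-·ʳ β x h))))
      (solve 5 (λ s α β u v → s :* :0 :+ :1 :* :0 :+ (α :* u :+ β :* v) := α :* u :+ β :* v) refl s α β (B x g) (B x h)))
    x⊥g : B x g ≡ 0#
    x⊥g = trans (solve 2 (λ u v → u := :1 :* u :+ :0 :* v) refl (B x g) (B x h)) (trans (sym (B-x-at 1# 1# 0#))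
      (spread (solve 1 (λ ε → :1 :+ (:1 :* :1 :+ :1 :* :0 :+ ε :* (:0 :* :0)) := :0) refl ε)))
    x⊥h : B x h ≡ 0#
    x⊥h = trans (solve 2 (λ u v → v := :0 :* u :+ :1 :* v) refl (B x g) (B x h)) (trans (sym (B-x-at ε 0# 1#))
      (spread (solve 1 (λ ε → ε :+ (:0 :* :0 :+ :0 :* :1 :+ ε :* (:1 :* :1)) := :0) refl ε)))

  tangent-meet : ∀ {a b w} → NoLines a → a ~ b → w ≢ 0w → On a w → On b w → ∃[ k ] k ≢ 0# × w ≡ k ·w lift a (a ⊕ b)
  tangent-meet {a} {b} {t , z} ell a~b w≢0 (t≡ , Qz) onb = k , k≢0 , cong₂ _,_ (trans t≡ (trans (cong (B a) z≡kx) (B-·ʳ k a x))) z≡kx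
    where
    x = a ⊕ b
    k = proj₁ (ell (~⇒≢0 a~b) (proj₂ a~b) Qz (on-both (t≡ , Qz) onb))
    z≡kx : z ≡ k · x
    z≡kx = proj₂ (ell (~⇒≢0 a~b) (proj₂ a~b) Qz (on-both (t≡ , Qz) onb))
    k≢0 : k ≢ 0#
    k≢0 k≡0 = on-≢0 {a} w≢0 (t≡ , Qz) (trans z≡kx (trans (cong (_· x) k≡0) (0·x≡0 x)))

  on-scale : ∀ {a k w} → On a w → On a (k ·w w)
  on-scale {a} {k} {t , z} (t≡ , Qz) = trans (cong (k *_) t≡) (sym (B-·ʳ k a z)) , trans (Q-· a k z) (trans (cong (k * k *_) Qz) (zeroʳ (k * k)))

  tangent-on : ∀ {a b} → a ~ b → On a (lift a (a ⊕ b)) × On b (lift a (a ⊕ b))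
  tangent-on {a} {b} (_ , Qab) = lift-on Qab , both-on Qab (B-self (a ⊕ b))

  -- If x = a ⊕ b is not singular, then every vector orthogonal to x becomes singular after
  -- adding a multiple of x; starting from a vector h not orthogonal to a common point, this gives another one.
  meet-tangent : ∀ {a b w} → a ≢ b → w ≢ 0w → On a w → On b w →
    (∀ {w′} → w′ ≢ 0w → On a w′ → On b w′ → ∃[ k ] w′ ≡ k ·w w) → a ~ b
  meet-tangent {a} {b} {t , z₀} a≢b w≢0 (t≡ , Qz₀) onb only = a≢b , decidable-stable (Q a x ≟ 0#) λ Qx≢0 → impossible Qx≢0 (transversal Qx≢0)
    where
    x = a ⊕ b
    z₀≢0 : z₀ ≢ 0v
    z₀≢0 = on-≢0 {a} w≢0 (t≡ , Qz₀)
    Bxz₀ : B x z₀ ≡ 0#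
    Bxz₀ = on-both (t≡ , Qz₀) onb
    module _ (Qx≢0 : Q a x ≢ 0#) where
      independent : ∀ k → x ⊕ k · z₀ ≢ 0v
      independent k e = Qx≢0 (trans (cong (Q a) (x⊕y≡0⇒x≡y e)) (Q-·-singular k Qz₀))
      transversal : ∃[ h ] B z₀ h ≡ 1# × B x h ≡ 0#
      transversal = combination (nondegenerate z₀≢0)
        where
        combination : ∃[ y ] B z₀ y ≡ 1# → ∃[ h ] B z₀ h ≡ 1# × B x h ≡ 0#
        combination (y1 , Bz₀y₁) = h , Bz₀h , Bxh
          where
          c = B x y1
          y2 = proj₁ (nondegenerate (independent c))
          d = B z₀ y2
          Bxy₂ : B x y2 ≡ 1# + c * d
          Bxy₂ = by-adding (proj₂ (nondegenerate (independent c))) (trans (cong (B x y2 +_) (trans (B-⊕ˡ x (c · z₀) y2) (cong (B x y2 +_) (B-·ˡ c z₀ y2))))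
            (solve 3 (λ u c d → u :+ (u :+ c :* d) := :1 :+ c :* d :+ :1) refl (B x y2) c d))
          -- The products of `z₀` and `x` with `y1` and `y2` form a matrix with rows `(1, d)` and
          -- `(c, 1 + cd)`, of determinant `1`. The coefficients come from Cramer's rule.
          h = (1# + c * d) · y1 ⊕ c · y2
          B-h : ∀ u → B u h ≡ (1# + c * d) * B u y1 + c * B u y2
          B-h u = trans (B-⊕ʳ u _ _) (cong₂ _+_ (B-·ʳ _ u y1) (B-·ʳ c u y2))
          Bz₀h : B z₀ h ≡ 1#
          Bz₀h = trans (B-h z₀) (trans (cong (λ u → (1# + c * d) * u + c * d) Bz₀y₁) (solve 2 (λ c d → (:1 :+ c :* d) :* :1 :+ c :* d := :1) refl c d))
          Bxh : B x h ≡ 0#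
          Bxh = trans (B-h x) (trans (cong (λ u → (1# + c * d) * c + c * u) Bxy₂) (solve 2 (λ c d → (:1 :+ c :* d) :* c :+ c :* (:1 :+ c :* d) := :0) refl c d))
      impossible : ¬ (∃[ h ] B z₀ h ≡ 1# × B x h ≡ 0#)
      impossible (h , Bz₀h , Bxh) = 1≢0 (trans (sym Bz₀y) (trans (cong (B z₀) y≡kz₀) (B-self-·ʳ k z₀)))
        where
        r = proj₁ (sqrt (Q a h * Q a x ⁻¹))
        y = h ⊕ r · x
        Qy : Q a y ≡ 0#
        Qy = trans (Q-⊕ a h (r · x)) (trans (cong₂ (λ u v → Q a h + u + v) (trans (Q-· a r x) (cong (_* Q a x) (proj₂ (sqrt (Q a h * Q a x ⁻¹)))))
            (trans (B-·ʳ r h x) (trans (cong (r *_) (trans (B-comm h x) Bxh)) (zeroʳ r))))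
          (by-adding (cong (Q a h *_) (*-inverseʳ Qx≢0))
            (solve 3 (λ u v i → u :+ u :* i :* v :+ :0 :+ u :* (v :* i) := :0 :+ u :* :1) refl (Q a h) (Q a x) (Q a x ⁻¹))))
        Bxy : B x y ≡ 0#
        Bxy = trans (B-⊕ʳ x h (r · x)) (trans (cong₂ _+_ Bxh (B-self-·ʳ r x)) (+-identityʳ 0#))
        Bz₀y : B z₀ y ≡ 1#
        Bz₀y = trans (B-⊕ʳ z₀ h (r · x)) (trans (cong₂ _+_ Bz₀h (trans (B-·ʳ r z₀ x) (trans (cong (r *_) (trans (B-comm z₀ x) Bxz₀)) (zeroʳ r)))) (+-identityʳ 1#))
        y≢0 : y ≢ 0v
        y≢0 = B≡1⇒≢0 (trans (B-comm y z₀) Bz₀y)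
        k = proj₁ (only (lift-≢0 {a} y≢0) (lift-on Qy) (both-on Qy Bxy))
        y≡kz₀ : y ≡ k · z₀
        y≡kz₀ = cong proj₂ (proj₂ (only (lift-≢0 {a} y≢0) (lift-on Qy) (both-on Qy Bxy)))

  module _ {a} (F : Frame a) where
    open Frame F hiding (at)

    private
      lin : V → V
      lin x = at F (z₁ x) (z₂ x) (z₃ x) (z₄ x)

      opaque
        unfolding _⊕_

        lin-⊕ : ∀ x y → lin (x ⊕ y) ≡ lin x ⊕ lin y
        lin-⊕ ⟨ x1 , x2 , x3 , x4 ⟩ ⟨ y1 , y2 , y3 , y4 ⟩ = cong₄ (law _ _ _ _) (law _ _ _ _) (law _ _ _ _) (law _ _ _ _)
          where
          law : ∀ e f g h → (x1 + y1) * e + (x2 + y2) * f + ((x3 + y3) * g + (x4 + y4) * h) ≡ x1 * e + x2 * f + (x3 * g + x4 * h) + (y1 * e + y2 * f + (y3 * g + y4 * h))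
          law = solve 12 (λ x1 x2 x3 x4 y1 y2 y3 y4 e f g h → (x1 :+ y1) :* e :+ (x2 :+ y2) :* f :+ ((x3 :+ y3) :* g :+ (x4 :+ y4) :* h)
            := x1 :* e :+ x2 :* f :+ (x3 :* g :+ x4 :* h) :+ (y1 :* e :+ y2 :* f :+ (y3 :* g :+ y4 :* h))) refl x1 x2 x3 x4 y1 y2 y3 y4

        lin-· : ∀ k x → lin (k · x) ≡ k · lin x
        lin-· k ⟨ x1 , x2 , x3 , x4 ⟩ = cong₄ (law _ _ _ _) (law _ _ _ _) (law _ _ _ _) (law _ _ _ _)
          where
          law : ∀ e f g h → k * x1 * e + k * x2 * f + (k * x3 * g + k * x4 * h) ≡ k * (x1 * e + x2 * f + (x3 * g + x4 * h))
          law = solve 9 (λ k x1 x2 x3 x4 e f g h → k :* x1 :* e :+ k :* x2 :* f :+ (k :* x3 :* g :+ k :* x4 :* h)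
            := k :* (x1 :* e :+ x2 :* f :+ (x3 :* g :+ x4 :* h))) refl k x1 x2 x3 x4

    frameSolid : Solid
    frameSolid = record
      { map       = λ x → lift a (lin x)
      ; map-⊕     = λ x y → trans (cong (lift a) (lin-⊕ x y)) (cong (_, lin x ⊕ lin y) (B-⊕ʳ a (lin x) (lin y)))
      ; map-·     = λ k x → trans (cong (lift a) (lin-· k x)) (cong (_, k · lin x) (B-·ʳ k a (lin x)))
      ; injective = λ e → let p , q , r , s = at-injective F (cong proj₂ e) in cong₄ p q r s
      }

    frameSolid-parabolic : ∀ x → parabolic (Solid.map frameSolid x) ≡ ellipticᴷ 1# 1# ε x
    frameSolid-parabolic x = trans (Q-at F (z₁ x) (z₂ x) (z₃ x) (z₄ x))
      (solve 5 (λ s t α β ε → s :* t :+ (α :* α :+ α :* β :+ ε :* (β :* β)) := s :* t :+ (:1 :* (α :* α) :+ :1 :* (α :* β) :+ ε :* (β :* β))) refl (z₁ x) (z₂ x) (z₃ x) (z₄ x) ε)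

    frame-irreducible : Irreducible 1# 1# ε
    frame-irreducible = anisotropic⇒irreducible 1# 1# ε λ {x} {y} e → anisotropic Qh∉℘ (trans
      (solve 3 (λ α β ε → α :* α :+ α :* β :+ ε :* (β :* β) := :1 :* (α :* α) :+ :1 :* (α :* β) :+ ε :* (β :* β)) refl x y ε) e)

    frame-on-solid : ∀ z → ∃[ x ] Solid.map frameSolid x ≡ lift a z
    frame-on-solid z = ⟨ B z f , B z e , B z h , B z g ⟩ , cong (lift a) (sym (at-coordinates F z))

  -- Here Q a z = z₁z₂ + z₃² + z₃z₄ + s²z₄².
  opaque
    unfolding _⊕_

    someFrame : ∃[ a ] Frame a
    someFrame = ⟨ 0# , 0# , s , 1# ⟩ , record
      { e    = unit₁
      ; f    = unit₂
      ; g    = unit₃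
      ; h    = unit₄
      ; pair = record
        { Qe  = solve 1 (λ s → (:0 :* :0 :+ :0 :* :1 :+ (s :* :0 :+ :1 :* :0)) :* (:0 :* :0 :+ :0 :* :1 :+ (s :* :0 :+ :1 :* :0)) :+ (:1 :* :0 :+ :0 :* :0) := :0) refl s
        ; Qf  = solve 1 (λ s → (:0 :* :1 :+ :0 :* :0 :+ (s :* :0 :+ :1 :* :0)) :* (:0 :* :1 :+ :0 :* :0 :+ (s :* :0 :+ :1 :* :0)) :+ (:0 :* :1 :+ :0 :* :0) := :0) refl s
        ; Bef = solve 1 (λ s → (:1 :* :1 :+ :0 :* :0 :+ (:0 :* :0 :+ :0 :* :0)) := :1) refl s
        }
      ; Qg   = solve 1 (λ s → (:0 :* :0 :+ :0 :* :0 :+ (s :* :0 :+ :1 :* :1)) :* (:0 :* :0 :+ :0 :* :0 :+ (s :* :0 :+ :1 :* :1)) :+ (:0 :* :0 :+ :1 :* :0) := :1) refl s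
      ; Qh∉℘ = λ x e → proj₂ ℘-not-surjective x (trans e (trans (solve 1 (λ s → (:0 :* :0 :+ :0 :* :0 :+ (s :* :1 :+ :1 :* :0)) :* (:0 :* :0 :+ :0 :* :0 :+ (s :* :1 :+ :1 :* :0)) :+ (:0 :* :0 :+ :0 :* :1) := s :* s) refl s) (proj₂ (sqrt (proj₁ ℘-not-surjective)))))
      ; Beg  = solve 1 (λ s → (:1 :* :0 :+ :0 :* :0 :+ (:0 :* :0 :+ :0 :* :1)) := :0) refl s
      ; Beh  = solve 1 (λ s → (:1 :* :0 :+ :0 :* :0 :+ (:0 :* :1 :+ :0 :* :0)) := :0) refl s
      ; Bfg  = solve 1 (λ s → (:0 :* :0 :+ :1 :* :0 :+ (:0 :* :0 :+ :0 :* :1)) := :0) refl s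
      ; Bfh  = solve 1 (λ s → (:0 :* :0 :+ :1 :* :0 :+ (:0 :* :1 :+ :0 :* :0)) := :0) refl s
      ; Bgh  = solve 1 (λ s → (:0 :* :0 :+ :0 :* :0 :+ (:1 :* :1 :+ :0 :* :0)) := :1) refl s
      }
      where
      s : K
      s = proj₁ (sqrt (proj₁ ℘-not-surjective))

-- Transport of the given field to `Fin q`

record Isomorphism {c ℓ₁ ℓ₂} (F : HeytingField c ℓ₁ ℓ₂) {q} (𝔽 : FiniteField₂ q) : Set (c ⊔ ℓ₁ ⊔ ℓ₂) where
  private
    module F = HeytingField F
    module 𝔽 = FiniteField₂ 𝔽
  open F using (_≈_; _#_)
  field
    to      : F.Carrier → 𝔽.K
    from    : 𝔽.K → F.Carrier
    to-cong : ∀ {x y} → x ≈ y → to x ≡ to y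
    to-from : ∀ k → to (from k) ≡ k
    from-to : ∀ x → from (to x) ≈ x
    from-+  : ∀ k l → from (k 𝔽.+ l) ≈ from k F.+ from l
    from-*  : ∀ k l → from (k 𝔽.* l) ≈ from k F.* from l
    from-0  : from 𝔽.0# ≈ F.0#
    ≢0⇒#0   : ∀ {k} → k ≢ 𝔽.0# → from k # F.0#

  from-injective : ∀ {k l} → from k ≈ from l → k ≡ l
  from-injective {k} {l} e = trans (sym (to-from k)) (trans (to-cong e) (to-from l))

  to-injective : ∀ {x y} → to x ≡ to y → x ≈ y
  to-injective {x} {y} e = F.trans (F.sym (from-to x)) (F.trans (F.reflexive (cong from e)) (from-to y))

module FiniteHeytingField {c ℓ₁ ℓ₂} (F : HeytingField c ℓ₁ ℓ₂) (n : ℕ)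
  (card : HasCardinality (HeytingField.setoid F) (2 ^ n)) where

  private
    module F = HeytingField F
    q = 2 ^ n
  open F using (_≈_; _#_; heytingCommutativeRing)

  open Inverse card using (to; from; to-cong)

  to-from : ∀ k → to (from k) ≡ k
  to-from k = Inverse.strictlyInverseˡ card k

  from-to : ∀ x → from (to x) ≈ x
  from-to x = Inverse.strictlyInverseʳ card x

  from-injective : ∀ {k l} → from k ≈ from l → k ≡ l
  from-injective {k} {l} e = trans (sym (to-from k)) (trans (to-cong e) (to-from l))

  to-injective : ∀ {x y} → to x ≡ to y → x ≈ y
  to-injective {x} {y} e = F.trans (F.sym (from-to x)) (F.trans (F.reflexive (cong from e)) (from-to y))

  private
    raw : RawRing _ _
    raw = record
      { Carrier = Fin q
      ; _≈_     = _≡_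
      ; _+_     = λ k l → to (from k F.+ from l)
      ; _*_     = λ k l → to (from k F.* from l)
      ; -_      = λ k → to (F.- from k)
      ; 0#      = to F.0#
      ; 1#      = to F.1#
      }

    from-monomorphism : IsRingMonomorphism raw (CommutativeRing.rawRing (HeytingCommutativeRing.commutativeRing heytingCommutativeRing)) from
    from-monomorphism = record
      { isRingHomomorphism = record
        { isSemiringHomomorphism = record
          { isNearSemiringHomomorphism = record
            { +-isMonoidHomomorphism = record
              { isMagmaHomomorphism = record
                { isRelHomomorphism = record { cong = F.reflexive ∘ cong from }
                ; homo = λ _ _ → from-to _ }
              ; ε-homo = from-to _ }
            ; *-homo = λ _ _ → from-to _ }
          ; 1#-homo = from-to _ }
        ; -‿homo = λ _ → from-to _ }
      ; injective = from-injective
      }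

    commutativeRing : CommutativeRing _ _
    commutativeRing = record { isCommutativeRing = RingMonomorphism.isCommutativeRing from-monomorphism F.isCommutativeRing }

    module R = CommutativeRing commutativeRing
    open R using (_+_; _*_; 0#; 1#)

    1≢0 : 1# ≢ 0#
    1≢0 e = F.#-irrefl (to-injective e) (HeytingProperties.1#0 heytingCommutativeRing)

    -- Tightness turns `x ≢ 0#` only into a double negation of apartness from zero. As equality of
    -- `y` with `0#` is decidable, this suffices to cancel `x`.
    cancel : ∀ {x y} → x ≢ 0# → x * y ≡ 0# → y ≡ 0#
    cancel {x} {y} x≢0 xy≡0 = decidable-stable (y Fin.≟ 0#) λ y≢0 →
      x≢0 (from-injective (F.trans (F.tight _ _ .proj₁ (λ x#0 → y≢0 (invertible (F.#⇒invertible x#0)))) (F.sym (from-to F.0#))))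
      where
      open SetoidReasoning F.setoid
      invertible : ∃[ i ] (i F.* (from x F.- F.0#) ≈ F.1#) × ((from x F.- F.0#) F.* i ≈ F.1#) → y ≡ 0#
      invertible (i , ix≈1 , _) = from-injective (begin
        from y                             ≈⟨ F.*-identityˡ (from y) ⟨
        F.1# F.* from y                    ≈⟨ F.*-congʳ ix≈1 ⟨
        i F.* (from x F.- F.0#) F.* from y ≈⟨ F.*-congʳ (F.*-congˡ (HeytingProperties.x-0≈x heytingCommutativeRing (from x))) ⟩
        i F.* from x F.* from y            ≈⟨ F.*-assoc i (from x) (from y) ⟩
        i F.* (from x F.* from y)          ≈⟨ F.*-congˡ (F.trans (F.sym (from-to _)) (F.trans (F.reflexive (cong from xy≡0)) (from-to F.0#))) ⟩
        i F.* F.0#                         ≈⟨ F.zeroʳ i ⟩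
        F.0#                               ≈⟨ from-to F.0# ⟨
        from 0#                            ∎)

    open FiniteSum R.+-commutativeMonoid using (sum; sum-permute; ∑-distrib-+; sum-replicate)
    open Mult R.+-monoid using (×-assocˡ) renaming (_×_ to _⋆_)
    open GroupProperties R.+-group using (identityʳ-unique)

    -- Summing x + 1 and x over the whole field gives q · 1 = 0.
    q⋆1≡0 : q ⋆ 1# ≡ 0#
    q⋆1≡0 = identityʳ-unique (sum id) (q ⋆ 1#) (begin
      sum id + q ⋆ 1#                    ≡⟨ cong (sum id +_) (sum-replicate q) ⟨
      sum id + sum (replicate q 1#)      ≡⟨ ∑-distrib-+ id (replicate q 1#) ⟨
      sum (λ (i : Fin q) → i + 1#)       ≡⟨ sum-permute id translation ⟨
      sum id                             ∎)
      where
      open ≡-Reasoning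
      translation : Permutation′ q
      translation = permutation (_+ 1#) (_+ (R.- 1#))
        (λ x → trans (R.+-assoc x _ _) (trans (cong (x +_) (R.-‿inverseˡ 1#)) (R.+-identityʳ x)))
        (λ x → trans (R.+-assoc x _ _) (trans (cong (x +_) (R.-‿inverseʳ 1#)) (R.+-identityʳ x)))

    -- If `2` were nonzero, it could be cancelled one factor at a time; starting from `q⋆1≡0` this
    -- ends in `1# ≡ 0#`.
    2^n⋆x≡0 : 1# + 1# ≢ 0# → ∀ m x → (2 ^ m) ⋆ x ≡ 0# → x ≡ 0#
    2^n⋆x≡0 2≢0 zero x e = trans (sym (R.+-identityʳ x)) e
    2^n⋆x≡0 2≢0 (suc m) x e = 2^n⋆x≡0 2≢0 m x (cancel 2≢0 (begin
      (1# + 1#) * y            ≡⟨ R.distribʳ y 1# 1# ⟩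
      1# * y + 1# * y          ≡⟨ cong₂ _+_ (R.*-identityˡ y) (trans (R.*-identityˡ y) (sym (R.+-identityʳ y))) ⟩
      2 ⋆ y                    ≡⟨ ×-assocˡ x 2 (2 ^ m) ⟩
      (2 ℕ.* 2 ^ m) ⋆ x        ≡⟨ e ⟩
      0#                       ∎))
      where
      open ≡-Reasoning
      y = (2 ^ m) ⋆ x

    1+1≡0 : 1# + 1# ≡ 0#
    1+1≡0 = decidable-stable (1# + 1# Fin.≟ 0#) λ 2≢0 → 1≢0 (2^n⋆x≡0 2≢0 n 1# q⋆1≡0)

    x+x≡0 : ∀ x → x + x ≡ 0#
    x+x≡0 x = trans (cong₂ _+_ (sym (R.*-identityˡ x)) (sym (R.*-identityˡ x)))
      (trans (sym (R.distribʳ x 1# 1#)) (trans (cong (_* x) 1+1≡0) (R.zeroˡ x)))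

    *-injective : ∀ {x} → x ≢ 0# → ∀ {y z} → x * y ≡ x * z → y ≡ z
    *-injective {x} x≢0 {y} {z} e = begin
      y              ≡⟨ R.+-identityʳ y ⟨
      y + 0#         ≡⟨ cong (y +_) (x+x≡0 z) ⟨
      y + (z + z)    ≡⟨ R.+-assoc y z z ⟨
      y + z + z      ≡⟨ cong (_+ z) (cancel x≢0 (trans (R.distribˡ x y z) (trans (cong (_+ x * z) e) (x+x≡0 (x * z))))) ⟩
      0# + z         ≡⟨ R.+-identityˡ z ⟩
      z              ∎
      where open ≡-Reasoning

    -- The field inverse presupposes apartness from zero, which is not yet known for a nonzero `x`.
    -- Counting supplies an inverse instead: multiplication by `x` is injective and so attains `1#`.
    inverse : ∀ x → ∃[ y ] (x ≢ 0# → x * y ≡ 1#)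
    inverse x with x Fin.≟ 0#
    ... | yes x≡0 = 0# , contradiction x≡0
    ... | no x≢0 with y , xy≡1 ← injective⇒surjective (*-injective x≢0) 1# = y , λ _ → xy≡1

  𝔽 : FiniteField₂ q
  𝔽 = record
    { _+_ = _+_ ; _*_ = _*_ ; 0# = 0# ; 1# = 1# ; _⁻¹ = proj₁ ∘ inverse
    ; isCommutativeSemiring = R.isCommutativeSemiring
    ; x+x≡0 = x+x≡0
    ; 1≢0 = 1≢0
    ; *-inverseʳ = λ {x} → proj₂ (inverse x)
    }

  -- The inverse found by counting is what proves apartness.
  ≢0⇒#0 : ∀ {k} → k ≢ FiniteField₂.0# 𝔽 → from k # F.0#
  ≢0⇒#0 {k} k≢0 = F.invertible⇒# (from i , F.trans (F.*-congˡ k-0≈k) (F.trans (F.*-comm _ _) unit) , F.trans (F.*-congʳ k-0≈k) unit)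
    where
    i = proj₁ (inverse k)
    k-0≈k = HeytingProperties.x-0≈x heytingCommutativeRing (from k)
    unit : from k F.* from i ≈ F.1#
    unit = F.trans (F.sym (from-to _)) (F.trans (F.reflexive (cong from (proj₂ (inverse k) k≢0))) (from-to F.1#))

  isomorphism : Isomorphism F 𝔽
  isomorphism = record
    { to = to ; from = from ; to-cong = to-cong ; to-from = to-from ; from-to = from-to
    ; from-+ = λ _ _ → from-to _ ; from-* = λ _ _ → from-to _ ; from-0 = from-to F.0#
    ; ≢0⇒#0 = ≢0⇒#0 }

-- Homogeneous coordinates in a basis adapted to the quadric

module Coordinates {c ℓ₁ ℓ₂} (F : HeytingField c ℓ₁ ℓ₂) {q} (𝔽 : FiniteField₂ q) (ψ : Isomorphism F 𝔽) where

  private module F = HeytingField F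
  open F using (_≈_; _#_)
  open ProjectiveSpace F hiding (PointSet; IsParabolicQuadric) renaming (_∼_ to _∼ₚ_)
  open SemiringSum (CommutativeRing.semiring (HeytingCommutativeRing.commutativeRing F.heytingCommutativeRing))
    using (sum; sum-cong-≋; ∑-distrib-+; *-distribˡ-sum)
  open VectorEquality F.setoid using (_≋_; ≋-sym; ≋-trans)
  open Isomorphism ψ
  open FieldTheory 𝔽
  open Forms 𝔽
  open Solids 𝔽

  combination-cong : ∀ {k m} {x y : Vector F.Carrier k} (e : Vector (Vector F.Carrier m) k) → x ≋ y → combination x e ≋ combination y e
  combination-cong e x≋y j = sum-cong-≋ (λ i → F.*-congʳ (x≋y i))

  combination-+ : ∀ {k m} (x y : Vector F.Carrier k) (e : Vector (Vector F.Carrier m) k) →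
    combination (λ i → x i F.+ y i) e ≋ (λ j → combination x e j F.+ combination y e j)
  combination-+ x y e j = F.trans (sum-cong-≋ (λ i → F.distribʳ (e i j) (x i) (y i))) (∑-distrib-+ (λ i → x i F.* e i j) (λ i → y i F.* e i j))

  combination-* : ∀ {k m} t (x : Vector F.Carrier k) (e : Vector (Vector F.Carrier m) k) →
    combination (λ i → t F.* x i) e ≋ (λ j → t F.* combination x e j)
  combination-* t x e j = F.trans (sum-cong-≋ (λ i → F.*-assoc t (x i) (e i j))) (F.sym (*-distribˡ-sum t (λ i → x i F.* e i j)))

  from4 : V → Vector F.Carrier 4
  from4 x 0F = from (z₁ x)
  from4 x 1F = from (z₂ x)
  from4 x 2F = from (z₃ x)
  from4 x 3F = from (z₄ x)

  to4 : Vector F.Carrier 4 → V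
  to4 x = ⟨ to (x 0F) , to (x 1F) , to (x 2F) , to (x 3F) ⟩

  from4-to4 : ∀ x → from4 (to4 x) ≋ x
  from4-to4 x 0F = from-to _
  from4-to4 x 1F = from-to _
  from4-to4 x 2F = from-to _
  from4-to4 x 3F = from-to _

  from4-injective : ∀ {x y} → from4 x ≋ from4 y → x ≡ y
  from4-injective e = cong₄ (from-injective (e 0F)) (from-injective (e 1F)) (from-injective (e 2F)) (from-injective (e 3F))

  from5 : W → Vector F.Carrier 5
  from5 (t , z) zero    = from t
  from5 (t , z) (suc i) = from4 z i

  to5 : Vector F.Carrier 5 → W
  to5 v = to (v zero) , to4 (v ∘ suc)

  from5-to5 : ∀ v → from5 (to5 v) ≋ v
  from5-to5 v zero    = from-to _
  from5-to5 v (suc i) = from4-to4 (v ∘ suc) i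

  from5-injective : ∀ {w w′} → from5 w ≋ from5 w′ → w ≡ w′
  from5-injective e = cong₂ _,_ (from-injective (e zero)) (from4-injective (e ∘ suc))

  to5-injective : ∀ {v v′} → to5 v ≡ to5 v′ → v ≋ v′
  to5-injective {v} {v′} e i = F.trans (F.sym (from5-to5 v i)) (F.trans (F.reflexive (cong (λ w → from5 w i) e)) (from5-to5 v′ i))

  opaque
    unfolding _⊕_

    from4-⊕ : ∀ x y → from4 (x ⊕ y) ≋ (λ i → from4 x i F.+ from4 y i)
    from4-⊕ x y 0F = from-+ _ _
    from4-⊕ x y 1F = from-+ _ _
    from4-⊕ x y 2F = from-+ _ _
    from4-⊕ x y 3F = from-+ _ _

    from4-· : ∀ k x → from4 (k · x) ≋ (λ i → from k F.* from4 x i)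
    from4-· k x 0F = from-* _ _
    from4-· k x 1F = from-* _ _
    from4-· k x 2F = from-* _ _
    from4-· k x 3F = from-* _ _

    from4-0 : from4 0v ≋ (λ _ → F.0#)
    from4-0 0F = from-0
    from4-0 1F = from-0
    from4-0 2F = from-0
    from4-0 3F = from-0

  from5-⊕ : ∀ w w′ → from5 (w ⊕w w′) ≋ (λ i → from5 w i F.+ from5 w′ i)
  from5-⊕ w w′ zero    = from-+ _ _
  from5-⊕ w w′ (suc i) = from4-⊕ (proj₂ w) (proj₂ w′) i

  from5-· : ∀ k w → from5 (k ·w w) ≋ (λ i → from k F.* from5 w i)
  from5-· k w zero    = from-* _ _
  from5-· k w (suc i) = from4-· k (proj₂ w) i

  from5-0 : from5 0w ≋ (λ _ → F.0#)
  from5-0 zero    = from-0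
  from5-0 (suc i) = from4-0 i

  x+x≈0 : ∀ x → x F.+ x ≈ F.0#
  x+x≈0 x = F.trans (F.+-cong (F.sym (from-to x)) (F.sym (from-to x)))
    (F.trans (F.sym (from-+ (to x) (to x))) (F.trans (F.reflexive (cong from (x+x≡0 (to x)))) from-0))

  module Basis (E : Subspace 4 4) where

    vector : W → Vector F.Carrier 5
    vector w = combination (from5 w) (basis E)

    vector-⊕ : ∀ w w′ → vector (w ⊕w w′) ≋ (λ j → vector w j F.+ vector w′ j)
    vector-⊕ w w′ = ≋-trans (combination-cong (basis E) (from5-⊕ w w′)) (combination-+ (from5 w) (from5 w′) (basis E))

    vector-· : ∀ k w → vector (k ·w w) ≋ (λ j → from k F.* vector w j)
    vector-· k w = ≋-trans (combination-cong (basis E) (from5-· k w)) (combination-* (from k) (from5 w) (basis E))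

    vector-0 : ∀ {w} → vector w ≋ (λ _ → F.0#) → w ≡ 0w
    vector-0 e = from5-injective (≋-trans (independent E _ e) (≋-sym from5-0))

    vector-0w : vector 0w ≋ (λ _ → F.0#)
    vector-0w j = F.trans (F.reflexive (cong (λ w → vector w j) (sym (cong₂ _,_ (x+x≡0 0#) (⊕-self 0v))))) (F.trans (vector-⊕ 0w 0w j) (x+x≈0 (vector 0w j)))

    vector-injective : ∀ {w w′} → vector w ≋ vector w′ → w ≡ w′
    vector-injective {w} {w′} e = from-sum (vector-0 (≋-trans (vector-⊕ w w′)
      λ j → F.trans (F.+-congʳ (e j)) (x+x≈0 (vector w′ j))))
      where
      from-sum : ∀ {w w′} → w ⊕w w′ ≡ 0w → w ≡ w′
      from-sum e = cong₂ _,_ (x+y≡0⇒x≡y (cong proj₁ e)) (x⊕y≡0⇒x≡y (cong proj₂ e))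

    private
      opaque
        W-finite : W ↔ Fin (q ℕ.* ((q ℕ.* q) ℕ.* (q ℕ.* q)))
        W-finite = ↔-sym Fin.*↔× ↔-∘ (↔-id K ×-↔ V-finite)

      entries : W → W
      entries w = to5 (vector w)

      entries-injective : Injective _≡_ _≡_ entries
      entries-injective e = vector-injective (to5-injective e)

      -- Independence makes `entries` injective, and counting makes it onto: five independent
      -- vectors span the space.
      coord-exists : ∀ v → ∃[ w ] entries w ≡ to5 v
      coord-exists v = finite-injective⇒surjective W-finite {f = entries} entries-injective (to5 v)

    opaque
      coord : Vector F.Carrier 5 → W
      coord v = proj₁ (coord-exists v)

      vector-coord : ∀ v → vector (coord v) ≋ v
      vector-coord v = to5-injective (proj₂ (coord-exists v))

    coord-unique : ∀ {v w} → v ≋ vector w → coord v ≡ w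
    coord-unique {v} e = vector-injective (≋-trans (vector-coord v) e)

    coord-injective : ∀ {v v′} → coord v ≡ coord v′ → v ≋ v′
    coord-injective {v} {v′} e = ≋-trans (≋-sym (vector-coord v)) (λ j → F.trans (F.reflexive (cong (λ w → vector w j) e)) (vector-coord v′ j))

    coordₚ : Point 4 → W
    coordₚ p = coord (vec p)

    module _ {p p′ : Point 4} where

      ∼⇒coord : p ∼ₚ p′ → ∃[ k ] k ≢ 0# × coordₚ p ≡ k ·w coordₚ p′
      ∼⇒coord (t , t#0 , e) = to t , (λ tt≡0 → #-irrefl (F.trans (F.trans (F.sym (from-to t)) (F.reflexive (cong from tt≡0))) from-0) t#0) ,
        coord-unique (λ j → F.trans (e j) (F.trans (F.*-cong (F.sym (from-to t)) (F.sym (vector-coord (vec p′) j))) (F.sym (vector-· (to t) (coordₚ p′) j))))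
        where open F using (#-irrefl)

      coord⇒∼ : ∀ {k} → k ≢ 0# → coordₚ p ≡ k ·w coordₚ p′ → p ∼ₚ p′
      coord⇒∼ {k} k≢0 e = from k , ≢0⇒#0 k≢0 , λ j → F.trans (F.sym (vector-coord (vec p) j)) (F.trans (F.reflexive (cong (λ w → vector w j) e))
        (F.trans (vector-· k (coordₚ p′) j) (F.*-congˡ (vector-coord (vec p′) j))))

    coordₚ-≢0 : ∀ p → coordₚ p ≢ 0w
    coordₚ-≢0 p e = let i , vi#0 = nonzero p in F.#-irrefl (vec≈0 i) vi#0
      where
      vec≈0 : vec p ≋ (λ _ → F.0#)
      vec≈0 = ≋-trans (≋-sym (vector-coord (vec p))) (λ j → F.trans (F.reflexive (cong (λ w → vector w j) e))
        (vector-0w j))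

    private
      nonzero-entry : ∀ {v} → to5 v ≢ 0w → ∃[ i ] v i # F.0#
      nonzero-entry {v} v≢0 with Fin.any? (λ i → ¬? (to (v i) ≟ 0#))
      ... | yes (i , vi≢0) = i , HeytingProperties.#-congʳ F.heytingCommutativeRing (from-to (v i)) (≢0⇒#0 vi≢0)
      ... | no all0 = contradiction (from5-injective (λ i → F.trans (from5-to5 v i) (F.trans (vi≈0 i) (F.sym (from5-0 i))))) v≢0
        where
        vi≈0 : ∀ i → v i ≈ F.0#
        vi≈0 i = F.trans (F.sym (from-to (v i))) (F.trans (F.reflexive (cong from (decidable-stable (to (v i) ≟ 0#) (λ ne → all0 (i , ne))))) from-0)

    point : ∀ w → w ≢ 0w → Point 4
    point w w≢0 = record { vec = vector w ; nonzero = nonzero-entry λ e → w≢0 (vector-0 (≋-trans (≋-sym (from5-to5 (vector w))) (λ i → F.trans (F.reflexive (cong (λ w → from5 w i) e)) (from5-0 i)))) }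

    coord-point : ∀ w w≢0 → coordₚ (point w w≢0) ≡ w
    coord-point w w≢0 = coord-unique (λ _ → F.refl)

    opaque
      unfolding _⊕_

      from-parabolic : ∀ w → parabolicForm (from5 w) ≈ from (parabolic w)
      from-parabolic (t , z) = F.sym (F.trans (from-+ _ _) (F.trans (F.+-cong (from-* _ _) (F.trans (from-+ _ _) (F.+-cong (from-* _ _) (from-* _ _))))
        (F.sym (F.+-assoc _ _ _))))

    parabolicForm-cong : ∀ {x y} → x ≋ y → parabolicForm x ≈ parabolicForm y
    parabolicForm-cong e = F.+-cong (F.+-cong (F.*-cong (e 0F) (e 0F)) (F.*-cong (e 1F) (e 2F))) (F.*-cong (e 3F) (e 4F))

    quadric⇒ : ∀ {p} → zeroLocus E parabolicForm p → parabolic (coordₚ p) ≡ 0#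
    quadric⇒ {p} (x , e , fx≈0) = trans (cong parabolic coord≡) (from-injective (F.trans (F.sym (from-parabolic (to5 x)))
        (F.trans (parabolicForm-cong (from5-to5 x)) (F.trans fx≈0 (F.sym from-0)))))
      where
      coord≡ : coordₚ p ≡ to5 x
      coord≡ = coord-unique (≋-trans e (combination-cong (basis E) (≋-sym (from5-to5 x))))

    ⇒quadric : ∀ {p} → parabolic (coordₚ p) ≡ 0# → zeroLocus E parabolicForm p
    ⇒quadric {p} e = from5 (coordₚ p) , ≋-sym (vector-coord (vec p)) , F.trans (from-parabolic (coordₚ p)) (F.trans (F.reflexive (cong from e)) from-0)

    module _ (S : Subspace 3 4) where

      private
        m : Fin 4 → W
        m i = coord (basis S i)

        image : V → W
        image x = z₁ x ·w m 0F ⊕w (z₂ x ·w m 1F ⊕w (z₃ x ·w m 2F ⊕w (z₄ x ·w m 3F)))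

        vector-image : ∀ x → vector (image x) ≋ combination (from4 x) (basis S)
        vector-image x j = F.trans (step _ _) (F.+-cong (term 0F (z₁ x)) (F.trans (step _ _) (F.+-cong (term 1F (z₂ x))
            (F.trans (step _ _) (F.+-cong (term 2F (z₃ x)) (F.trans (term 3F (z₄ x)) (F.sym (F.+-identityʳ _))))))))
          where
          step : ∀ w w′ → vector (w ⊕w w′) j ≈ vector w j F.+ vector w′ j
          step w w′ = vector-⊕ w w′ j
          term : ∀ i k → vector (k ·w m i) j ≈ from k F.* basis S i j
          term i k = F.trans (vector-· k (m i) j) (F.*-congˡ (vector-coord (basis S i) j))

        combination-coord : ∀ x → coord (combination (from4 x) (basis S)) ≡ image x
        combination-coord x = coord-unique (≋-sym (vector-image x))

      solidOf : Solid
      solidOf = record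
        { map       = image
        ; map-⊕     = λ x y → vector-injective (≋-trans (vector-image (x ⊕ y)) (≋-trans (combination-cong (basis S) (from4-⊕ x y))
            (≋-trans (combination-+ (from4 x) (from4 y) (basis S)) (≋-trans (λ j → F.+-cong (F.sym (vector-image x j)) (F.sym (vector-image y j)))
              (≋-sym (vector-⊕ (image x) (image y)))))))
        ; map-·     = λ k x → vector-injective (≋-trans (vector-image (k · x)) (≋-trans (combination-cong (basis S) (from4-· k x))
            (≋-trans (combination-* (from k) (from4 x) (basis S)) (≋-trans (λ j → F.*-congˡ (F.sym (vector-image x j))) (≋-sym (vector-· k (image x)))))))
        ; injective = λ {x} {y} e → x⊕y≡0⇒x≡y (from4-injective (≋-trans (independent S _ (≋-trans (combination-cong (basis S) (from4-⊕ x y))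
            (≋-trans (combination-+ (from4 x) (from4 y) (basis S)) (λ j → F.trans (F.+-congʳ (F.trans (F.sym (vector-image x j))
              (F.trans (F.reflexive (cong (λ w → vector w j) e)) (vector-image y j)))) (x+x≈0 _))))) (≋-sym from4-0)))
        }

      vector-solidOf : ∀ x → vector (Solid.map solidOf x) ≋ combination (from4 x) (basis S)
      vector-solidOf = vector-image

      open Solid solidOf using (map)

      span⇒ : ∀ {p} → span S p → ∃[ x ] coordₚ p ≡ map x
      span⇒ (x , e) = to4 x , coord-unique (≋-trans e (≋-trans (combination-cong (basis S) (≋-sym (from4-to4 x))) (≋-sym (vector-image (to4 x)))))

      ⇒span : ∀ {p x} → coordₚ p ≡ map x → span S p
      ⇒span {p} {x} e = from4 x , coord-injective (trans e (sym (combination-coord x)))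

      module _ {f : Vector F.Carrier 4 → F.Carrier} (f-cong : ∀ {x y} → x ≋ y → f x ≈ f y) where

        zeroLocus⇒ : ∀ {p} → zeroLocus S f p → ∃[ x ] coordₚ p ≡ map x × f (from4 x) ≈ F.0#
        zeroLocus⇒ (x , e , fx≈0) = to4 x , coord-unique (≋-trans e (≋-trans (combination-cong (basis S) (≋-sym (from4-to4 x))) (≋-sym (vector-image (to4 x))))) ,
          F.trans (f-cong (from4-to4 x)) fx≈0

        ⇒zeroLocus : ∀ {p x} → coordₚ p ≡ map x → f (from4 x) ≈ F.0# → zeroLocus S f p
        ⇒zeroLocus {p} {x} e fx≈0 = from4 x , coord-injective (trans e (sym (combination-coord x))) , fx≈0

    module _ (M : Solid) where
      open Solid M

      private
        unit : Fin 4 → V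
        unit 0F = unit₁
        unit 1F = unit₂
        unit 2F = unit₃
        unit 3F = unit₄

        vectors : Vector (Vector F.Carrier 5) 4
        vectors i = vector (map (unit i))

        vectors-combination : ∀ x → combination (from4 x) vectors ≋ vector (map x)
        vectors-combination x j = F.sym (F.trans (F.reflexive (cong (λ x → vector (map x) j) (sym (expand x))))
            (F.trans (step _ _) (F.+-cong (term 0F (z₁ x)) (F.trans (step _ _) (F.+-cong (term 1F (z₂ x))
              (F.trans (step _ _) (F.+-cong (term 2F (z₃ x)) (F.trans (term 3F (z₄ x)) (F.sym (F.+-identityʳ _))))))))))
          where
          step : ∀ x y → vector (map (x ⊕ y)) j ≈ vector (map x) j F.+ vector (map y) j
          step x y = F.trans (F.reflexive (cong (λ w → vector w j) (map-⊕ x y))) (vector-⊕ (map x) (map y) j)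
          term : ∀ i k → vector (map (k · unit i)) j ≈ from k F.* vectors i j
          term i k = F.trans (F.reflexive (cong (λ w → vector w j) (map-· k (unit i)))) (vector-· k (map (unit i)) j)

      subspaceOf : Subspace 3 4
      subspaceOf = record
        { basis       = vectors
        ; independent = λ x e i → F.trans (F.sym (from4-to4 x i)) (F.trans (F.reflexive (cong (λ x → from4 x i) (injective (trans
            (vector-0 {map (to4 x)} (≋-trans (≋-sym (vectors-combination (to4 x))) (≋-trans (combination-cong vectors (from4-to4 x)) e)))
            (sym map-0))))) (from4-0 i))
        }

      map-subspaceOf : ∀ x → Solid.map (solidOf subspaceOf) x ≡ map x
      map-subspaceOf x = vector-injective (≋-trans (vector-solidOf subspaceOf x) (vectors-combination x))

-- Elliptic ovoids and their poles

module Ovoids {c ℓ₁ ℓ₂ r} (F : HeytingField c ℓ₁ ℓ₂) {q} (𝔽 : FiniteField₂ q) (ψ : Isomorphism F 𝔽)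
  (Q₀ : PointSet F 4 r) (Q₀-parabolic : IsParabolicQuadric F Q₀) where

  private module F = HeytingField F
  open F using (_≈_)
  open ProjectiveSpace F hiding (PointSet; IsParabolicQuadric) renaming (_∼_ to _∼ₚ_)
  open VectorEquality F.setoid using (_≋_)
  open Isomorphism ψ
  open FieldTheory 𝔽
  open Forms 𝔽
  open Tangency 𝔽
  open Solids 𝔽
  open Sections 𝔽
  open Coordinates F 𝔽 ψ
  open Basis (proj₁ Q₀-parabolic)
  open EllipticOvoids F Q₀ q

  private
    Q₀⇒ : ∀ {p} → p ∈ᵖ Q₀ → parabolic (coordₚ p) ≡ 0#
    Q₀⇒ {p} p∈Q₀ = quadric⇒ {p} (proj₁ (proj₂ Q₀-parabolic) p∈Q₀)

    ⇒Q₀ : ∀ {p} → parabolic (coordₚ p) ≡ 0# → p ∈ᵖ Q₀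
    ⇒Q₀ {p} e = proj₂ (proj₂ Q₀-parabolic) (⇒quadric {p} e)

    to-+ : ∀ x y → to (x F.+ y) ≡ to x + to y
    to-+ x y = from-injective (F.trans (from-to _) (F.trans (F.sym (F.+-cong (from-to x) (from-to y))) (F.sym (from-+ (to x) (to y)))))

    to-* : ∀ x y → to (x F.* y) ≡ to x * to y
    to-* x y = from-injective (F.trans (from-to _) (F.trans (F.sym (F.*-cong (from-to x) (from-to y))) (F.sym (from-* (to x) (to y)))))

    module _ (α β γ : F.Carrier) where

      ellipticForm-cong : ∀ {x y} → x ≋ y → ellipticForm α β γ x ≈ ellipticForm α β γ y
      ellipticForm-cong e = F.+-cong (F.*-cong (e 0F) (e 1F)) (F.+-cong (F.+-cong (F.*-congˡ (F.*-cong (e 2F) (e 2F)))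
        (F.*-congˡ (F.*-cong (e 2F) (e 3F)))) (F.*-congˡ (F.*-cong (e 3F) (e 3F))))

      to-ellipticForm : ∀ x → to (ellipticForm α β γ (from4 x)) ≡ ellipticᴷ (to α) (to β) (to γ) x
      to-ellipticForm x = trans (to-+ _ _) (cong₂ _+_ (product (z₁ x) (z₂ x)) (trans (to-+ _ _) (cong₂ _+_ (trans (to-+ _ _)
          (cong₂ _+_ (term α (z₃ x) (z₃ x)) (term β (z₃ x) (z₄ x)))) (term γ (z₄ x) (z₄ x)))))
        where
        product : ∀ k l → to (from k F.* from l) ≡ k * l
        product k l = trans (to-* _ _) (cong₂ _*_ (to-from k) (to-from l))
        term : ∀ c k l → to (c F.* (from k F.* from l)) ≡ to c * (k * l)
        term c k l = trans (to-* _ _) (cong (to c *_) (product k l))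

      ellipticForm≈0⇒ : ∀ {x} → ellipticForm α β γ (from4 x) ≈ F.0# → ellipticᴷ (to α) (to β) (to γ) x ≡ 0#
      ellipticForm≈0⇒ {x} e = trans (sym (to-ellipticForm x)) (trans (to-cong e) (trans (to-cong (F.sym from-0)) (to-from 0#)))

      ⇒ellipticForm≈0 : ∀ {x} → ellipticᴷ (to α) (to β) (to γ) x ≡ 0# → ellipticForm α β γ (from4 x) ≈ F.0#
      ⇒ellipticForm≈0 {x} e = F.trans (F.sym (from-to _)) (F.trans (F.reflexive (cong from (trans (to-ellipticForm x) e))) from-0)

      irreducible⇒ : IrreducibleBinaryForm α β γ → Irreducible (to α) (to β) (to γ)
      irreducible⇒ irr l0 l1 m₀ m₁ α≡ β≡ γ≡ = irr (from l0 , from l1 , from m₀ , from m₁ ,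
          lower α≡ (from-* l0 m₀) , lower β≡ (F.trans (from-+ _ _) (F.+-cong (from-* l0 m₁) (from-* l1 m₀))) , lower γ≡ (from-* l1 m₁))
        where
        lower : ∀ {x k y} → to x ≡ k → from k ≈ y → x ≈ y
        lower {x} e e′ = F.trans (F.sym (from-to x)) (F.trans (F.reflexive (cong from e)) e′)

      ⇒irreducible : Irreducible (to α) (to β) (to γ) → IrreducibleBinaryForm α β γ
      ⇒irreducible irr (l0 , l1 , m₀ , m₁ , α≈ , β≈ , γ≈) = irr (to l0) (to l1) (to m₀) (to m₁) (trans (to-cong α≈) (to-* _ _))
        (trans (to-cong β≈) (trans (to-+ _ _) (cong₂ _+_ (to-* _ _) (to-* _ _)))) (trans (to-cong γ≈) (to-* _ _))

    HasPole : EllipticOvoid → V → Set (c ⊔ ℓ₁ ⊔ ℓ₂ ⊔ r)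
    HasPole X a = ∀ p → (points X p → On a (coordₚ p)) × (On a (coordₚ p) → points X p)

    findPole : ∀ X → ∃[ a ] Frame a × HasPole X a
    findPole X = let E , span≐ , α , β , γ , irr , X≐ = elliptic X in find E span≐ α β γ irr X≐
      where
      find : ∀ E → span E ≐ span (solid X) → ∀ α β γ → IrreducibleBinaryForm α β γ →
        points X ≐ zeroLocus E (ellipticForm α β γ) → ∃[ a ] Frame a × HasPole X a
      find E span≐ α β γ irr X≐ = pole , pole-frame , λ p → X⇒ , ⇒X
        where
        -- `E` and `solid X` have the same span, but it is in the basis of `E` that the quadric has
        -- its normal form.
        M = solidOf E
        open Solid M using (map; injective; map-0)

        map-≢0 : ∀ {x} → x ≢ 0v → map x ≢ 0w
        map-≢0 x≢0 e = x≢0 (injective (trans e (sym map-0)))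

        φ : V → K
        φ = ellipticᴷ (to α) (to β) (to γ)

        singular⇒ : ∀ {x} → parabolic (map x) ≡ 0# → φ x ≡ 0#
        singular⇒ {x} e with x ≟v 0v
        -- The zero vector is not a projective point, so the equality of point sets does not speak
        -- of it.
        ... | yes x≡0 = trans (cong φ x≡0) (elliptic-0 (to α) (to β) (to γ))
        ... | no x≢0 = conclude (zeroLocus⇒ E (ellipticForm-cong α β γ) {p} (proj₁ X≐ (proj₁ span≐ {p} (⇒span E {p} p≡) , ⇒Q₀ {p} (trans (cong parabolic p≡) e))))
          where
          p = point (map x) (map-≢0 x≢0)
          p≡ : coordₚ p ≡ map x
          p≡ = coord-point (map x) (map-≢0 x≢0)
          conclude : ∃[ y ] coordₚ p ≡ map y × ellipticForm α β γ (from4 y) ≈ F.0# → φ x ≡ 0#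
          conclude (y , p≡′ , φy) = trans (cong φ (injective (trans (sym p≡) p≡′))) (ellipticForm≈0⇒ α β γ φy)

        ⇒singular : ∀ {x} → φ x ≡ 0# → parabolic (map x) ≡ 0#
        ⇒singular {x} e with x ≟v 0v
        ... | yes x≡0 = trans (cong parabolic (trans (cong map x≡0) map-0)) parabolic-0
        ... | no x≢0 = trans (cong parabolic (sym p≡)) (Q₀⇒ {p} (proj₂ (proj₂ X≐ (⇒zeroLocus E (ellipticForm-cong α β γ) {p} p≡ (⇒ellipticForm≈0 α β γ e)))))
          where
          p = point (map x) (map-≢0 x≢0)
          p≡ : coordₚ p ≡ map x
          p≡ = coord-point (map x) (map-≢0 x≢0)

        open EllipticSolid (to α) (to β) (to γ) (irreducible⇒anisotropic (to α) (to β) (to γ) (irreducible⇒ α β γ irr)) M singular⇒ ⇒singular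

        module _ {p : Point 4} where

          X⇒ : points X p → On pole (coordₚ p)
          X⇒ (p∈S , p∈Q₀) = conclude (span⇒ E {p} (proj₂ span≐ {p} p∈S))
            where
            conclude : ∃[ x ] coordₚ p ≡ map x → On pole (coordₚ p)
            conclude (x , p≡) = subst (On pole) (sym p≡lift) (lift-on (trans (cong parabolic (sym p≡lift)) (Q₀⇒ {p} p∈Q₀)))
              where
              p≡lift : coordₚ p ≡ lift pole (π x)
              p≡lift = trans p≡ (map≡ x)

          ⇒X : On pole (coordₚ p) → points X p
          ⇒X (t≡ , Qz) = let x , e = on-graph (proj₂ (coordₚ p)) in
            proj₁ span≐ {p} (⇒span E {p} (trans p≡lift (sym e))) , ⇒Q₀ {p} (trans (cong parabolic p≡lift) Qz)
            where
            p≡lift : coordₚ p ≡ lift pole (proj₂ (coordₚ p))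
            p≡lift = cong (_, proj₂ (coordₚ p)) t≡

  opaque
    pole : EllipticOvoid → V
    pole X = proj₁ (findPole X)

    frame : ∀ X → Frame (pole X)
    frame X = proj₁ (proj₂ (findPole X))

    points⇒on : ∀ {X p} → points X p → On (pole X) (coordₚ p)
    points⇒on {X} {p} = proj₁ (proj₂ (proj₂ (findPole X)) p)

    on⇒points : ∀ {X p} → On (pole X) (coordₚ p) → points X p
    on⇒points {X} {p} = proj₂ (proj₂ (proj₂ (findPole X)) p)

  private
    on⇒point-∈ : ∀ {X w} w≢0 → On (pole X) w → points X (point w w≢0)
    on⇒point-∈ {X} {w} w≢0 on = on⇒points {X} (subst (On (pole X)) (sym (coord-point w w≢0)) on)

    point-∈⇒on : ∀ {X w} w≢0 → points X (point w w≢0) → On (pole X) w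
    point-∈⇒on {X} {w} w≢0 p∈X = subst (On (pole X)) (coord-point w w≢0) (points⇒on {X} p∈X)

  same-pole⇒≈ : ∀ {X Y} → pole X ≡ pole Y → X ≈ₒ Y
  same-pole⇒≈ {X} {Y} e = mk≈ₒ ((λ {p} p∈X → on⇒points {Y} (subst (λ a → On a (coordₚ p)) e (points⇒on {X} p∈X))) ,
    (λ {p} p∈Y → on⇒points {X} (subst (λ a → On a (coordₚ p)) (sym e) (points⇒on {Y} p∈Y))))

  ≈⇒same-pole : ∀ {X Y} → X ≈ₒ Y → pole X ≡ pole Y
  ≈⇒same-pole {X} {Y} X≈Y = pole-unique (frame X) λ w≢0 on → point-∈⇒on {Y} w≢0 (proj₁ (samePoints X≈Y) (on⇒point-∈ {X} w≢0 on))

  -- The frame is a basis in which the section has the equation `st + α² + αβ + εβ² = 0`. That the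
  -- pole found for this ovoid is the given one follows from uniqueness.
  ovoid-with-pole : ∀ {a} → Frame a → ∃[ X ] pole X ≡ a
  ovoid-with-pole {a} G = X , sym (pole-unique G λ {w} w≢0 on → point-∈⇒on {X} w≢0 (⇒X (subst (On a) (sym (coord-point w w≢0)) on)))
    where
    S = subspaceOf (frameSolid G)
    map′≡ : ∀ x → Solid.map (solidOf S) x ≡ Solid.map (frameSolid G) x
    map′≡ = map-subspaceOf (frameSolid G)
    ε = Frame.ε G
    coefficients : ∀ x → ellipticᴷ (to (from 1#)) (to (from 1#)) (to (from ε)) x ≡ ellipticᴷ 1# 1# ε x
    coefficients x = cong₂ (λ u v → ellipticᴷ u u v x) (to-from 1#) (to-from ε)
    form : Vector F.Carrier 4 → F.Carrier
    form = ellipticForm (from 1#) (from 1#) (from ε)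
    form-cong : ∀ {x y} → x ≋ y → form x ≈ form y
    form-cong = ellipticForm-cong (from 1#) (from 1#) (from ε)
    irreducible : IrreducibleBinaryForm (from 1#) (from 1#) (from ε)
    irreducible = ⇒irreducible (from 1#) (from 1#) (from ε) (subst₂ (λ u v → Irreducible u u v) (sym (to-from 1#)) (sym (to-from ε)) (frame-irreducible G))
    section⇒zeroLocus : ∀ {p} → span S p × p ∈ᵖ Q₀ → zeroLocus S form p
    section⇒zeroLocus {p} (p∈S , p∈Q₀) = conclude (span⇒ S {p} p∈S)
      where
      conclude : ∃[ x ] coordₚ p ≡ Solid.map (solidOf S) x → zeroLocus S form p
      conclude (x , p≡) = ⇒zeroLocus S form-cong {p} p≡ (⇒ellipticForm≈0 (from 1#) (from 1#) (from ε)
        (trans (coefficients x) (trans (sym (frameSolid-parabolic G x)) (trans (cong parabolic (trans (sym (map′≡ x)) (sym p≡))) (Q₀⇒ {p} p∈Q₀)))))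
    zeroLocus⇒section : ∀ {p} → zeroLocus S form p → span S p × p ∈ᵖ Q₀
    zeroLocus⇒section {p} p∈Z = conclude (zeroLocus⇒ S form-cong {p} p∈Z)
      where
      conclude : ∃[ x ] coordₚ p ≡ Solid.map (solidOf S) x × form (from4 x) ≈ F.0# → span S p × p ∈ᵖ Q₀
      conclude (x , p≡ , φx) = ⇒span S {p} p≡ , ⇒Q₀ {p} (trans (cong parabolic (trans p≡ (map′≡ x)))
        (trans (frameSolid-parabolic G x) (trans (sym (coefficients x)) (ellipticForm≈0⇒ (from 1#) (from 1#) (from ε) φx))))
    X : EllipticOvoid
    X = record
      { solid = S
      ; elliptic = S , ≐-refl {x = span S} , from 1# , from 1# , from ε , irreducible , (section⇒zeroLocus , zeroLocus⇒section)
      }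
    ⇒X : ∀ {p} → On a (coordₚ p) → points X p
    ⇒X {p} (t≡ , Qz) = let x , e = frame-on-solid G (proj₂ (coordₚ p)) in
      ⇒span S {p} (trans p≡lift (trans (sym e) (sym (map′≡ x)))) , ⇒Q₀ {p} (trans (cong parabolic p≡lift) Qz)
      where
      p≡lift : coordₚ p ≡ lift a (proj₂ (coordₚ p))
      p≡lift = cong (_, proj₂ (coordₚ p)) t≡

  -- The factor `k` prescribes the common point only up to proportionality, so that a single `p` can
  -- serve all pairs of a rosette.
  tangent⇒meetExactlyIn : ∀ {X Y} p {k} → k ≢ 0# → pole X ~ pole Y → lift (pole X) (pole X ⊕ pole Y) ≡ k ·w coordₚ p → MeetExactlyIn p X Y
  tangent⇒meetExactlyIn {X} {Y} p {k} k≢0 X~Y w≡ = meet⇒∼ , ∼⇒meet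
    where
    meet⇒∼ : ∀ {p′} → points X p′ × points Y p′ → p′ ∼ₚ p
    meet⇒∼ {p′} (p′∈X , p′∈Y) =
      let l , l≢0 , p′≡ = tangent-meet (noLines (frame X)) X~Y (coordₚ-≢0 p′) (points⇒on {X} p′∈X) (points⇒on {Y} p′∈Y)
      in coord⇒∼ {p′} {p} (*-≢0 l≢0 k≢0) (trans p′≡ (trans (cong (l ·w_) w≡) (cong₂ _,_ (sym (*-assoc l k _)) (·-·-assoc l k _))))
    p≡ : coordₚ p ≡ k ⁻¹ ·w lift (pole X) (pole X ⊕ pole Y)
    p≡ = sym (trans (cong (k ⁻¹ ·w_) w≡) (cong₂ _,_ (trans (sym (*-assoc _ _ _)) (trans (cong (_* proj₁ (coordₚ p)) (trans (*-comm _ _) (*-inverseʳ k≢0))) (*-identityˡ _))) (⁻¹·-cancel _ k≢0)))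
    ∼⇒meet : ∀ {p′} → p′ ∼ₚ p → points X p′ × points Y p′
    ∼⇒meet {p′} p′∼p = let l , _ , p′≡ = ∼⇒coord {p′} {p} p′∼p ; onX , onY = tangent-on X~Y in
      on⇒points {X} (subst (On (pole X)) (sym (trans p′≡ (cong (l ·w_) p≡))) (on-scale {pole X} (on-scale {pole X} onX))) ,
      on⇒points {Y} (subst (On (pole Y)) (sym (trans p′≡ (cong (l ·w_) p≡))) (on-scale {pole Y} (on-scale {pole Y} onY)))

  ~⇒adjacent : ∀ {X Y} → pole X ~ pole Y → Adjacent X Y
  ~⇒adjacent {X} {Y} X~Y = (λ X≈Y → proj₁ X~Y (≈⇒same-pole X≈Y)) , p ,
      tangent⇒meetExactlyIn {X} {Y} p 1≢0 X~Y (sym (trans (cong₂ _,_ (*-identityˡ _) (1·x≡x _)) (coord-point w w≢0)))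
    where
    w = lift (pole X) (pole X ⊕ pole Y)
    w≢0 : w ≢ 0w
    w≢0 = lift-≢0 {pole X} (~⇒≢0 X~Y)
    p = point w w≢0

  adjacent⇒~ : ∀ {X Y} → Adjacent X Y → pole X ~ pole Y
  adjacent⇒~ {X} {Y} (X≉Y , p , meet) = meet-tangent {w = coordₚ p} (X≉Y ∘ same-pole⇒≈) (coordₚ-≢0 p) (points⇒on {X} (proj₁ p∈)) (points⇒on {Y} (proj₂ p∈)) only
    where
    p∈ : points X p × points Y p
    p∈ = proj₂ meet (coord⇒∼ {p} {p} 1≢0 (sym (cong₂ _,_ (*-identityˡ _) (1·x≡x _))))
    only : ∀ {w′} → w′ ≢ 0w → On (pole X) w′ → On (pole Y) w′ → ∃[ k ] w′ ≡ k ·w coordₚ p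
    only {w′} w′≢0 onX onY = let k , _ , e = ∼⇒coord {point w′ w′≢0} {p} (proj₁ meet (on⇒point-∈ {X} w′≢0 onX , on⇒point-∈ {Y} w′≢0 onY)) in
      k , trans (sym (coord-point w′ w′≢0)) e

  -- The value `B (a ⊕ k · x) x` does not depend on `k`, so all these sections pass through the
  -- point `lift a x`; the differences of their poles are multiples of the singular vector `x`.
  pencil-point : ∀ {a x} → x ≢ 0v → Q a x ≡ 0# → ∃[ p ] p ∈ᵖ Q₀ ×
    (∀ {X Y k l} → pole X ≡ a ⊕ k · x → pole Y ≡ a ⊕ l · x → k ≢ l → pole X ~ pole Y × MeetExactlyIn p X Y)
  pencil-point {a} {x} x≢0 Qx = p , ⇒Q₀ {p} (trans (cong parabolic (coord-point w w≢0)) Qx) , meet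
    where
    w = lift a x
    w≢0 : w ≢ 0w
    w≢0 = lift-≢0 {a} x≢0
    p = point w w≢0
    meet : ∀ {X Y k l} → pole X ≡ a ⊕ k · x → pole Y ≡ a ⊕ l · x → k ≢ l → pole X ~ pole Y × MeetExactlyIn p X Y
    meet {X} {Y} {k} {l} X≡ Y≡ k≢l = X~Y , tangent⇒meetExactlyIn {X} {Y} p k+l≢0 X~Y w≡
      where
      k+l≢0 : k + l ≢ 0#
      k+l≢0 = k≢l ∘ x+y≡0⇒x≡y
      singular : ∀ m → Q a (m · x) ≡ 0#
      singular m = Q-·-singular m Qx
      difference : pole X ⊕ pole Y ≡ (k + l) · x
      difference = trans (cong₂ _⊕_ X≡ Y≡) (trans ([x⊕y]⊕[x⊕z]≡y⊕z a (k · x) (l · x)) (·-distrib-+ k l x))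
      X~Y : pole X ~ pole Y
      X~Y = subst₂ _~_ (sym X≡) (sym Y≡) (0or1⇒tangent (singular k) (singular l)
        (λ e → ·-≢0 k+l≢0 x≢0 (trans (sym (·-distrib-+ k l x)) (trans (cong (k · x ⊕_) (sym e)) (⊕-self _))))
        (inj₁ (trans (B-·ˡ k x _) (trans (cong (k *_) (B-self-·ʳ l x)) (zeroʳ k)))))
      w≡ : lift (pole X) (pole X ⊕ pole Y) ≡ (k + l) ·w coordₚ p
      w≡ = trans (cong (lift (pole X)) difference) (trans (cong (_, (k + l) · x) (trans (B-·ʳ (k + l) (pole X) x) (cong ((k + l) *_)
        (trans (cong (λ b → B b x) X≡) (trans (B-⊕ˡ a (k · x) x) (trans (cong (B a x +_) (B-self-·ˡ k x)) (+-identityʳ _)))))))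
        (cong ((k + l) ·w_) (sym (coord-point w w≢0))))

-- Cliques in a graph with decidable equality of vertices

module Cliques {a ℓ ℓ′} (S : Setoid a ℓ) (_≟_ : Decidable (Setoid._≈_ S)) (Adj : Rel (Setoid.Carrier S) ℓ′)
  (Adj-sym : Symmetric Adj) (Adj-respʳ : Adj Respectsʳ Setoid._≈_ S) (Adj⇒≉ : ∀ {x y} → Adj x y → ¬ Setoid._≈_ S x y) where

  open Setoid S using (Carrier; _≈_) renaming (refl to ≈-refl; sym to ≈-sym; trans to ≈-trans)
  open Membership S using (_∈_; _∉_; find)
  open Subset S using (_⊆_)

  private
    vertexSetoid : DecSetoid a ℓ
    vertexSetoid = record { isDecEquivalence = record { isEquivalence = Setoid.isEquivalence S ; _≟_ = _≟_ } }

  open DecMembership vertexSetoid using (_∈?_)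

  Clique : List Carrier → Set (a ⊔ ℓ′)
  Clique = AllPairs Adj

  private
    remove : ∀ {x ys} → x ∈ ys → ∃[ zs ] length ys ≡ suc (length zs) × (∀ {y} → y ∈ ys → ¬ y ≈ x → y ∈ zs)
    remove {x} {y ∷ ys} (here x≈y) = ys , refl , λ { (here z≈y) z≉x → contradiction (≈-trans z≈y (≈-sym x≈y)) z≉x ; (there z∈ys) _ → z∈ys }
    remove {x} {y ∷ ys} (there x∈ys) with zs , len , keep ← remove x∈ys =
      y ∷ zs , cong suc len , λ { (here z≈y) _ → here z≈y ; (there z∈ys) z≉x → there (keep z∈ys z≉x) }

  All-∈ : ∀ {x y ys} → All (Adj x) ys → y ∈ ys → Adj x y
  All-∈ (xz ∷ _) (here y≈z) = Adj-respʳ (≈-sym y≈z) xz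
  All-∈ (_ ∷ xs) (there y∈ys) = All-∈ xs y∈ys

  common⇒∉ : ∀ {x ys} → All (Adj x) ys → x ∉ ys
  common⇒∉ x~ys x∈ys = Adj⇒≉ (All-∈ x~ys x∈ys) ≈-refl

  clique-⊆⇒length≤ : ∀ {C D} → Clique C → C ⊆ D → length C ≤ length D
  clique-⊆⇒length≤ [] _ = z≤n
  clique-⊆⇒length≤ {x ∷ C} {D} (x~C ∷ clique) C⊆D with zs , len , keep ← remove (C⊆D (here ≈-refl)) =
    subst (suc (length C) ≤_) (sym len)
      (s≤s (clique-⊆⇒length≤ clique λ y∈C → keep (C⊆D (there y∈C)) λ y≈x → Adj⇒≉ (All-∈ x~C y∈C) (≈-sym y≈x)))

  clique-adjacent : ∀ {C x y} → Clique C → x ∈ C → y ∈ C → ¬ x ≈ y → Adj x y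
  clique-adjacent (_ ∷ _) (here x≈z) (here y≈z) x≉y = contradiction (≈-trans x≈z (≈-sym y≈z)) x≉y
  clique-adjacent (z~C ∷ _) (here x≈z) (there y∈C) _ = Adj-sym (Adj-respʳ (≈-sym x≈z) (Adj-sym (All-∈ z~C y∈C)))
  clique-adjacent (z~C ∷ _) (there x∈C) (here y≈z) _ = Adj-respʳ (≈-sym y≈z) (Adj-sym (All-∈ z~C x∈C))
  clique-adjacent (_ ∷ clique) (there x∈C) (there y∈C) x≉y = clique-adjacent clique x∈C y∈C x≉y

  maximal⇒no-common : ∀ {C} → Clique C → (∀ D → Clique D → C ⊆ D → D ⊆ C) → ∀ x → ¬ All (Adj x) C
  maximal⇒no-common {C} clique maximal x x~C = common⇒∉ x~C (maximal (x ∷ C) (x~C ∷ clique) there (here ≈-refl))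

  module _ {C D} (C-clique : Clique C) (D-clique : Clique D) (len : length D ≡ suc (length C)) (C⊆D : C ⊆ D) where

    -- By length, `D` has a vertex outside `C`. A second one would give a clique inside `D` with two
    -- vertices more than `C`, again contradicting the length.
    new-vertex : ∃[ x ] All (Adj x) C × x ∈ D × D ⊆ x ∷ C
    new-vertex with All.all? (_∈? C) D
    ... | yes D⊆C = contradiction (subst (_≤ length C) len (clique-⊆⇒length≤ D-clique (lookup D⊆C))) ℕ.1+n≰n
      where
      lookup : ∀ {xs} → All (_∈ C) xs → xs ⊆ C
      lookup (x∈C ∷ _) (here y≈x) = ∈-resp-≈ S (≈-sym y≈x) x∈C
      lookup (_ ∷ xs) (there y∈xs) = lookup xs y∈xs
    ... | no D⊈C with x , x∈D , x∉C ← find (¬All⇒Any¬ (_∈? C) D D⊈C) = x , x~C , x∈D , D⊆x∷C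
      where
      adjacent-to : ∀ {z} → z ∈ D → z ∉ C → ∀ {ys} → ys ⊆ C → All (Adj z) ys
      adjacent-to z∈D z∉C {[]} _ = []
      adjacent-to z∈D z∉C {y ∷ ys} ys⊆C = clique-adjacent D-clique z∈D (C⊆D (ys⊆C (here ≈-refl)))
        (λ z≈y → z∉C (∈-resp-≈ S (≈-sym z≈y) (ys⊆C (here ≈-refl)))) ∷ adjacent-to z∈D z∉C (ys⊆C ∘ there)
      x~C : All (Adj x) C
      x~C = adjacent-to x∈D x∉C id
      D⊆x∷C : D ⊆ x ∷ C
      D⊆x∷C {z} z∈D with z ∈? (x ∷ C)
      ... | yes z∈ = z∈
      ... | no z∉ = contradiction (subst (suc (suc (length C)) ≤_) len (clique-⊆⇒length≤ {z ∷ x ∷ C}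
              ((clique-adjacent D-clique z∈D x∈D (z∉ ∘ here) ∷ adjacent-to z∈D (z∉ ∘ there) id) ∷ x~C ∷ C-clique)
              λ { (here y≈z) → ∈-resp-≈ S (≈-sym y≈z) z∈D ; (there (here y≈x)) → ∈-resp-≈ S (≈-sym y≈x) x∈D ; (there (there y∈C)) → C⊆D y∈C })) ℕ.1+n≰n

  -- Cliques with one vertex more than `C` correspond to common neighbours of `C`, so an enumeration
  -- `κ` of the latter counts the former. Although cliques are compared by mutual inclusion, the
  -- added vertex can be recovered, since a common neighbour never lies in `C`.
  extensions : ∀ {k p C} {P : Pred (List Carrier) p} → Clique C →
    (∀ {D} → P D → Clique D × length D ≡ suc (length C)) →
    (κ : Fin k → Carrier) → (∀ i → All (Adj (κ i)) C) → (∀ {i j} → κ i ≈ κ j → i ≡ j) →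
    (∀ {x} → All (Adj x) C → ∃[ i ] κ i ≈ x) → (∀ i → P (κ i ∷ C)) →
    HasCardinality (subsetoid (InducedEquivalence (⊆-preorder S)) (λ D → P D × C ⊆ D)) k
  extensions {k} {_} {C} {P} C-clique P⇒clique κ κ~C κ-injective κ-surjective P-κ = record
    { to        = λ (_ , PD , C⊆D) → proj₁ (index PD C⊆D)
    ; from      = λ i → κ i ∷ C , P-κ i , there
    ; to-cong   = λ { {D , PD , C⊆D} {D′ , PD′ , C⊆D′} (D⊆D′ , _) →
                    determined (D⊆D′ (proj₁ (proj₂ (index PD C⊆D)))) (proj₂ (proj₂ (index PD′ C⊆D′))) }
    ; from-cong = λ { refl → id , id }
    ; inverse   = (λ { {i} {D , PD , C⊆D} (D⊆ , _) → determined (D⊆ (proj₁ (proj₂ (index PD C⊆D)))) id })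
                , (λ { {D , PD , C⊆D} refl →
                    (λ { (here y≈) → ∈-resp-≈ S (≈-sym y≈) (proj₁ (proj₂ (index PD C⊆D))) ; (there y∈C) → C⊆D y∈C }) , proj₂ (proj₂ (index PD C⊆D)) })
    }
    where
    index : ∀ {D} → P D → C ⊆ D → ∃[ i ] κ i ∈ D × D ⊆ κ i ∷ C
    index PD C⊆D with D-clique , len ← P⇒clique PD with x , x~C , x∈D , D⊆x∷C ← new-vertex C-clique D-clique len C⊆D with i , κi≈x ← κ-surjective x~C =
      i , ∈-resp-≈ S (≈-sym κi≈x) x∈D , λ y∈D → replace (D⊆x∷C y∈D)
      where
      replace : ∀ {y} → y ∈ x ∷ C → y ∈ κ i ∷ C
      replace (here y≈x) = here (≈-trans y≈x (≈-sym κi≈x))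
      replace (there y∈C) = there y∈C
    determined : ∀ {i j D} → κ i ∈ D → D ⊆ κ j ∷ C → i ≡ j
    determined {i} κi∈D D⊆ with D⊆ κi∈D
    ... | here κi≈κj = κ-injective κi≈κj
    ... | there κi∈C = contradiction κi∈C (common⇒∉ (κ~C i))

-- Powers of 2 modulo 3

4^k%3≡1 : ∀ k → 2 ^ (k ℕ.* 2) % 3 ≡ 1
4^k%3≡1 zero = refl
4^k%3≡1 (suc k) = trans (cong (_% 3) (sym (ℕ.*-assoc 2 2 (2 ^ (k ℕ.* 2)))))
  (trans (%-distribˡ-* 4 (2 ^ (k ℕ.* 2)) 3) (cong (λ m → (1 ℕ.* m) % 3) (4^k%3≡1 k)))

even⇒2^n%3≡1 : ∀ {n} → 2 ∣ n → 2 ^ n % 3 ≡ 1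
even⇒2^n%3≡1 (divides k refl) = 4^k%3≡1 k

odd⇒1+2k : ∀ {n} → 2 ∤ n → ∃[ k ] n ≡ suc (k ℕ.* 2)
odd⇒1+2k {n} 2∤n with n % 2 in eq | m%n<n n 2 | m≡m%n+[m/n]*n n 2
... | 0 | _ | _ = contradiction (m%n≡0⇒n∣m n 2 eq) 2∤n
... | 1 | _ | e = n / 2 , e
... | suc (suc _) | s≤s (s≤s ()) | _

odd⇒2^n%3≡2 : ∀ {n} → 2 ∤ n → 2 ^ n % 3 ≡ 2
odd⇒2^n%3≡2 2∤n with k , refl ← odd⇒1+2k 2∤n =
  trans (%-distribˡ-* 2 (2 ^ (k ℕ.* 2)) 3) (cong (λ m → (2 ℕ.* m) % 3) (4^k%3≡1 k))

-- An odd `n` other than `1` is at least `3`, so `q` is at least `8`. This separates `q` from the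
-- size of the largest non-linear cliques.
odd⇒2^n>6 : ∀ {n} → 2 ∤ n → 2 ^ n > 2 → 2 ^ n > 6
odd⇒2^n>6 2∤n q>2 with odd⇒1+2k 2∤n
... | zero  , refl = contradiction q>2 (ℕ.<-irrefl refl)
... | suc k , refl = ℕ.≤-trans (ℕ.n≤1+n 7) (ℕ.^-monoʳ-≤ 2 (s≤s (s≤s (s≤s (z≤n {k ℕ.* 2})))))

-- Neighbours and cliques in the tangency graph

module TangencyGraph {c ℓ₁ ℓ₂ r} (F : HeytingField c ℓ₁ ℓ₂) {q} (𝔽 : FiniteField₂ q) (ψ : Isomorphism F 𝔽)
  (Q₀ : PointSet F 4 r) (Q₀-parabolic : IsParabolicQuadric F Q₀) where

  open FieldTheory 𝔽
  open Forms 𝔽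
  open Tangency 𝔽
  open Ovoids F 𝔽 ψ Q₀ Q₀-parabolic
  open EllipticOvoids F Q₀ q

  _≟ₒ_ : (X Y : EllipticOvoid) → Dec (X ≈ₒ Y)
  X ≟ₒ Y = map′ same-pole⇒≈ ≈⇒same-pole (pole X ≟v pole Y)

  Adjacent-sym : ∀ {X Y} → Adjacent X Y → Adjacent Y X
  Adjacent-sym {X} {Y} X~Y = ~⇒adjacent {Y} {X} (~-sym (adjacent⇒~ {X} {Y} X~Y))

  Adjacent-respʳ : ∀ {X Y Z} → Y ≈ₒ Z → Adjacent X Y → Adjacent X Z
  Adjacent-respʳ {X} {Y} {Z} Y≈Z X~Y = ~⇒adjacent {X} {Z} (subst (pole X ~_) (≈⇒same-pole Y≈Z) (adjacent⇒~ {X} {Y} X~Y))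

  open Cliques ovoidSetoid _≟ₒ_ Adjacent (λ {X} {Y} → Adjacent-sym {X} {Y}) (λ {X} {Y} {Z} → Adjacent-respʳ {X} {Y} {Z}) (λ {X} {Y} (X≉Y , _) → X≉Y) public hiding (Clique)

  opaque
    ovoid : ∀ {a} → Frame a → EllipticOvoid
    ovoid G = proj₁ (ovoid-with-pole G)

    pole-ovoid : ∀ {a} (G : Frame a) → pole (ovoid G) ≡ a
    pole-ovoid G = proj₂ (ovoid-with-pole G)

  ell : ∀ X → NoLines (pole X)
  ell X = noLines (frame X)

  adjacent-ovoid : ∀ {a X} (G : Frame a) → pole X ~ a → Adjacent (ovoid G) X
  adjacent-ovoid {a} {X} G X~a = ~⇒adjacent {ovoid G} {X} (subst (_~ pole X) (sym (pole-ovoid G)) (~-sym X~a))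

  reverse-all : ∀ X {C} → All (λ Y → Adjacent Y X) C → All (Adjacent X) C
  reverse-all X [] = []
  reverse-all X {Y ∷ _} (YX ∷ C~X) = Adjacent-sym {Y} {X} YX ∷ reverse-all X C~X

  meets : ∀ {a} X Y → a ≡ pole Y → Adjacent X Y → a ~ pole X
  meets X Y a≡ XY = subst (_~ pole X) (sym a≡) (~-sym (adjacent⇒~ {X} {Y} XY))

  rosette⇒clique : ∀ {p R} → Rosette p R → Clique R
  rosette⇒clique {p} (_ , pairs) = AllPairs.map (λ (X≉Y , meet) → X≉Y , p , meet) pairs

  -- Flat cliques

  module _ {X Y} (X~Y : pole X ~ pole Y) where

    private
      a = pole X
      x = a ⊕ pole Y
      x≢0 : x ≢ 0v
      x≢0 = ~⇒≢0 X~Y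
      Qx : Q a x ≡ 0#
      Qx = proj₂ X~Y

      pencilFrame : ∀ k → Frame (a ⊕ k · x)
      pencilFrame k = shiftFrame {a} {k · x} (Q-·-singular k Qx) (frame X)

      opaque
        pencil : K → EllipticOvoid
        pencil k = ovoid (pencilFrame k)

        pole-pencil : ∀ k → pole (pencil k) ≡ a ⊕ k · x
        pole-pencil k = pole-ovoid (pencilFrame k)

        p : ProjectiveSpace.Point F 4
        p = proj₁ (pencil-point {a} {x} x≢0 Qx)

        p∈Q₀ : p ∈ᵖ Q₀
        p∈Q₀ = proj₁ (proj₂ (pencil-point {a} {x} x≢0 Qx))

        pencil-meet : ∀ {k l} → k ≢ l → pole (pencil k) ~ pole (pencil l) × MeetExactlyIn p (pencil k) (pencil l)
        pencil-meet {k} {l} = proj₂ (proj₂ (pencil-point {a} {x} x≢0 Qx)) {pencil k} {pencil l} (pole-pencil k) (pole-pencil l)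

      pencil-rosette : ∀ {k l} → k ≢ l → ¬ (pencil k ≈ₒ pencil l) × MeetExactlyIn p (pencil k) (pencil l)
      pencil-rosette {k} {l} k≢l = (λ k≈l → proj₁ (proj₁ (pencil-meet k≢l)) (≈⇒same-pole k≈l)) , proj₂ (pencil-meet k≢l)

      InPencil : EllipticOvoid → Set
      InPencil Z = ∃[ k ] pole Z ≡ a ⊕ k · x

      R : List EllipticOvoid
      R = tabulate pencil

      rosette : Rosette p R
      rosette = length-tabulate pencil , AllPairs.tabulate⁺ pencil-rosette

      inPencil⇒∈R : ∀ {C} → All InPencil C → C ⊆ R
      inPencil⇒∈R ((k , e) ∷ _) (here Z≈) = Any.tabulate⁺ k (same-pole⇒≈ (trans (≈⇒same-pole Z≈) (trans e (sym (pole-pencil k)))))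
      inPencil⇒∈R (_ ∷ all) (there Z∈) = inPencil⇒∈R all Z∈

      X-inPencil : InPencil X
      X-inPencil = 0# , sym (trans (cong (a ⊕_) (0·x≡0 x)) (⊕-identityʳ a))

      flat-inPencil : ∀ {Z} → pole X ~ pole Z → β a (pole Y) (pole Z) ≡ 0# → InPencil Z
      flat-inPencil {Z} X~Z flat = let k , e = ell X x≢0 Qx (proj₂ X~Z) flat in k , trans (sym (x⊕x⊕y≡y a (pole Z))) (cong (a ⊕_) e)

      others-inPencil : ∀ {Z rest} → pole X ~ pole Z → pole Y ~ pole Z → β a (pole Y) (pole Z) ≡ 0# →
        All (Adjacent X) rest → All (Adjacent Y) rest → All (Adjacent Z) rest → All InPencil rest
      others-inPencil X~Z Y~Z flat [] [] [] = []
      others-inPencil {Z} {W ∷ _} X~Z Y~Z flat (XW ∷ X~) (YW ∷ Y~) (ZW ∷ Z~) =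
        flat-inPencil {W} (adjacent⇒~ {X} {W} XW) (flat-propagates (ell X) X~Y X~Z (adjacent⇒~ {X} {W} XW) Y~Z (adjacent⇒~ {Y} {W} YW) (adjacent⇒~ {Z} {W} ZW) flat)
        ∷ others-inPencil {Z} X~Z Y~Z flat X~ Y~ Z~

    -- The rosette is the whole pencil of poles `a ⊕ k · x`, one for each `k` in the field. Its
    -- members are elliptic by `shiftFrame`.
    flat⇒linear : ∀ {Z rest} → Clique (X ∷ Y ∷ Z ∷ rest) → β a (pole Y) (pole Z) ≡ 0# → Linear (X ∷ Y ∷ Z ∷ rest)
    flat⇒linear {Z} ((_ ∷ XZ ∷ X~) ∷ (YZ ∷ Y~) ∷ Z~ ∷ _) flat = p , p∈Q₀ , R , rosette ,
      inPencil⇒∈R (X-inPencil ∷ flat-inPencil {Y} X~Y (B-self x) ∷ flat-inPencil {Z} X~Z flat ∷ others-inPencil {Z} X~Z (adjacent⇒~ {Y} {Z} YZ) flat X~ Y~ Z~)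
      where
      X~Z = adjacent⇒~ {X} {Z} XZ

  -- A rosette is a clique itself, so a maximal clique contained in it exhausts it.
  maximal-linear⇒length : ∀ {C} → MaximalClique C → Linear C → length C ≡ q
  maximal-linear⇒length (clique , maximal) (p , _ , R , rosette@(len , _) , C⊆R) =
    trans (ℕ.≤-antisym (clique-⊆⇒length≤ clique C⊆R) (clique-⊆⇒length≤ (rosette⇒clique {p} rosette) (maximal R (rosette⇒clique {p} rosette) C⊆R))) len

  nonlinear-⊇ : ∀ {C D} → C ⊆ D → NonLinear C → NonLinear D
  nonlinear-⊇ C⊆D nonlinear (p , p∈ , R , rosette , D⊆R) = nonlinear (p , p∈ , R , rosette , λ Z∈C → D⊆R (C⊆D Z∈C))

  -- Non-flat cliques: e and f are the differences to the second and third vertex, and the fourth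
  -- vertex is normalised to the point (1, 0) of the conic.

  record Star₃ (X Y Z : EllipticOvoid) : Set where
    field
      F₀ : Frame (pole X)
      e≡ : pole X ⊕ Frame.e F₀ ≡ pole Y
      f≡ : pole X ⊕ Frame.f F₀ ≡ pole Z

    vertex : K → K → V
    vertex = member F₀

    vertexFrame : ∀ {α β} → N F₀ α β ≡ 1# → Frame (vertex α β)
    vertexFrame N≡1 = shiftFrame (Q-11 F₀ N≡1) F₀

    vertex-ovoid : ∀ {α β} → N F₀ α β ≡ 1# → EllipticOvoid
    vertex-ovoid N≡1 = ovoid (vertexFrame N≡1)

    pole-vertex-ovoid : ∀ {α β} (N≡1 : N F₀ α β ≡ 1#) → pole (vertex-ovoid N≡1) ≡ vertex α β
    pole-vertex-ovoid N≡1 = pole-ovoid (vertexFrame N≡1)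

    vertex-common : ∀ {α β} (N≡1 : N F₀ α β ≡ 1#) → All (Adjacent (vertex-ovoid N≡1)) (X ∷ Y ∷ Z ∷ [])
    vertex-common {α} {β} N≡1 = adjacent-ovoid {X = X} G (member-~a F₀ N≡1) ∷ adjacent-ovoid {X = Y} G (subst (_~ vertex α β) e≡ (member-~e F₀ N≡1))
      ∷ adjacent-ovoid {X = Z} G (subst (_~ vertex α β) f≡ (member-~f F₀ N≡1)) ∷ []
      where
      G = vertexFrame N≡1

    OnConic : EllipticOvoid → Set
    OnConic W = ∃[ α ] ∃[ β ] N F₀ α β ≡ 1# × pole W ≡ vertex α β

    common⇒vertex : ∀ {W} → All (Adjacent W) (X ∷ Y ∷ Z ∷ []) → OnConic W
    common⇒vertex {W} (WX ∷ WY ∷ WZ ∷ []) = common₃ F₀ (meets W X refl WX) (meets W Y e≡ WY)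
      (meets W Z f≡ WZ)

  record Star₄ (X Y Z W : EllipticOvoid) : Set where
    field
      star₃ : Star₃ X Y Z
    open Star₃ star₃ public
    field
      g≡ : vertex 1# 0# ≡ pole W

    open Frame F₀ public using (ε; Qh∉℘)

    common⇒vertex₄ : ∀ {U} → All (Adjacent U) (X ∷ Y ∷ Z ∷ W ∷ []) → ∃[ α ] ℘ α ≡ ε + 1# × pole U ≡ vertex α 1#
    common⇒vertex₄ {U} (UX ∷ UY ∷ UZ ∷ UW ∷ []) = common₄ F₀ (meets U X refl UX) (meets U Y e≡ UY)
      (meets U Z f≡ UZ) (meets U W g≡ UW)

    module _ {s} (℘s : ℘ s ≡ ε + 1#) where

      fifth : EllipticOvoid
      fifth = vertex-ovoid (N-α1 F₀ ℘s)

      pole-fifth : pole fifth ≡ vertex s 1#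
      pole-fifth = pole-vertex-ovoid (N-α1 F₀ ℘s)

      fifth-common : All (Adjacent fifth) (X ∷ Y ∷ Z ∷ W ∷ [])
      fifth-common = prepend (vertex-common (N-α1 F₀ ℘s))
        where
        prepend : All (Adjacent fifth) (X ∷ Y ∷ Z ∷ []) → All (Adjacent fifth) (X ∷ Y ∷ Z ∷ W ∷ [])
        prepend (x ∷ y ∷ z ∷ []) = x ∷ y ∷ z ∷ adjacent-ovoid {X = W} (vertexFrame (N-α1 F₀ ℘s)) (subst (_~ vertex s 1#) g≡ (member-~member F₀ (N-10 F₀) (N-α1 F₀ ℘s) (det-10 F₀ s))) ∷ []

      ℘s+1 : ℘ (s + 1#) ≡ ε + 1#
      ℘s+1 = trans (℘x+1 s) ℘s

      common⇒vertex₅ : ∀ {U T} → pole U ≡ vertex s 1# → All (Adjacent T) (X ∷ Y ∷ Z ∷ W ∷ U ∷ []) → pole T ≡ vertex (s + 1#) 1#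
      common⇒vertex₅ {U} {T} U≡ (TX ∷ TY ∷ TZ ∷ TW ∷ TU ∷ []) = common₅ F₀ ℘s (meets T X refl TX) (meets T Y e≡ TY)
        (meets T Z f≡ TZ) (meets T W g≡ TW) (meets T U (sym U≡) TU)

    sixth-common : ∀ {s U} (℘s : ℘ s ≡ ε + 1#) → pole U ≡ vertex s 1# → All (Adjacent (fifth (℘s+1 ℘s))) (X ∷ Y ∷ Z ∷ W ∷ U ∷ [])
    sixth-common {s} {U} ℘s U≡ = append (fifth-common (℘s+1 ℘s))
      where
      T = fifth (℘s+1 ℘s)
      append : All (Adjacent T) (X ∷ Y ∷ Z ∷ W ∷ []) → All (Adjacent T) (X ∷ Y ∷ Z ∷ W ∷ U ∷ [])
      append (x ∷ y ∷ z ∷ w ∷ []) = x ∷ y ∷ z ∷ w ∷ adjacent-ovoid {X = U} (vertexFrame (N-α1 F₀ (℘s+1 ℘s))) (subst (_~ vertex (s + 1#) 1#) (sym U≡) (member-~member F₀ (N-α1 F₀ ℘s) (N-α1 F₀ (℘s+1 ℘s)) (det-s F₀ s))) ∷ []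

  private
    hyperbolic : ∀ {a b c} → a ~ b → a ~ c → β a b c ≡ 1# → HyperbolicPair a (a ⊕ b) (a ⊕ c)
    hyperbolic a~b a~c β≡1 = record { Qe = proj₂ a~b ; Qf = proj₂ a~c ; Bef = β≡1 }

  private
    buildStar₃ : ∀ {X Y Z} → Clique (X ∷ Y ∷ Z ∷ []) → β (pole X) (pole Y) (pole Z) ≡ 1# → Star₃ X Y Z
    buildStar₃ {X} {Y} {Z} ((XY ∷ XZ ∷ []) ∷ _) β≡1 = record
      { F₀ = proj₁ completed
      ; e≡ = trans (cong (pole X ⊕_) (proj₁ (proj₂ completed))) (x⊕x⊕y≡y _ _)
      ; f≡ = trans (cong (pole X ⊕_) (proj₂ (proj₂ completed))) (x⊕x⊕y≡y _ _)
      }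
      where
      completed = completeFrame₀ (ell X) (hyperbolic (adjacent⇒~ {X} {Y} XY) (adjacent⇒~ {X} {Z} XZ) β≡1)

    buildStar₄ : ∀ {X Y Z W} → Clique (X ∷ Y ∷ Z ∷ W ∷ []) → β (pole X) (pole Y) (pole Z) ≡ 1# → Star₄ X Y Z W
    buildStar₄ {X} {Y} {Z} {W} ((XY ∷ XZ ∷ XW ∷ []) ∷ (YZ ∷ YW ∷ []) ∷ (ZW ∷ []) ∷ _) β≡1 = record
      { star₃ = record
        { F₀ = G
        ; e≡ = trans (cong (a ⊕_) e≡) (x⊕x⊕y≡y _ _)
        ; f≡ = trans (cong (a ⊕_) f≡) (x⊕x⊕y≡y _ _)
        }
      ; g≡ = trans (cong (a ⊕_) at≡z) (x⊕x⊕y≡y a (pole W))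
      }
      where
      a = pole X
      x = a ⊕ pole Y
      y = a ⊕ pole Z
      z = a ⊕ pole W
      X~Y = adjacent⇒~ {X} {Y} XY
      X~Z = adjacent⇒~ {X} {Z} XZ
      X~W = adjacent⇒~ {X} {W} XW
      Y~Z = adjacent⇒~ {Y} {Z} YZ
      Y~W = adjacent⇒~ {Y} {W} YW
      Z~W = adjacent⇒~ {Z} {W} ZW
      Bxz : B x z ≡ 1#
      Bxz = spread-propagates (ell X) X~Y X~Z X~W Y~Z Y~W Z~W β≡1
      Byz : B y z ≡ 1#
      Byz = spread-propagates (ell X) X~Z X~Y X~W (~-sym Y~Z) Z~W Y~W (trans (B-comm y x) β≡1)
      -- Chosen to make `a + e + f + g`, the vertex at the point `(1, 0)` of the conic, the pole of
      -- `W`.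
      g = (x ⊕ y) ⊕ z
      Bxg : B x g ≡ 0#
      Bxg = trans (B-⊕ʳ x _ z) (trans (cong₂ _+_ (trans (B-⊕ʳ x x y) (cong₂ _+_ (B-self x) β≡1)) Bxz)
        (solve 0 (:0 :+ :1 :+ :1 := :0) refl))
      Byg : B y g ≡ 0#
      Byg = trans (B-⊕ʳ y _ z) (trans (cong₂ _+_ (trans (B-⊕ʳ y x y) (cong₂ _+_ (trans (B-comm y x) β≡1) (B-self y))) Byz)
        (solve 0 (:1 :+ :0 :+ :1 := :0) refl))
      Qg : Q a g ≡ 1#
      Qg = trans (Q-⊕ a (x ⊕ y) z) (trans (cong₂ _+_ (cong₂ _+_ (trans (Q-⊕ a x y) (cong₂ _+_ (cong₂ _+_ (proj₂ X~Y) (proj₂ X~Z)) β≡1)) (proj₂ X~W))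
          (trans (B-⊕ˡ x y z) (cong₂ _+_ Bxz Byz)))
        (solve 0 (:0 :+ :0 :+ :1 :+ :0 :+ (:1 :+ :1) := :1) refl))
      completed = completeFrame (ell X) (hyperbolic X~Y X~Z β≡1) Bxg Byg Qg
      G = proj₁ completed
      e≡ = proj₁ (proj₂ completed)
      f≡ = proj₁ (proj₂ (proj₂ completed))
      g≡ = proj₂ (proj₂ (proj₂ completed))
      at≡z : at G 1# 1# 1# 0# ≡ z
      at≡z = trans (cong₂ _⊕_ (cong₂ _⊕_ (trans (1·x≡x _) e≡) (trans (1·x≡x _) f≡)) (trans (cong₂ _⊕_ (trans (1·x≡x _) g≡) (0·x≡0 _)) (⊕-identityʳ g)))
        (x⊕x⊕y≡y (x ⊕ y) z)

  opaque
    star₃ : ∀ {X Y Z} → Clique (X ∷ Y ∷ Z ∷ []) → β (pole X) (pole Y) (pole Z) ≡ 1# → Star₃ X Y Z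
    star₃ = buildStar₃

    star₄ : ∀ {X Y Z W} → Clique (X ∷ Y ∷ Z ∷ W ∷ []) → β (pole X) (pole Y) (pole Z) ≡ 1# → Star₄ X Y Z W
    star₄ = buildStar₄

-- Sizes and numbers of cliques

module MaximalCliques {c ℓ₁ ℓ₂ r} (F : HeytingField c ℓ₁ ℓ₂) {q} (𝔽 : FiniteField₂ q) (ψ : Isomorphism F 𝔽)
  (Q₀ : PointSet F 4 r) (Q₀-parabolic : IsParabolicQuadric F Q₀) where

  open FieldTheory 𝔽
  open Forms 𝔽
  open Tangency 𝔽
  open Sections 𝔽 using (someFrame)
  open Ovoids F 𝔽 ψ Q₀ Q₀-parabolic
  open EllipticOvoids F Q₀ q
  open TangencyGraph F 𝔽 ψ Q₀ Q₀-parabolic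

  Spread : EllipticOvoid → EllipticOvoid → EllipticOvoid → Set
  Spread X Y Z = β (pole X) (pole Y) (pole Z) ≡ 1#

  no-common : ∀ {C X} → MaximalClique C → ¬ All (Adjacent X) C
  no-common {_} {X} (clique , maximal) = maximal⇒no-common clique maximal X

  linear⊎spread : ∀ {X Y Z rest} → Clique (X ∷ Y ∷ Z ∷ rest) → Linear (X ∷ Y ∷ Z ∷ rest) ⊎ Spread X Y Z
  linear⊎spread {X} {Y} {Z} clique@((XY ∷ XZ ∷ _) ∷ (YZ ∷ _) ∷ _) =
    Sum.map (flat⇒linear {X} {Y} X~Y clique) id (triangle X~Y (adjacent⇒~ {X} {Z} XZ) (adjacent⇒~ {Y} {Z} YZ))
    where
    X~Y : pole X ~ pole Y
    X~Y = adjacent⇒~ {X} {Y} XY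

  common-1 : ∀ X → ∃[ W ] All (Adjacent W) (X ∷ [])
  common-1 X = ovoid G , adjacent-ovoid {X = X} G (shift-~ (B≡1⇒≢0 Bef) Qe) ∷ []
    where
    open Frame (frame X) using (e; Qe; Bef)
    G : Frame (pole X ⊕ e)
    G = shiftFrame Qe (frame X)

  common-2 : ∀ {X Y} → Adjacent X Y → ∃[ W ] All (Adjacent W) (X ∷ Y ∷ [])
  common-2 {X} {Y} XY = build (completePair (ell X) (~⇒≢0 X~Y) (proj₂ X~Y))
    where
    X~Y : pole X ~ pole Y
    X~Y = adjacent⇒~ {X} {Y} XY
    x : V
    x = pole X ⊕ pole Y
    build : ∃[ f ] HyperbolicPair (pole X) x f → ∃[ W ] All (Adjacent W) (X ∷ Y ∷ [])
    build (f , pair) = ovoid G , adjacent-ovoid {X = X} G X~W ∷ adjacent-ovoid {X = Y} G Y~W ∷ []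
      where
      open HyperbolicPair pair using (Qf; Bef)
      G : Frame (pole X ⊕ f)
      G = shiftFrame Qf (frame X)
      X~W : pole X ~ pole X ⊕ f
      X~W = shift-~ (B≡1⇒≢0 (trans (B-comm f x) Bef)) Qf
      x≢f : x ≢ f
      x≢f x≡f = 1≢0 (trans (sym Bef) (trans (cong (B x) (sym x≡f)) (B-self x)))
      Y~W : pole Y ~ pole X ⊕ f
      Y~W = subst (_~ pole X ⊕ f) (x⊕x⊕y≡y (pole X) (pole Y)) (0or1⇒tangent (proj₂ X~Y) Qf x≢f (inj₂ Bef))

  data Shape : List EllipticOvoid → Set (c ⊔ ℓ₁ ⊔ ℓ₂ ⊔ r) where
    linear : ∀ {C} → Linear C → length C ≡ q → Shape C
    spread : ∀ {X Y Z rest} → Spread X Y Z → Shape (X ∷ Y ∷ Z ∷ rest)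

  -- Cliques with fewer than three vertices always have a common neighbour. A maximal clique
  -- therefore starts with a triangle, and the product at its first vertex decides the case.
  shape : ∀ {C} → MaximalClique C → Shape C
  shape {[]} maximal = contradiction [] (no-common {X = ovoid (proj₂ someFrame)} maximal)
  shape {X ∷ []} maximal = contradiction (proj₂ (common-1 X)) (no-common maximal)
  shape {X ∷ Y ∷ []} maximal@((XY ∷ []) ∷ _ , _) = contradiction (proj₂ (common-2 {X} {Y} XY)) (no-common maximal)
  shape {X ∷ Y ∷ Z ∷ rest} maximal@(clique , _) = Sum.[ (λ lin → linear lin (maximal-linear⇒length maximal lin)) , spread ] (linear⊎spread clique)

  first₄ : ∀ {X Y Z W rest} → Clique (X ∷ Y ∷ Z ∷ W ∷ rest) → Clique (X ∷ Y ∷ Z ∷ W ∷ [])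
  first₄ ((XY ∷ XZ ∷ XW ∷ _) ∷ (YZ ∷ YW ∷ _) ∷ (ZW ∷ _) ∷ _) = (XY ∷ XZ ∷ XW ∷ []) ∷ (YZ ∷ YW ∷ []) ∷ (ZW ∷ []) ∷ [] ∷ []

  spread-extends₃ : ∀ {X Y Z} → Clique (X ∷ Y ∷ Z ∷ []) → Spread X Y Z → ∃[ W ] All (Adjacent W) (X ∷ Y ∷ Z ∷ [])
  spread-extends₃ clique spr = vertex-ovoid (N-10 F₀) , vertex-common (N-10 F₀)
    where open Star₃ (star₃ clique spr)

  fifth-vertex : ∀ {X Y Z W U rest} (clique : Clique (X ∷ Y ∷ Z ∷ W ∷ U ∷ rest)) (spr : Spread X Y Z) →
    let open Star₄ (star₄ (first₄ clique) spr) in ∃[ s ] ℘ s ≡ ε + 1# × pole U ≡ vertex s 1#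
  fifth-vertex {X} {Y} {Z} {W} {U} clique@((_ ∷ _ ∷ _ ∷ XU ∷ _) ∷ (_ ∷ _ ∷ YU ∷ _) ∷ (_ ∷ ZU ∷ _) ∷ (WU ∷ _) ∷ _) spr =
    common⇒vertex₄ {U} (reverse-all U (XU ∷ YU ∷ ZU ∷ WU ∷ []))
    where open Star₄ (star₄ (first₄ clique) spr)

  module _ (q≡1 : q % 3 ≡ 1) where

    -- A fifth vertex would bring a solution of `℘ s ≡ ε + 1#`. Adding a cube root of unity `ω`, for
    -- which `℘ ω ≡ 1#`, would put `ε` into the image of `℘`.
    even-spread-length : ∀ {X Y Z rest} → MaximalClique (X ∷ Y ∷ Z ∷ rest) → Spread X Y Z → length (X ∷ Y ∷ Z ∷ rest) ≡ 4
    even-spread-length {rest = []} maximal@(clique , _) spr = contradiction (proj₂ (spread-extends₃ clique spr)) (no-common maximal)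
    even-spread-length {rest = _ ∷ []} _ _ = refl
    even-spread-length {rest = W ∷ U ∷ _} (clique , _) spr =
      let s , ℘s , _ = fifth-vertex clique spr ; ω , ℘ω = cubeRootOfUnity q≡1 in
      contradiction (trans (℘-+ s ω) (trans (cong₂ _+_ ℘s ℘ω) (solve 1 (λ ε → ε :+ :1 :+ :1 := ε) refl ε))) (Qh∉℘ (s + ω))
      where open Star₄ (star₄ (first₄ clique) spr) using (ε; Qh∉℘)

    even-maximal : ∀ {C} → MaximalClique C → (Linear C × length C ≡ q) ⊎ length C ≡ 4
    even-maximal maximal = conclude maximal (shape maximal)
      where
      conclude : ∀ {C} → MaximalClique C → Shape C → (Linear C × length C ≡ q) ⊎ length C ≡ 4
      conclude _ (linear lin len) = inj₁ (lin , len)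
      conclude maximal (spread spr) = inj₂ (even-spread-length maximal spr)

  module _ (q≡2 : q % 3 ≡ 2) where

    private
      1∉℘ : ∀ x → ℘ x ≢ 1#
      1∉℘ = no-cubeRootOfUnity q≡2

    -- Neither `1#` nor `ε` lies in the image of `℘`, which has index 2, so their sum does.
    spread-extends₄ : ∀ {X Y Z W} → Clique (X ∷ Y ∷ Z ∷ W ∷ []) → Spread X Y Z → ∃[ U ] All (Adjacent U) (X ∷ Y ∷ Z ∷ W ∷ [])
    spread-extends₄ clique spr = let s , ℘s = ℘-index 1∉℘ Qh∉℘ in fifth ℘s , fifth-common ℘s
      where open Star₄ (star₄ clique spr)

    spread-extends₅ : ∀ {X Y Z W U} → Clique (X ∷ Y ∷ Z ∷ W ∷ U ∷ []) → Spread X Y Z → ∃[ V ] All (Adjacent V) (X ∷ Y ∷ Z ∷ W ∷ U ∷ [])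
    spread-extends₅ {U = U} clique spr = let s , ℘s , U≡ = fifth-vertex clique spr in fifth (℘s+1 ℘s) , sixth-common {U = U} ℘s U≡
      where open Star₄ (star₄ (first₄ clique) spr)

    -- The first five vertices leave a single common neighbour, with parameter `s + 1`; a sixth and
    -- a seventh vertex would coincide.
    spread-no₇ : ∀ {X Y Z W U V T rest} → Clique (X ∷ Y ∷ Z ∷ W ∷ U ∷ V ∷ T ∷ rest) → ¬ Spread X Y Z
    spread-no₇ {X} {Y} {Z} {W} {U} {V} {T} clique@((_ ∷ _ ∷ _ ∷ _ ∷ XV ∷ XT ∷ _) ∷ (_ ∷ _ ∷ _ ∷ YV ∷ YT ∷ _) ∷ (_ ∷ _ ∷ ZV ∷ ZT ∷ _)
        ∷ (_ ∷ WV ∷ WT ∷ _) ∷ (UV ∷ UT ∷ _) ∷ (VT ∷ _) ∷ _) spr =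
      let s , ℘s , U≡ = fifth-vertex clique spr
          V≡ = common⇒vertex₅ ℘s {U} {V} U≡ (reverse-all V (XV ∷ YV ∷ ZV ∷ WV ∷ UV ∷ []))
          T≡ = common⇒vertex₅ ℘s {U} {T} U≡ (reverse-all T (XT ∷ YT ∷ ZT ∷ WT ∷ UT ∷ []))
      in proj₁ (adjacent⇒~ {V} {T} VT) (trans V≡ (sym T≡))
      where open Star₄ (star₄ (first₄ clique) spr)

    odd-spread-length≤6 : ∀ {X Y Z rest} → Clique (X ∷ Y ∷ Z ∷ rest) → Spread X Y Z → length (X ∷ Y ∷ Z ∷ rest) ≤ 6
    odd-spread-length≤6 {rest = []} _ _ = s≤s (s≤s (s≤s z≤n))
    odd-spread-length≤6 {rest = _ ∷ []} _ _ = s≤s (s≤s (s≤s (s≤s z≤n)))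
    odd-spread-length≤6 {rest = _ ∷ _ ∷ []} _ _ = s≤s (s≤s (s≤s (s≤s (s≤s z≤n))))
    odd-spread-length≤6 {rest = _ ∷ _ ∷ _ ∷ []} _ _ = ℕ.≤-refl
    odd-spread-length≤6 {rest = _ ∷ _ ∷ _ ∷ _ ∷ _} clique spr = contradiction spr (spread-no₇ clique)

    odd-spread-length : ∀ {X Y Z rest} → MaximalClique (X ∷ Y ∷ Z ∷ rest) → Spread X Y Z → length (X ∷ Y ∷ Z ∷ rest) ≡ 6
    odd-spread-length {rest = []} maximal@(clique , _) spr = contradiction (proj₂ (spread-extends₃ clique spr)) (no-common maximal)
    odd-spread-length {rest = _ ∷ []} maximal@(clique , _) spr = contradiction (proj₂ (spread-extends₄ clique spr)) (no-common maximal)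
    odd-spread-length {rest = _ ∷ _ ∷ []} maximal@(clique , _) spr = contradiction (proj₂ (spread-extends₅ clique spr)) (no-common maximal)
    odd-spread-length {rest = _ ∷ _ ∷ _ ∷ []} _ _ = refl
    odd-spread-length {rest = _ ∷ _ ∷ _ ∷ _ ∷ _} (clique , _) spr = contradiction spr (spread-no₇ clique)

    odd-maximal : ∀ {C} → MaximalClique C → (Linear C × length C ≡ q) ⊎ length C ≡ 6
    odd-maximal maximal = conclude maximal (shape maximal)
      where
      conclude : ∀ {C} → MaximalClique C → Shape C → (Linear C × length C ≡ q) ⊎ length C ≡ 6
      conclude _ (linear lin len) = inj₁ (lin , len)
      conclude maximal (spread spr) = inj₂ (odd-spread-length maximal spr)

    -- A clique starting with a spread triangle has at most 6 vertices, maximal or not, hence fewer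
    -- than `q`.
    odd-q-clique-linear : q > 6 → ∀ {C} → Clique C → length C ≡ q → Linear C
    odd-q-clique-linear q>6 {[]} _ refl = contradiction q>6 λ ()
    odd-q-clique-linear q>6 {_ ∷ []} _ refl = contradiction q>6 λ { (s≤s ()) }
    odd-q-clique-linear q>6 {_ ∷ _ ∷ []} _ refl = contradiction q>6 λ { (s≤s (s≤s ())) }
    odd-q-clique-linear q>6 {X ∷ Y ∷ Z ∷ rest} clique len =
      Sum.[ id , (λ spr → contradiction (odd-spread-length≤6 clique spr) (ℕ.<⇒≱ (subst (_> 6) (sym len) q>6))) ] (linear⊎spread clique)

    -- The fifth vertices correspond to the solutions of `℘ α ≡ ε + 1#`, which form one fibre
    -- `{s, s + 1}` of `℘`.
    spread-in-two-5-cliques : ∀ {X Y Z W} → Clique (X ∷ Y ∷ Z ∷ W ∷ []) → Spread X Y Z → ContainedInExactly 2 (CliqueOfSize 5) (X ∷ Y ∷ Z ∷ W ∷ [])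
    spread-in-two-5-cliques {X} {Y} {Z} {W} clique spr = extensions clique id κ κ-common κ-injective κ-surjective (λ i → κ-common i ∷ clique , refl)
      where
      open Star₄ (star₄ clique spr)
      s : K
      s = proj₁ (℘-index 1∉℘ Qh∉℘)
      ℘s : ℘ s ≡ ε + 1#
      ℘s = proj₂ (℘-index 1∉℘ Qh∉℘)
      κ : Fin 2 → EllipticOvoid
      κ 0F = fifth ℘s
      κ 1F = fifth (℘s+1 ℘s)
      κ-common : ∀ i → All (Adjacent (κ i)) (X ∷ Y ∷ Z ∷ W ∷ [])
      κ-common 0F = fifth-common ℘s
      κ-common 1F = fifth-common (℘s+1 ℘s)
      apart : ¬ κ 0F ≈ₒ κ 1F
      apart e = 1≢0 (sym (+-cancelˡ s (trans (+-identityʳ s)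
        (proj₁ (member-injective F₀ (trans (sym (pole-fifth ℘s)) (trans (≈⇒same-pole e) (pole-fifth (℘s+1 ℘s)))))))))
      κ-injective : ∀ {i j} → κ i ≈ₒ κ j → i ≡ j
      κ-injective {0F} {0F} _ = refl
      κ-injective {1F} {1F} _ = refl
      κ-injective {0F} {1F} e = contradiction e apart
      κ-injective {1F} {0F} e = contradiction (same-pole⇒≈ (sym (≈⇒same-pole e))) apart
      κ-surjective : ∀ {U} → All (Adjacent U) (X ∷ Y ∷ Z ∷ W ∷ []) → ∃[ i ] κ i ≈ₒ U
      κ-surjective {U} common = choose (common⇒vertex₄ {U} common)
        where
        choose : ∃[ α ] ℘ α ≡ ε + 1# × pole U ≡ vertex α 1# → ∃[ i ] κ i ≈ₒ U
        choose (α , ℘α , U≡) = Sum.[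
            (λ α≡s → 0F , same-pole⇒≈ (trans (pole-fifth ℘s) (trans (cong (λ α → vertex α 1#) (sym α≡s)) (sym U≡))))
          , (λ α≡s+1 → 1F , same-pole⇒≈ (trans (pole-fifth (℘s+1 ℘s)) (trans (cong (λ α → vertex α 1#) (sym α≡s+1)) (sym U≡))))
          ] (℘-fibres (trans ℘α (sym ℘s)))

    spread-in-one-6-clique : ∀ {X Y Z W U} → Clique (X ∷ Y ∷ Z ∷ W ∷ U ∷ []) → Spread X Y Z → ContainedInExactly 1 (CliqueOfSize 6) (X ∷ Y ∷ Z ∷ W ∷ U ∷ [])
    spread-in-one-6-clique {X} {Y} {Z} {W} {U} clique spr = extensions clique id (λ _ → T) (λ _ → T-common) (λ _ → unique)
        (λ {V} common → 0F , same-pole⇒≈ (trans (pole-fifth (℘s+1 ℘s)) (sym (common⇒vertex₅ ℘s {U} {V} U≡ common)))) (λ _ → T-common ∷ clique , refl)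
      where
      open Star₄ (star₄ (first₄ clique) spr)
      s : K
      s = proj₁ (fifth-vertex clique spr)
      ℘s : ℘ s ≡ ε + 1#
      ℘s = proj₁ (proj₂ (fifth-vertex clique spr))
      U≡ : pole U ≡ vertex s 1#
      U≡ = proj₂ (proj₂ (fifth-vertex clique spr))
      T : EllipticOvoid
      T = fifth (℘s+1 ℘s)
      T-common : All (Adjacent T) (X ∷ Y ∷ Z ∷ W ∷ U ∷ [])
      T-common = sixth-common {U = U} ℘s U≡
      unique : ∀ {i j : Fin 1} → i ≡ j
      unique {0F} {0F} = refl

  nonlinear⇒spread : ∀ {X Y Z rest} → Clique (X ∷ Y ∷ Z ∷ rest) → NonLinear (X ∷ Y ∷ Z ∷ rest) → Spread X Y Z
  nonlinear⇒spread clique nonlinear = Sum.[ (λ lin → contradiction lin nonlinear) , id ] (linear⊎spread clique)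

  -- A clique containing a non-linear one is non-linear, so every point of the conic contributes a
  -- clique to the count.
  spread-in-q+1-4-cliques : ∀ {X Y Z} → Clique (X ∷ Y ∷ Z ∷ []) → NonLinear (X ∷ Y ∷ Z ∷ []) → ContainedInExactly (suc q) (NonLinearCliqueOfSize 4) (X ∷ Y ∷ Z ∷ [])
  spread-in-q+1-4-cliques {X} {Y} {Z} clique nonlinear = extensions {P = NonLinearCliqueOfSize 4} clique proj₁ κ κ-common κ-injective κ-surjective larger
    where
    C : List EllipticOvoid
    C = X ∷ Y ∷ Z ∷ []
    open Star₃ (star₃ clique (nonlinear⇒spread clique nonlinear))
    opaque
      κ : Fin (suc q) → EllipticOvoid
      κ i = vertex-ovoid (conic-N F₀ i)

      pole-κ : ∀ i → pole (κ i) ≡ vertex (proj₁ (conic F₀ i)) (proj₂ (conic F₀ i))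
      pole-κ i = pole-vertex-ovoid (conic-N F₀ i)

      κ-common : ∀ i → All (Adjacent (κ i)) C
      κ-common i = vertex-common (conic-N F₀ i)

    larger : ∀ i → NonLinearCliqueOfSize 4 (κ i ∷ C)
    larger i = (κ-common i ∷ clique , refl) , nonlinear-⊇ {C} {κ i ∷ C} there nonlinear
    κ-injective : ∀ {i j} → κ i ≈ₒ κ j → i ≡ j
    κ-injective {i} {j} e = conic-injective F₀ (cong₂ _,_ (proj₁ αβ) (proj₂ αβ))
      where
      αβ : proj₁ (conic F₀ i) ≡ proj₁ (conic F₀ j) × proj₂ (conic F₀ i) ≡ proj₂ (conic F₀ j)
      αβ = member-injective F₀ (trans (sym (pole-κ i)) (trans (≈⇒same-pole e) (pole-κ j)))
    κ-surjective : ∀ {W} → All (Adjacent W) C → ∃[ i ] κ i ≈ₒ W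
    κ-surjective {W} common = choose (common⇒vertex {W} common)
      where
      choose : OnConic W → ∃[ i ] κ i ≈ₒ W
      choose (α , β , N≡1 , W≡) = i , same-pole⇒≈ (trans (pole-κ i) (trans (cong₂ vertex (cong proj₁ eq) (cong proj₂ eq)) (sym W≡)))
        where
        i : Fin (suc q)
        i = proj₁ (conic-surjective F₀ N≡1)
        eq : conic F₀ i ≡ (α , β)
        eq = proj₂ (conic-surjective F₀ N≡1)

  maximal-length<q⇒nonlinear : ∀ {C} → MaximalClique C → length C < q → NonLinear C
  maximal-length<q⇒nonlinear maximal len<q lin = ℕ.<-irrefl (maximal-linear⇒length maximal lin) len<q

theorem2 :
    ∀ {c ℓ₁ ℓ₂ r} (F : HeytingField c ℓ₁ ℓ₂) (n : ℕ) →
    HasCardinality (HeytingField.setoid F) (2 ^ n) →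
    (Q₀ : PointSet F 4 r) → IsParabolicQuadric F Q₀ →
    let q = 2 ^ n
        open EllipticOvoids F Q₀ q
    in
    (2 ∣ n →
      (∀ C → MaximalClique C → length C ≡ q ⊎ length C ≡ 4) ×
      (q > 4 →
        (∀ C → MaximalClique C → length C ≡ q → Linear C) ×
        (∀ C → MaximalClique C → length C ≡ 4 → NonLinear C)))
    ×
    (2 ∤ n → q > 2 →
      (∀ C → MaximalClique C → length C ≡ q ⊎ length C ≡ 6) ×
      (∀ C → CliqueOfSize q C → Linear C) ×
      (∀ C → MaximalClique C → length C ≡ 6 → NonLinear C))
    ×
    (∀ C → NonLinearCliqueOfSize 3 C → ContainedInExactly (suc q) (NonLinearCliqueOfSize 4) C)
    ×
    (2 ∤ n →
      (∀ C → NonLinearCliqueOfSize 4 C → ContainedInExactly 2 (CliqueOfSize 5) C) ×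
      (∀ C → NonLinearCliqueOfSize 5 C → ContainedInExactly 1 (CliqueOfSize 6) C))
theorem2 F n card Q₀ Q₀-parabolic =
    (λ 2∣n → let q%3≡1 = even⇒2^n%3≡1 2∣n in
      (λ C maximal → Sum.map proj₂ id (even-maximal q%3≡1 maximal)) ,
      (λ q>4 →
        (λ C maximal len → Sum.[ proj₁ , (λ len≡4 → contradiction q>4 (ℕ.<-irrefl (trans (sym len≡4) len))) ] (even-maximal q%3≡1 maximal)) ,
        (λ C maximal len → maximal-length<q⇒nonlinear maximal (subst (ℕ._< 2 ^ n) (sym len) q>4)))) ,
    (λ 2∤n q>2 → let q%3≡2 = odd⇒2^n%3≡2 2∤n ; q>6 = odd⇒2^n>6 2∤n q>2 in
      (λ C maximal → Sum.map proj₂ id (odd-maximal q%3≡2 maximal)) ,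
      (λ C (clique , len) → odd-q-clique-linear q%3≡2 q>6 clique len) ,
      (λ C maximal len → maximal-length<q⇒nonlinear maximal (subst (ℕ._< 2 ^ n) (sym len) q>6))) ,
    (λ { (X ∷ Y ∷ Z ∷ []) ((clique , _) , nonlinear) → spread-in-q+1-4-cliques clique nonlinear }) ,
    (λ 2∤n → let q%3≡2 = odd⇒2^n%3≡2 2∤n in
      (λ { (X ∷ Y ∷ Z ∷ W ∷ []) ((clique , _) , nonlinear) → spread-in-two-5-cliques q%3≡2 clique (nonlinear⇒spread clique nonlinear) }) ,
      (λ { (X ∷ Y ∷ Z ∷ W ∷ U ∷ []) ((clique , _) , nonlinear) → spread-in-one-6-clique q%3≡2 clique (nonlinear⇒spread clique nonlinear) }))
  where
  open FiniteHeytingField F n card using (𝔽; isomorphism)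
  open MaximalCliques F 𝔽 isomorphism Q₀ Q₀-parabolic
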